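{- There is a dynamic programming algorithm (\textsc{algorithm Trunks}) on the uniform-cost RAM which, given any instance of the optimum-BST-on-the-HMM problem with $n$ keys and a memory hierarchy with $h\ge 2$ levels of sizes $m_1,\dots,m_h$, constructs an optimum solution $\langle T^*,\phi^*\rangle$ in time $$O\!\left(\frac{2^{\,n-m_h}\,(n-m_h+h)^{\,n-m_h}\, n^3}{(h-2)!}\right).$$
   Context: Binary search trees. Given $n\ge 1$ keys $x_1\prec x_2\prec\cdots\prec x_n$ from a totally ordered universe, a binary search tree (BST) $T$ over the keys is an ordered rooted binary tree with $n$ internal nodes, identified with the keys so that an inorder traversal visits $x_1,\dots,x_n$ in order, and $n+1$ external nodes (leaves) $z_0,\dots,z_n$ from left to right, where $z_j$ represents the search arguments $y$ with $x_j\prec y\prec x_{j+1}$ (with the convention that $z_0$ means $y\prec x_1$ and $z_n$ means $y\succ x_n$). Also given are $p_i\ge 0$ ($1\le i\le n$), the probability that $y=x_i$, and $q_j\ge 0$ ($0\le j\le n$), the probability that $y$ falls in the interval of $z_j$; $\sum_i p_i+\sum_j q_j=1$. For a node $v$ of $T$, let $T_v$ be the subtree rooted at $v$ and let $w(T_v)$ be the sum of all $p_i$ and $q_j$ over the internal nodes $x_i$ and external nodes $z_j$ in $T_v$; in particular $w(T_{z_j})=q_j$. Hierarchical memory (HMM). There are $n$ memory locations with addresses $1,\dots,n$ partitioned into $h$ levels, level $l$ having $m_l$ locations, $\sum_{l=1}^h m_l=n$. A single access to a location in level $l$ costs $c_l\in\mathbb N$, where $c_1<c_2<\cdots<c_h$.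 The addresses are ordered from fastest to slowest, so $\mu(a)=c_l$ when $m_1+\cdots+m_{l-1}<a\le m_1+\cdots+m_l$. The problem. A solution is a pair $\langle T,\phi\rangle$ of a BST $T$ over the keys and a one-to-one memory assignment $\phi$ of the internal nodes of $T$ to the addresses $\{1,\dots,n\}$. External nodes are not stored; for an external node $z_j$, $\phi(z_j)$ denotes the address at which the parent of $z_j$ is stored. The cost of a solution (called the expected cost of a search) is $$\mathrm{cost}(\langle T,\phi\rangle)=\sum_{i=1}^n w(T_{x_i})\,\mu(\phi(x_i))+\sum_{j=0}^n w(T_{z_j})\,\mu(\phi(z_j)).$$ A solution is optimum if its cost is minimum over all pairs $\langle T,\phi\rangle$. The algorithm is given the $p_i$, $q_j$, $m_l$ and $c_l$. Uniform-cost RAM: each memory access, arithmetic operation and comparison on numbers takes unit time. -}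

module Defs where

open import Algebra.Bundles using (CommutativeRing)
import Algebra.Definitions.RawMonoid as RawMonoidDefs
open import Data.Bool.Base using (Bool; true; false; if_then_else_; _∧_; not)
open import Data.Fin.Base as Fin using (Fin; zero; suc; toℕ; fromℕ; inject₁; splitAt)
open import Data.Nat.Base as ℕ using (ℕ; zero; suc; _∸_)
import Data.Nat.Properties as ℕ using (_≟_; _≤?_)
open import Data.Sum.Base using ([_,_]′)
open import Function.Base using (_∘_; const)
open import Function.Definitions using (Injective)
open import Level using (Level; _⊔_) renaming (suc to lsuc)
open import Relation.Binary.Core using (Rel)
open import Relation.Binary.PropositionalEquality.Core using (_≡_)
open import Relation.Binary.Structures using (IsDecTotalOrder)
open import Relation.Nullary.Decidable.Core using (does)

------------------------------------------------------------------------
-- The numbers in which probabilities and costs are measured.  ℝ with the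
-- unit-time comparison of the RAM is the intended instance; ℚ is another.

record OrderedCommutativeRing c ℓ₁ ℓ₂ : Set (lsuc (c ⊔ ℓ₁ ⊔ ℓ₂)) where
  field
    commutativeRing : CommutativeRing c ℓ₁
  open CommutativeRing commutativeRing public
  infix 4 _≤_
  field
    _≤_             : Rel Carrier ℓ₂
    isDecTotalOrder : IsDecTotalOrder _≈_ _≤_
    +-monoʳ-≤       : ∀ x {y z} → y ≤ z → x + y ≤ x + z
    *-nonNeg        : ∀ {x y} → 0# ≤ x → 0# ≤ y → 0# ≤ x * y
  open IsDecTotalOrder isDecTotalOrder public
    using (_≟_; _≤?_; antisym; total; isTotalOrder; isPartialOrder; isPreorder)
    renaming (refl to ≤-refl; reflexive to ≤-reflexive; trans to ≤-trans)

  fromℕ# : ℕ → Carrier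
  fromℕ# n = RawMonoidDefs._×_ +-rawMonoid n 1#

  sum# : ∀ {n} → (Fin n → Carrier) → Carrier
  sum# = RawMonoidDefs.sum +-rawMonoid

sumℕ : ∀ {n} → (Fin n → ℕ) → ℕ
sumℕ = RawMonoidDefs.sum ℕ.+-0-rawMonoid

------------------------------------------------------------------------
-- Binary search trees.
--
-- There are n keys x₁ ≺ ⋯ ≺ xₙ; k : Fin n stands for the key x with
-- subscript toℕ k + 1, and j : Fin (suc n) for the external node z with
-- subscript toℕ j.  Tree i j is the type of binary search trees whose
-- external nodes, from left to right, are zᵢ , … , zⱼ, and whose internal
-- nodes in inorder are therefore xᵢ₊₁ , … , xⱼ.

data Tree {n : ℕ} : Fin (suc n) → Fin (suc n) → Set where
  leaf : ∀ j → Tree j j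
  node : ∀ {i j} (k : Fin n) → Tree i (inject₁ k) → Tree (suc k) j → Tree i j

BST : ℕ → Set
BST n = Tree {n} zero (fromℕ n)

------------------------------------------------------------------------
-- The memory hierarchy.  Addresses and levels are counted from 0, so
-- address 0 and level 0 are the fastest.

levelOf : ∀ {h} (m : Fin h → ℕ) → Fin (sumℕ m) → Fin h
levelOf {suc h} m a =
  [ const zero , suc ∘ levelOf (m ∘ suc) ]′ (splitAt (m zero) a)

------------------------------------------------------------------------
-- Programs of the uniform-cost RAM.
--
-- Memory consists of cells holding natural numbers and cells holding
-- elements of the number system.  A cell is named by a bank and an index;
-- the bank is a constant of the program, the index is computed.  A program
-- mentions only finitely many banks, so interleaving them into a single
-- linear memory changes running times by at most a constant factor.

Bank : Set
Bank = ℕ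

infixl 6 _⊕_ _⊖_ _⊞_ _⊟_
infixl 7 _⊗_ _⊘_ _⊠_
infix  4 _`≤_ _`≤#_
infixr 3 _`∧_
infixr 1 _︔_
infix  2 _[_]≔_ _[_]≔#_

data NatExp : Set where
  lit             : ℕ → NatExp
  load            : Bank → NatExp → NatExp
  _⊕_ _⊖_ _⊗_ _⊘_ : NatExp → NatExp → NatExp

data NumExp : Set where
  load#       : Bank → NatExp → NumExp
  cast        : NatExp → NumExp
  _⊞_ _⊟_ _⊠_ : NumExp → NumExp → NumExp

data BoolExp : Set where
  _`≤_  : NatExp → NatExp → BoolExp
  _`≤#_ : NumExp → NumExp → BoolExp
  `not  : BoolExp → BoolExp
  _`∧_  : BoolExp → BoolExp → BoolExp

data Program : Set where
  skip          : Program
  _[_]≔_        : Bank → NatExp → NatExp → Program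
  _[_]≔#_       : Bank → NatExp → NumExp → Program
  _︔_           : Program → Program → Program
  `if_then_else_ : BoolExp → Program → Program → Program
  `while_loop_     : BoolExp → Program → Program

-- Each constant, memory access, arithmetic operation, comparison and
-- connective takes one unit of time, whatever the size of the operands.

natTime : NatExp → ℕ
natTime (lit _)    = 1
natTime (load _ e) = 1 ℕ.+ natTime e
natTime (e ⊕ f)    = 1 ℕ.+ natTime e ℕ.+ natTime f
natTime (e ⊖ f)    = 1 ℕ.+ natTime e ℕ.+ natTime f
natTime (e ⊗ f)    = 1 ℕ.+ natTime e ℕ.+ natTime f
natTime (e ⊘ f)    = 1 ℕ.+ natTime e ℕ.+ natTime f

numTime : NumExp → ℕ
numTime (load# _ e) = 1 ℕ.+ natTime e
numTime (cast e)    = 1 ℕ.+ natTime e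
numTime (e ⊞ f)     = 1 ℕ.+ numTime e ℕ.+ numTime f
numTime (e ⊟ f)     = 1 ℕ.+ numTime e ℕ.+ numTime f
numTime (e ⊠ f)     = 1 ℕ.+ numTime e ℕ.+ numTime f

boolTime : BoolExp → ℕ
boolTime (e `≤ f)  = 1 ℕ.+ natTime e ℕ.+ natTime f
boolTime (e `≤# f) = 1 ℕ.+ numTime e ℕ.+ numTime f
boolTime (`not b)  = 1 ℕ.+ boolTime b
boolTime (b `∧ b′) = 1 ℕ.+ boolTime b ℕ.+ boolTime b′

-- Integer quotient, with quotient 0 on division by 0.
quot : ℕ → ℕ → ℕ
quot a zero    = 0
quot a (suc b) = a ℕ./ suc b

-- Banks of the input (read by Holds) and of the output (read by Stores).
sizeBank m-bank c-bank : Bank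
sizeBank = 0
m-bank   = 1
c-bank   = 2

rootBank leftBank rightBank φ-bank : Bank
rootBank  = 3
leftBank  = 4
rightBank = 5
φ-bank    = 6

p-bank q-bank : Bank
p-bank = 0
q-bank = 1

module Model {c ℓ₁ ℓ₂ : Level} (K : OrderedCommutativeRing c ℓ₁ ℓ₂) where
  open OrderedCommutativeRing K

  ----------------------------------------------------------------------
  -- Execution of programs

  record State : Set c where
    constructor ⟪_,_⟫
    field
      nat : Bank → ℕ → ℕ
      num : Bank → ℕ → Carrier
  open State public

  _[_,_↦_] : ∀ {a} {A : Set a} → (Bank → ℕ → A) → Bank → ℕ → A → (Bank → ℕ → A)
  (M [ b , i ↦ x ]) b′ i′ =
    if does (b ℕ.≟ b′) ∧ does (i ℕ.≟ i′) then x else M b′ i′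

  natVal : NatExp → State → ℕ
  natVal (lit n)    σ = n
  natVal (load b e) σ = nat σ b (natVal e σ)
  natVal (e ⊕ f)    σ = natVal e σ ℕ.+ natVal f σ
  natVal (e ⊖ f)    σ = natVal e σ ∸ natVal f σ
  natVal (e ⊗ f)    σ = natVal e σ ℕ.* natVal f σ
  natVal (e ⊘ f)    σ = quot (natVal e σ) (natVal f σ)

  numVal : NumExp → State → Carrier
  numVal (load# b e) σ = num σ b (natVal e σ)
  numVal (cast e)    σ = fromℕ# (natVal e σ)
  numVal (e ⊞ f)     σ = numVal e σ + numVal f σ
  numVal (e ⊟ f)     σ = numVal e σ - numVal f σ
  numVal (e ⊠ f)     σ = numVal e σ * numVal f σ

  boolVal : BoolExp → State → Bool
  boolVal (e `≤ f)  σ = does (natVal e σ ℕ.≤? natVal f σ)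
  boolVal (e `≤# f) σ = does (numVal e σ ≤? numVal f σ)
  boolVal (`not b)  σ = not (boolVal b σ)
  boolVal (b `∧ b′) σ = boolVal b σ ∧ boolVal b′ σ

  -- ⟨ P , σ ⟩⇓⟨ τ , t ⟩: started in state σ, P halts in state τ after
  -- t units of time.
  data ⟨_,_⟩⇓⟨_,_⟩ : Program → State → State → ℕ → Set c where
    ⇓-skip : ∀ {σ} → ⟨ skip , σ ⟩⇓⟨ σ , 1 ⟩
    ⇓-nat  : ∀ {σ b i e} →
             ⟨ b [ i ]≔ e , σ ⟩⇓⟨
               ⟪ nat σ [ b , natVal i σ ↦ natVal e σ ] , num σ ⟫
             , 1 ℕ.+ natTime i ℕ.+ natTime e ⟩
    ⇓-num  : ∀ {σ b i e} →
             ⟨ b [ i ]≔# e , σ ⟩⇓⟨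
               ⟪ nat σ , num σ [ b , natVal i σ ↦ numVal e σ ] ⟫
             , 1 ℕ.+ natTime i ℕ.+ numTime e ⟩
    ⇓-seq  : ∀ {σ ρ τ P Q s t} →
             ⟨ P , σ ⟩⇓⟨ ρ , s ⟩ → ⟨ Q , ρ ⟩⇓⟨ τ , t ⟩ →
             ⟨ P ︔ Q , σ ⟩⇓⟨ τ , s ℕ.+ t ⟩
    ⇓-then : ∀ {σ τ b P Q t} → boolVal b σ ≡ true →
             ⟨ P , σ ⟩⇓⟨ τ , t ⟩ →
             ⟨ `if b then P else Q , σ ⟩⇓⟨ τ , 1 ℕ.+ boolTime b ℕ.+ t ⟩
    ⇓-else : ∀ {σ τ b P Q t} → boolVal b σ ≡ false →
             ⟨ Q , σ ⟩⇓⟨ τ , t ⟩ →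
             ⟨ `if b then P else Q , σ ⟩⇓⟨ τ , 1 ℕ.+ boolTime b ℕ.+ t ⟩
    ⇓-done : ∀ {σ b P} → boolVal b σ ≡ false →
             ⟨ `while b loop P , σ ⟩⇓⟨ σ , 1 ℕ.+ boolTime b ⟩
    ⇓-loop : ∀ {σ ρ τ b P s t} → boolVal b σ ≡ true →
             ⟨ P , σ ⟩⇓⟨ ρ , s ⟩ → ⟨ `while b loop P , ρ ⟩⇓⟨ τ , t ⟩ →
             ⟨ `while b loop P , σ ⟩⇓⟨ τ , 1 ℕ.+ boolTime b ℕ.+ s ℕ.+ t ⟩

  ----------------------------------------------------------------------
  -- Optimum binary search trees on the hierarchical memory

  -- An instance with h = h-2 + 2 levels.  The number n of keys is defined
  -- as the sum of the level sizes; n ≥ 1 follows from m-pos.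
  record Instance : Set (c ⊔ ℓ₁ ⊔ ℓ₂) where
    field
      h-2   : ℕ

    h : ℕ
    h = suc (suc h-2)

    field
      m     : Fin h → ℕ
      m-pos : ∀ l → 1 ℕ.≤ m l
      cₗ    : Fin h → ℕ
      cₗ-<  : ∀ {l l′} → l Fin.< l′ → cₗ l ℕ.< cₗ l′

    n : ℕ
    n = sumℕ m

    m-last : ℕ
    m-last = m (fromℕ (suc h-2))

    field
      p     : Fin n → Carrier
      q     : Fin (suc n) → Carrier
      p-nonNeg : ∀ k → 0# ≤ p k
      q-nonNeg : ∀ j → 0# ≤ q j
      total≈1  : sum# p + sum# q ≈ 1#

    μ : Fin n → ℕ
    μ a = cₗ (levelOf m a)

    w : ∀ {i j} → Tree i j → Carrier
    w (leaf j)     = q j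
    w (node k L R) = w L + p k + w R

  module _ (I : Instance) where
    open Instance I

    record Solution : Set where
      field
        T           : BST n
        φ           : Fin n → Fin n
        φ-injective : Injective _≡_ _≡_ φ

    -- The terms of the cost contributed by the nodes of a subtree: those of
    -- its internal nodes, and those of its external nodes, zⱼ being charged
    -- at the address of its parent.  (A tree that is a single external node
    -- does not arise as a BST n, since n ≥ 1.)
    internalCost : (Fin n → Fin n) → ∀ {i j} → Tree i j → Carrier
    internalCost φ (leaf j)         = 0#
    internalCost φ T@(node k L R) =
      w T * fromℕ# (μ (φ k)) + (internalCost φ L + internalCost φ R)

    mutual
      externalCost : (Fin n → Fin n) → ∀ {i j} → Tree i j → Carrier
      externalCost φ (leaf j)     = 0#
      externalCost φ (node k L R) = childCost φ k L + childCost φ k R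

      childCost : (Fin n → Fin n) → (parent : Fin n) → ∀ {i j} → Tree i j → Carrier
      childCost φ k T@(leaf j)     = w T * fromℕ# (μ (φ k))
      childCost φ k T@(node _ _ _) = externalCost φ T

    cost : Solution → Carrier
    cost S = internalCost φ T + externalCost φ T
      where open Solution S

    Optimum : Solution → Set ℓ₂
    Optimum S = ∀ S′ → cost S ≤ cost S′

    --------------------------------------------------------------------
    -- Input and output of the algorithm.  Arrays are indexed by the
    -- subscripts of the informal notation: p₁ … pₙ, q₀ … qₙ, m₁ … mₕ,
    -- c₁ … cₕ; addresses are written as 1 … n.

    -- Cells not mentioned have arbitrary initial contents.
    record Holds (σ : State) : Set (c ⊔ ℓ₁) where
      field
        n-cell : nat σ sizeBank 0 ≡ n
        h-cell : nat σ sizeBank 1 ≡ h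
        m-cell : ∀ l → nat σ m-bank (suc (toℕ l)) ≡ m l
        c-cell : ∀ l → nat σ c-bank (suc (toℕ l)) ≡ cₗ l
        p-cell : ∀ k → num σ p-bank (suc (toℕ k)) ≈ p k
        q-cell : ∀ j → num σ q-bank (toℕ j) ≈ q j

    -- Trees are stored by child pointers: 0 points to an external node, and
    -- i ≥ 1 to the internal node xᵢ.
    data PointsTo (σ : State) : ℕ → ∀ {i j} → Tree {n} i j → Set where
      external : ∀ {j} → PointsTo σ 0 (leaf j)
      internal : ∀ {i j k} {L : Tree i (inject₁ k)} {R : Tree (suc k) j} →
                 PointsTo σ (nat σ leftBank  (suc (toℕ k))) L →
                 PointsTo σ (nat σ rightBank (suc (toℕ k))) R →
                 PointsTo σ (suc (toℕ k)) (node k L R)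

    record Stores (σ : State) (S : Solution) : Set where
      open Solution S
      field
        T-cells : PointsTo σ (nat σ rootBank 0) T
        φ-cells : ∀ k → nat σ φ-bank (suc (toℕ k)) ≡ suc (toℕ (φ k))

-- Let M = n ∸ m-last be the number of addresses outside the slowest level.  A
-- dynamic program over the triples (i , j , S), where S is a set of these fast
-- addresses, finds the least cost of a tree over zᵢ , … , zⱼ some of whose keys
-- have distinct addresses in S, while all the others are charged for the
-- slowest level.  At a node each address of S goes to the root, to the left
-- subtree or to the right subtree, or is dropped, so that base 4 numerals of
-- length M describe all the possibilities.  Trying each of them for each S and
-- each i ≤ k < j takes time O(8^M n³), and 4^M (h-2)! ≤ 4 (M + h)^M because
-- M ≥ h - 1 and 2^g g! ≤ (g + 1)^g.
--
-- The cost found is a lower bound for all solutions.  It is attained: starting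
-- from any bijection, transpositions bring the keys with a fast address to that
-- address, and whatever addresses are left for the others cost no more than
-- the slowest level.

module Submission where

open import Defs
open import Data.Bool.Base using (Bool; T; _∧_; _∨_; false; if_then_else_; not; true)
open import Data.Fin.Base as Fin using (Fin; fromℕ; fromℕ<; inject₁; splitAt; suc; toℕ; zero)
open import Data.Fin.Properties using (any?; splitAt⁻¹-↑ʳ; splitAt⁻¹-↑ˡ; toℕ-fromℕ; toℕ-fromℕ<; toℕ-injective; toℕ-inject₁; toℕ-↑ʳ; toℕ-↑ˡ; toℕ<n)
open import Data.Product.Base using (_,_; _×_; proj₁; proj₂; Σ-syntax; ∃-syntax)
open import Data.Sum.Base using ([_,_]′; _⊎_; inj₁; inj₂; map₁)
open import Data.Unit.Base using (tt; ⊤)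
open import Function.Base using (_∘_; id)
open import Function.Definitions using (Injective)
open import Level using (Level) renaming (_⊔_ to _⊔ˡ_)
open import Relation.Binary.Definitions using (tri<; tri>; tri≈)
open import Relation.Nullary.Decidable using (Dec; _×-dec_; dec-false; dec-true; does; no; yes)
open import Relation.Nullary.Negation using (contradiction; ¬_)

-- Addresses of equal cost are never identified. The time bound leaves room for treating every fast
-- address as a separate resource, which makes a splitting a plain numeral whose effect is computed
-- digit by digit.
--
-- A rule determines the set to which it applies, namely the positions of its nonzero digits, so
-- testing whether a rule is admissible for `S` is one comparison with a table entry. An address of
-- `S` goes to waste by being sent to a subtree that makes no use of it.
--
-- Two obstacles shape the development. The machine has no recursion, no bit operations and no
-- infinite number: hence the effect of each rule is tabulated beforehand so that a candidate costs
-- constant time, a zero key marks a cell without a candidate, and the tree is read off by one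
-- descent per key. Moreover the input cells agree with the probabilities only up to `≈`: hence the
-- loops are verified against the contents of the cells, with `≡`, and the instance enters only when
-- table values are compared with costs.

-- A logic of terminating runs with postconditions, time bounds and frames

module Semantics where

  open import Data.Nat.Base
  open import Data.Nat.Properties
  open import Relation.Binary.PropositionalEquality

  -- A syntactic over-approximation, at the granularity of whole banks. On concrete programs it
  -- evaluates, so the frame conditions below are proved by `refl`.
  writesNat writesNum : Program → Bank → Bool
  writesNat skip                   b = false
  writesNat (b′ [ _ ]≔ _)          b = does (b′ ≟ b)
  writesNat (_ [ _ ]≔# _)          b = false
  writesNat (P ︔ Q)                b = writesNat P b ∨ writesNat Q b
  writesNat (`if _ then P else Q)  b = writesNat P b ∨ writesNat Q b
  writesNat (`while _ loop P)      b = writesNat P b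
  writesNum skip                   b = false
  writesNum (_ [ _ ]≔ _)           b = false
  writesNum (b′ [ _ ]≔# _)         b = does (b′ ≟ b)
  writesNum (P ︔ Q)                b = writesNum P b ∨ writesNum Q b
  writesNum (`if _ then P else Q)  b = writesNum P b ∨ writesNum Q b
  writesNum (`while _ loop P)      b = writesNum P b

  ∨-falseˡ : ∀ {x y} → x ∨ y ≡ false → x ≡ false
  ∨-falseˡ {false} _ = refl

  ∨-falseʳ : ∀ {x y} → x ∨ y ≡ false → y ≡ false
  ∨-falseʳ {false} eq = eq

  ∨-false : ∀ {x y} → x ∨ y ≡ false → (x ≡ false) × (y ≡ false)
  ∨-false {x} eq = ∨-falseˡ eq , ∨-falseʳ {x} eq

  -- The limit is evaluated once and kept in a cell of its own, so that a test takes a fixed time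
  -- and the number of rounds is settled on entry.
  for : (counter limit : Bank) → NatExp → Program → Program
  for X L e P =
    L [ lit 0 ]≔ e ︔
    X [ lit 0 ]≔ lit 0 ︔
    `while lit 1 ⊕ load X (lit 0) `≤ load L (lit 0) loop
      (P ︔ X [ lit 0 ]≔ lit 1 ⊕ load X (lit 0))

  module Logic {c ℓ₁ ℓ₂ : Level} (K : OrderedCommutativeRing c ℓ₁ ℓ₂) where
    open Model K

    record Run {ℓ} (P : Program) (σ : State) (Post : State → Set ℓ) (B : ℕ) : Set (c ⊔ˡ ℓ) where
      constructor run
      field
        {final} : State
        {time}  : ℕ
        steps   : ⟨ P , σ ⟩⇓⟨ final , time ⟩
        post    : Post final
        bound   : time ≤ B
    open Run public

    record Frame (P : Program) (σ τ : State) : Set c where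
      field
        natF : ∀ b → writesNat P b ≡ false → ∀ i → nat τ b i ≡ nat σ b i
        numF : ∀ b → writesNum P b ≡ false → ∀ i → num τ b i ≡ num σ b i
    open Frame public

    ↦-other : ∀ {a} {A : Set a} (M : Bank → ℕ → A) b i x b′ → does (b ≟ b′) ≡ false →
              ∀ i′ → (M [ b , i ↦ x ]) b′ i′ ≡ M b′ i′
    ↦-other M b i x b′ eq i′ rewrite eq = refl

    ↦-same : ∀ {a} {A : Set a} (M : Bank → ℕ → A) b i x → (M [ b , i ↦ x ]) b i ≡ x
    ↦-same M b i x rewrite dec-true (b ≟ b) refl | dec-true (i ≟ i) refl = refl

    Frame-refl : ∀ {P σ} → Frame P σ σ
    Frame-refl = record { natF = λ _ _ _ → refl ; numF = λ _ _ _ → refl }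

    Frame-trans : ∀ {P Q R σ ρ τ} →
                  (∀ b → writesNat R b ≡ false → writesNat P b ≡ false) →
                  (∀ b → writesNum R b ≡ false → writesNum P b ≡ false) →
                  (∀ b → writesNat R b ≡ false → writesNat Q b ≡ false) →
                  (∀ b → writesNum R b ≡ false → writesNum Q b ≡ false) →
                  Frame P σ ρ → Frame Q ρ τ → Frame R σ τ
    Frame-trans p p# q q# f g = record
      { natF = λ b eq i → trans (natF g b (q b eq) i) (natF f b (p b eq) i)
      ; numF = λ b eq i → trans (numF g b (q# b eq) i) (numF f b (p# b eq) i)
      }

    Frame-mono : ∀ {P Q σ τ} →
                 (∀ b → writesNat Q b ≡ false → writesNat P b ≡ false) →
                 (∀ b → writesNum Q b ≡ false → writesNum P b ≡ false) →
                 Frame P σ τ → Frame Q σ τ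
    Frame-mono p p# f = record
      { natF = λ b eq → natF f b (p b eq) ; numF = λ b eq → numF f b (p# b eq) }

    ⇓-frame : ∀ {P σ τ t} → ⟨ P , σ ⟩⇓⟨ τ , t ⟩ → Frame P σ τ
    ⇓-frame ⇓-skip = Frame-refl
    ⇓-frame {b′ [ i ]≔ e} {σ} ⇓-nat = record
      { natF = λ b eq → ↦-other (nat σ) b′ (natVal i σ) (natVal e σ) b eq ; numF = λ _ _ _ → refl }
    ⇓-frame {b′ [ i ]≔# e} {σ} ⇓-num = record
      { natF = λ _ _ _ → refl ; numF = λ b eq → ↦-other (num σ) b′ (natVal i σ) (numVal e σ) b eq }
    ⇓-frame {P ︔ Q} (⇓-seq d e) =
      Frame-trans (λ _ → ∨-falseˡ) (λ _ → ∨-falseˡ)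
                  (λ b → ∨-falseʳ {writesNat P b}) (λ b → ∨-falseʳ {writesNum P b})
                  (⇓-frame d) (⇓-frame e)
    ⇓-frame (⇓-then _ d) = Frame-mono (λ _ → ∨-falseˡ) (λ _ → ∨-falseˡ) (⇓-frame d)
    ⇓-frame {`if _ then P else Q} (⇓-else _ d) =
      Frame-mono (λ b → ∨-falseʳ {writesNat P b}) (λ b → ∨-falseʳ {writesNum P b}) (⇓-frame d)
    ⇓-frame (⇓-done _) = Frame-refl
    ⇓-frame (⇓-loop _ d e) =
      Frame-trans (λ _ → id) (λ _ → id) (λ _ → id) (λ _ → id) (⇓-frame d) (⇓-frame e)

    private
      variable
        ℓ ℓ′ : Level
        P Q : Program
        σ : State
        B B′ : ℕ

    -- The new postcondition may use the frame of the run. In this way facts about untouched banks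
    -- pass over a program without being part of its specification.
    weaken : {Post : State → Set ℓ} {Post′ : State → Set ℓ′} →
             B ≤ B′ → (∀ {τ} → Frame P σ τ → Post τ → Post′ τ) →
             Run P σ Post B → Run P σ Post′ B′
    weaken le f (run d p b) = run d (f (⇓-frame d) p) (≤-trans b le)

    runSkip : {Post : State → Set ℓ} → Post σ → Run skip σ Post 1
    runSkip p = run ⇓-skip p ≤-refl

    assign : ∀ {b i e} {Post : State → Set ℓ} →
             Post ⟪ nat σ [ b , natVal i σ ↦ natVal e σ ] , num σ ⟫ →
             Run (b [ i ]≔ e) σ Post (1 + natTime i + natTime e)
    assign p = run ⇓-nat p ≤-refl

    assign# : ∀ {b i e} {Post : State → Set ℓ} →
              Post ⟪ nat σ , num σ [ b , natVal i σ ↦ numVal e σ ] ⟫ →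
              Run (b [ i ]≔# e) σ Post (1 + natTime i + numTime e)
    assign# p = run ⇓-num p ≤-refl

    -- The postcondition of the first program is that the second one runs to `Post`. A verification
    -- then nests like the program, and assignments need no intermediate assertions.
    seq : {Post : State → Set ℓ} →
          Run P σ (λ ρ → Run Q ρ Post B′) B → Run (P ︔ Q) σ Post (B + B′)
    seq (run d (run e p b′) b) = run (⇓-seq d e) p (+-mono-≤ b b′)

    branch : ∀ {b} {Post : State → Set ℓ} →
             (boolVal b σ ≡ true → Run P σ Post B) →
             (boolVal b σ ≡ false → Run Q σ Post B′) →
             Run (`if b then P else Q) σ Post (1 + boolTime b + (B + B′))
    branch {σ = σ} {B = B} {B′ = B′} {b = b} p q with boolVal b σ in eq
    ... | true  = let run d r le = p refl in
                  run (⇓-then eq d) r (+-monoʳ-≤ (1 + boolTime b) (≤-trans le (m≤m+n B B′)))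
    ... | false = let run d r le = q refl in
                  run (⇓-else eq d) r (+-monoʳ-≤ (1 + boolTime b) (≤-trans le (m≤n+m B′ B)))

    whileRun : ∀ {b} (Inv : ℕ → State → Set ℓ) N →
           (∀ {σ} → Inv N σ → boolVal b σ ≡ false) →
           (∀ k {σ} → k < N → Inv k σ → boolVal b σ ≡ true) →
           (∀ k {σ} → k < N → Inv k σ → Run P σ (Inv (suc k)) B) →
           Inv 0 σ →
           Run (`while b loop P) σ (Inv N) (N * (1 + boolTime b + B) + (1 + boolTime b))
    whileRun {P = P} {B = B} {b = b} Inv N stop go body inv₀ = iterate N 0 (+-identityʳ N) inv₀
      where
      T₁ = 1 + boolTime b
      iterate : ∀ r k {σ} → r + k ≡ N → Inv k σ →
                Run (`while b loop P) σ (Inv N) (r * (T₁ + B) + T₁)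
      iterate zero    k refl inv = run (⇓-done (stop inv)) inv ≤-refl
      iterate (suc r) k eq   inv =
        let k<N        = subst (k <_) eq (s≤s (m≤n+m k r))
            run d i le = body k k<N inv
            run e p l′ = iterate r (suc k) (trans (+-suc r k) eq) i
        in run (⇓-loop (go k k<N inv) d e) p
               (≤-trans (+-mono-≤ (+-monoʳ-≤ T₁ le) l′)
                        (≤-reflexive (sym (+-assoc (T₁ + B) (r * (T₁ + B)) T₁))))

    -- For the invariants used below both sides reduce to the same type, because comparisons of
    -- concrete banks evaluate; `id` is then a proof.
    Insensitive : Bank → (State → Set ℓ) → Set (c ⊔ˡ ℓ)
    Insensitive b I = ∀ {σ x} → I σ → I ⟪ nat σ [ b , 0 ↦ x ] , num σ ⟫

    -- A round adds 8 units for the test and 6 for the increment to the body; the initial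
    -- assignments take 5 + `natTime e` and the failing test 8. The body receives the frame of the
    -- whole loop since entry, so `Inv` need only mention what the loop changes.
    forRun : ∀ {X L e} (Inv : ℕ → State → Set ℓ) N → natVal e σ ≡ N →
             does (X ≟ L) ≡ false → does (L ≟ X) ≡ false →
             writesNat P X ≡ false → writesNat P L ≡ false →
             (∀ {k} → Insensitive X (Inv k)) → (∀ {k} → Insensitive L (Inv k)) →
             Inv 0 σ →
             (∀ k {ρ} → k < N → nat ρ X 0 ≡ k → Frame (for X L e P) σ ρ → Inv k ρ →
              Run P ρ (Inv (suc k)) B) →
             Run (for X L e P) σ (Inv N) (N * (14 + B) + (13 + natTime e))
    forRun {σ = σ} {P = P} {B = B} {X = X} {L = L} {e = e} Inv N eN X≢L L≢X PX PL insX insL inv₀ body =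
      weaken bnd (λ _ (_ , _ , _ , i) → i)
        (seq (assign (seq (assign
          (whileRun Inv′ N stop go body′
            (↦-same (nat σ [ L , 0 ↦ natVal e σ ]) X 0 0 , trans (↦-other (nat σ [ L , 0 ↦ natVal e σ ]) X 0 0 L X≢L 0) (trans (↦-same (nat σ) L 0 _) eN) , fr₀ , insX (insL inv₀)))))))
      where
      F : State → Set c
      F ρ = Frame (for X L e P) σ ρ
      Inv′ : ℕ → State → Set _
      Inv′ k ρ = nat ρ X 0 ≡ k × nat ρ L 0 ≡ N × F ρ × Inv k ρ
      fr₀ : F _
      fr₀ = Frame-trans (λ b eq → ∨-falseˡ eq) (λ _ _ → refl)
              (λ b eq → ∨-falseˡ (∨-falseʳ {does (L ≟ b)} eq)) (λ _ _ → refl)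
              (⇓-frame (⇓-nat {b = L} {lit 0} {e})) (⇓-frame (⇓-nat {b = X} {lit 0} {lit 0}))
      stop : ∀ {ρ} → Inv′ N ρ → _
      stop (x , l , _) = dec-false (_ ≤? _) (λ le → 1+n≰n (subst₂ (λ u v → suc u ≤ v) x l le))
      go : ∀ k {ρ} → k < N → Inv′ k ρ → _
      go k k<N (x , l , _) = dec-true (_ ≤? _) (subst₂ (λ u v → suc u ≤ v) (sym x) (sym l) k<N)
      W = for X L e P
      sub : ∀ b → writesNat W b ≡ false → writesNat P b ≡ false
      sub b eq = ∨-falseˡ (∨-falseʳ {does (X ≟ b)} (∨-falseʳ {does (L ≟ b)} eq))
      sub# : ∀ b → writesNum W b ≡ false → writesNum P b ≡ false
      sub# b eq = ∨-falseˡ eq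
      body′ : ∀ k {ρ} → k < N → Inv′ k ρ → Run (P ︔ X [ lit 0 ]≔ lit 1 ⊕ load X (lit 0)) ρ (Inv′ (suc k)) (B + 6)
      body′ k {ρ} k<N (x , l , f , i) =
        seq (weaken ≤-refl (λ {τ} g i′ →
          assign (trans (↦-same (nat τ) X 0 _) (cong suc (trans (natF g X PX 0) x))
                 , trans (↦-other (nat τ) X 0 _ L X≢L 0) (trans (natF g L PL 0) l)
                 , Frame-trans (λ _ → id) (λ _ → id)
                     (λ b eq → ∨-falseˡ (∨-falseʳ {does (L ≟ b)} eq)) (λ _ _ → refl)
                     (Frame-trans {R = W} (λ _ → id) (λ _ → id) sub sub# f g)
                     (⇓-frame (⇓-nat {b = X} {lit 0} {lit 1 ⊕ load X (lit 0)}))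
                 , insX i′))
          (body k k<N x f i))
      bnd : 2 + natTime e + (3 + (N * (8 + (B + 6)) + 8)) ≤ N * (14 + B) + (13 + natTime e)
      bnd = ≤-reflexive (begin
        2 + natTime e + (3 + (N * (8 + (B + 6)) + 8)) ≡⟨ cong (λ u → 2 + natTime e + (3 + (N * (8 + u) + 8))) (+-comm B 6) ⟩
        2 + natTime e + (3 + (N * (14 + B) + 8))      ≡⟨ cong (2 + natTime e +_) (+-assoc 3 (N * (14 + B)) 8) ⟨
        2 + natTime e + (3 + N * (14 + B) + 8)        ≡⟨ cong (λ u → 2 + natTime e + (u + 8)) (+-comm 3 (N * (14 + B))) ⟩
        2 + natTime e + (N * (14 + B) + 3 + 8)        ≡⟨ cong (2 + natTime e +_) (+-assoc (N * (14 + B)) 3 8) ⟩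
        2 + natTime e + (N * (14 + B) + 11)           ≡⟨ +-comm (2 + natTime e) _ ⟩
        N * (14 + B) + 11 + (2 + natTime e)           ≡⟨ +-assoc (N * (14 + B)) 11 _ ⟩
        N * (14 + B) + (13 + natTime e)               ∎)
        where open ≡-Reasoning

    -- As `X` and `Y` are at least 1, the overheads 14 and 13 + `e` are absorbed by multiples of
    -- `X * Y`, and nested loops keep bounds that are single products. For concrete numbers the side
    -- condition evaluates to the unit type and is filled in automatically.
    loop-bound : ∀ {N X Y B} e c₀ c₁ {_ : T (27 + e + c₀ ≤ᵇ c₁)} → N ≤ X → 1 ≤ X → 1 ≤ Y → B ≤ c₀ * Y →
                 N * (14 + B) + (13 + e) ≤ c₁ * (X * Y)
    loop-bound {N} {X} {Y} {B} e c₀ c₁ {c≤} N≤X 1≤X 1≤Y B≤ = begin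
      N * (14 + B) + (13 + e)
        ≤⟨ +-mono-≤ (*-mono-≤ N≤X (+-mono-≤ (up 14 1≤Y) B≤)) (up (13 + e) (*-mono-≤ 1≤X 1≤Y)) ⟩
      X * (14 * Y + c₀ * Y) + (13 + e) * (X * Y)
        ≡⟨ cong (_+ (13 + e) * (X * Y)) (trans (cong (X *_) (sym (*-distribʳ-+ Y 14 c₀))) (x∙yz≈y∙xz X (14 + c₀) Y)) ⟩
      (14 + c₀) * (X * Y) + (13 + e) * (X * Y)
        ≡⟨ *-distribʳ-+ (X * Y) (14 + c₀) (13 + e) ⟨
      (14 + c₀ + (13 + e)) * (X * Y)
        ≤⟨ *-monoˡ-≤ (X * Y) (≤-trans (≤-reflexive lem) (≤ᵇ⇒≤ (27 + e + c₀) c₁ c≤)) ⟩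
      c₁ * (X * Y) ∎
      where
      open ≤-Reasoning
      open import Algebra.Properties.CommutativeSemigroup *-commutativeSemigroup using (x∙yz≈y∙xz)
      up : ∀ k {Z} → 1 ≤ Z → k ≤ k * Z
      up k 1≤Z = ≤-trans (≤-reflexive (sym (*-identityʳ k))) (*-monoʳ-≤ k 1≤Z)
      lem : 14 + c₀ + (13 + e) ≡ 27 + e + c₀
      lem = trans (+-comm (14 + c₀) (13 + e)) (trans (sym (+-assoc (13 + e) 14 c₀)) (cong (_+ c₀) (trans (+-comm (13 + e) 14) refl)))

    bound-sum : ∀ k c c′ {_ : T (k + c ≤ᵇ c′)} {Y B} → 1 ≤ Y → B ≤ c * Y → k + B ≤ c′ * Y
    bound-sum k c c′ {le} {Y} {B} 1≤Y B≤ = begin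
      k + B          ≤⟨ +-mono-≤ (≤-trans (≤-reflexive (sym (*-identityʳ k))) (*-monoʳ-≤ k 1≤Y)) B≤ ⟩
      k * Y + c * Y  ≡⟨ *-distribʳ-+ Y k c ⟨
      (k + c) * Y    ≤⟨ *-monoˡ-≤ Y (≤ᵇ⇒≤ (k + c) c′ le) ⟩
      c′ * Y         ∎
      where open ≤-Reasoning

-- Sets and splittings of addresses as numerals in base 2 and base 4

module Codes where

  import Algebra.Properties.CommutativeSemigroup as CommutativeSemigroupProperties
  open import Data.Nat.Base
  open import Data.Nat.DivMod
  open import Data.Nat.Divisibility using (m∣m*n)
  open import Data.Nat.Properties
  open import Relation.Binary.PropositionalEquality

  ^-distribʳ-* : ∀ o m n → (m * n) ^ o ≡ m ^ o * n ^ o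
  ^-distribʳ-* zero    m n = refl
  ^-distribʳ-* (suc o) m n = trans (cong (m * n *_) (^-distribʳ-* o m n)) (interchange m n (m ^ o) (n ^ o))
    where open CommutativeSemigroupProperties *-commutativeSemigroup using (interchange)

  foldDigits : (ℕ → ℕ → ℕ) → ℕ → (ℕ → ℕ) → ℕ
  foldDigits step zero    f = 0
  foldDigits step (suc m) f = step (f 0) (foldDigits step m (f ∘ suc))

  -- Sets of fast addresses are numbered in base 2, ways to split them in base 4.
  enc : ℕ → ℕ → (ℕ → ℕ) → ℕ
  enc b = foldDigits (λ d x → d + b * x)

  foldDigits-enc : ∀ b γ m f → foldDigits (λ d x → γ d + b * x) m f ≡ enc b m (γ ∘ f)
  foldDigits-enc b γ zero    f = refl
  foldDigits-enc b γ (suc m) f = cong (λ x → γ (f 0) + b * x) (foldDigits-enc b γ m (f ∘ suc))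

  enc-cong : ∀ b m {f g} → (∀ a → a < m → f a ≡ g a) → enc b m f ≡ enc b m g
  enc-cong b zero    eq = refl
  enc-cong b (suc m) eq =
    cong₂ (λ d x → d + b * x) (eq 0 z<s) (enc-cong b m (λ a a<m → eq (suc a) (s≤s a<m)))

  enc< : ∀ b m {f} → (∀ a → a < m → f a < b) → enc b m f < b ^ m
  enc< b zero    f<b = z<s
  enc< b (suc m) {f} f<b = begin-strict
    f 0 + b * enc b m (f ∘ suc)  <⟨ +-monoˡ-< _ (f<b 0 z<s) ⟩
    b + b * enc b m (f ∘ suc)    ≡⟨ *-suc b _ ⟨
    b * suc (enc b m (f ∘ suc))  ≤⟨ *-monoʳ-≤ b (enc< b m (λ a a<m → f<b (suc a) (s≤s a<m))) ⟩
    b * b ^ m                    ∎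
    where open ≤-Reasoning

  suc-enc-ones : ∀ m → suc (enc 2 m (λ _ → 1)) ≡ 2 ^ m
  suc-enc-ones zero    = refl
  suc-enc-ones (suc m) = trans (sym (*-suc 2 _)) (cong (2 *_) (suc-enc-ones m))

  module _ (b : ℕ) {{_ : NonZero b}} where

    [d+bx]%b : ∀ {d} x → d < b → (d + b * x) % b ≡ d
    [d+bx]%b {d} x d<b = begin
      (d + b * x) % b ≡⟨ cong (λ y → (d + y) % b) (*-comm b x) ⟩
      (d + x * b) % b ≡⟨ [m+kn]%n≡m%n d x b ⟩
      d % b           ≡⟨ m<n⇒m%n≡m d<b ⟩
      d               ∎
      where open ≡-Reasoning

    [d+bx]/b : ∀ {d} x → d < b → (d + b * x) / b ≡ x
    [d+bx]/b {d} x d<b = begin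
      (d + b * x) / b     ≡⟨ +-distrib-/-∣ʳ d (m∣m*n x) ⟩
      d / b + b * x / b   ≡⟨ cong₂ _+_ (m<n⇒m/n≡0 d<b) (trans (cong (_/ b) (*-comm b x)) (m*n/n≡m x b)) ⟩
      x                   ∎
      where open ≡-Reasoning

    enc-injective : ∀ m {f g} → (∀ a → f a < b) → (∀ a → g a < b) → enc b m f ≡ enc b m g →
                    ∀ a → a < m → f a ≡ g a
    enc-injective (suc m) {f} {g} f<b g<b eq zero    _ =
      trans (sym ([d+bx]%b _ (f<b 0))) (trans (cong (_% b) eq) ([d+bx]%b _ (g<b 0)))
    enc-injective (suc m) {f} {g} f<b g<b eq (suc a) (s≤s a<m) =
      enc-injective m (f<b ∘ suc) (g<b ∘ suc)
        (trans (sym ([d+bx]/b _ (f<b 0))) (trans (cong (_/ b) eq) ([d+bx]/b _ (g<b 0)))) a a<m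

    -- The digits are bounded at all positions, also beyond `m`, where they are 0. Thus digit
    -- functions can be total and need no bound on the position.
    decode : ∀ m t → t < b ^ m → Σ[ f ∈ (ℕ → ℕ) ] (∀ a → f a < b) × enc b m f ≡ t
    decode zero    t t<1  = (λ _ → 0) , (λ _ → >-nonZero⁻¹ b) , sym (n<1⇒n≡0 t<1)
    decode (suc m) t t<bm with decode m (t / b) (m<n*o⇒m/o<n (subst (t <_) (*-comm b (b ^ m)) t<bm))
    ... | f , f<b , eq = g , g<b ,
          trans (cong (λ x → t % b + b * x) eq)
                (trans (cong (t % b +_) (*-comm b (t / b))) (sym (m≡m%n+[m/n]*n t b)))
      where
      g : ℕ → ℕ
      g zero    = t % b
      g (suc a) = f a
      g<b : ∀ a → g a < b
      g<b zero    = m%n<n t b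
      g<b (suc a) = f<b a

  digit4 : ℕ → ℕ
  digit4 u = u ∸ 4 * (u / 4)

  digit4-enc : ∀ {d} x → d < 4 → digit4 (d + 4 * x) ≡ d
  digit4-enc {d} x d<4 =
    trans (cong (λ y → d + 4 * x ∸ 4 * y) ([d+bx]/b 4 x d<4)) (m+n∸n≡m d (4 * x))

  u/4<u : ∀ {u} → 1 ≤ u → u / 4 < u
  u/4<u {suc u} _ = m/n<m (suc u) 4 (s≤s z<s)

  -- The recurrence starts at 1, since `0 / 4` is 0 and entry 0 would refer to itself. Numerals of
  -- any length with only zero digits all lead to entry 0, which is right because `step 0 0 ≡ 0`.
  foldDigits-table : ∀ {N step} (A : ℕ → ℕ) → step 0 0 ≡ 0 → A 0 ≡ 0 →
    (∀ u → 1 ≤ u → u < N → A u ≡ step (digit4 u) (A (u / 4))) →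
    ∀ m f → (∀ a → f a < 4) → enc 4 m f < N → A (enc 4 m f) ≡ foldDigits step m f
  foldDigits-table A s0 A0 rec zero    f f<4 lt = A0
  foldDigits-table {N} {step} A s0 A0 rec (suc m) f f<4 lt = go (enc 4 (suc m) f) refl
    where
    x = enc 4 m (f ∘ suc)
    ih : x < N → A x ≡ foldDigits step m (f ∘ suc)
    ih = foldDigits-table A s0 A0 rec m (f ∘ suc) (f<4 ∘ suc)
    q≡ : (f 0 + 4 * x) / 4 ≡ x
    q≡ = [d+bx]/b 4 x (f<4 0)
    go : ∀ u → f 0 + 4 * x ≡ u → A (f 0 + 4 * x) ≡ foldDigits step (suc m) f
    go zero    eq =
      let f0 = m+n≡0⇒m≡0 (f 0) eq
          x0 = m+n≡0⇒m≡0 x (m+n≡0⇒n≡0 (f 0) eq)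
      in trans (trans (cong A eq) A0)
           (trans (sym s0) (cong₂ step (sym f0)
             (trans (sym A0) (trans (cong A (sym x0)) (ih (subst (_< N) (sym x0) (≤-<-trans z≤n lt)))))))
    go (suc u) eq =
      let pos : 1 ≤ f 0 + 4 * x
          pos = subst (1 ≤_) (sym eq) z<s
      in trans (rec (f 0 + 4 * x) pos lt)
           (cong₂ step (digit4-enc x (f<4 0))
             (trans (cong A q≡) (ih (<-trans (subst (_< f 0 + 4 * x) q≡ (u/4<u pos)) lt))))

  -- A base 4 digit says what becomes of an address that is available to a
  -- subtree: 0 dropped, 1 left subtree, 2 right subtree, 3 root.
  available toLeft toRight : ℕ → ℕ
  available d = 1 ∸ (1 ∸ d)
  toLeft    d = (1 ∸ (d ∸ 1)) ∸ (1 ∸ d)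
  toRight   d = (1 ∸ (2 ∸ d)) ∸ (1 ∸ (3 ∸ d))

  -- One more than the position of the first digit 3, and 0 if there is none.
  firstRoot-step : ℕ → ℕ → ℕ
  firstRoot-step d r = (d ∸ 2) + (1 ∸ (d ∸ 2)) * (r + (1 ∸ (1 ∸ r)))

  firstRoot : ℕ → (ℕ → ℕ) → ℕ
  firstRoot = foldDigits firstRoot-step

  available<2 : ∀ d → available d < 2
  available<2 d = s≤s (m∸n≤m 1 (1 ∸ d))

  toLeft<2 : ∀ d → toLeft d < 2
  toLeft<2 d = s≤s (≤-trans (m∸n≤m (1 ∸ (d ∸ 1)) (1 ∸ d)) (m∸n≤m 1 (d ∸ 1)))

  toRight<2 : ∀ d → toRight d < 2
  toRight<2 d = s≤s (≤-trans (m∸n≤m (1 ∸ (2 ∸ d)) (1 ∸ (3 ∸ d))) (m∸n≤m 1 (2 ∸ d)))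

  toLeft-1 : ∀ {d} → toLeft d ≡ 1 → d ≡ 1
  toLeft-1 {1} eq = refl
  toLeft-1 {suc (suc zero)} ()
  toLeft-1 {suc (suc (suc d))} ()

  toRight-1 : ∀ {d} → d < 4 → toRight d ≡ 1 → d ≡ 2
  toRight-1 {2} _ eq = refl
  toRight-1 {3} _ ()
  toRight-1 {suc (suc (suc (suc d)))} (s≤s (s≤s (s≤s (s≤s ())))) _

  d∸2≡0 : ∀ {d} → d < 3 → d ∸ 2 ≡ 0
  d∸2≡0 (s≤s d≤2) = m≤n⇒m∸n≡0 d≤2

  step-zero : ∀ {d} → d < 3 → firstRoot-step d 0 ≡ 0
  step-zero d<3 rewrite d∸2≡0 d<3 = refl

  step-suc : ∀ {d} r → d < 3 → firstRoot-step d (suc r) ≡ suc (suc r)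
  step-suc r d<3 rewrite d∸2≡0 d<3 | 0∸n≡0 r | +-identityʳ (r + 1) | +-comm r 1 = refl

  firstRoot-none : ∀ m f → (∀ a → a < m → f a < 3) → firstRoot m f ≡ 0
  firstRoot-none zero    f f<3 = refl
  firstRoot-none (suc m) f f<3 =
    trans (cong (firstRoot-step (f 0)) (firstRoot-none m (f ∘ suc) (λ a a<m → f<3 (suc a) (s≤s a<m))))
          (step-zero (f<3 0 z<s))

  firstRoot-unique : ∀ m f a → a < m → f a ≡ 3 → (∀ a′ → a′ ≢ a → f a′ < 3) → firstRoot m f ≡ suc a
  firstRoot-unique (suc m) f zero _ fa _ rewrite fa = refl
  firstRoot-unique (suc m) f (suc a) (s≤s a<m) fa f<3 =
    trans (cong (firstRoot-step (f 0))
            (firstRoot-unique m (f ∘ suc) a a<m fa (λ a′ ne → f<3 (suc a′) (ne ∘ suc-injective))))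
          (step-suc a (f<3 0 (λ ())))

  firstRoot-sound : ∀ m f {a} → (∀ a → f a < 4) → firstRoot m f ≡ suc a → a < m × f a ≡ 3
  firstRoot-sound (suc m) f {a} f<4 eq with m≤n⇒m<n∨m≡n (s≤s⁻¹ (f<4 0))
  ... | inj₂ f0 = subst (λ a → a < suc m × f a ≡ 3) (suc-injective (trans (sym root) eq)) (z<s , f0)
    where
    root : firstRoot (suc m) f ≡ 1
    root rewrite f0 = refl
  ... | inj₁ f0<3 = later (firstRoot m (f ∘ suc)) refl
    where
    later : ∀ r → firstRoot m (f ∘ suc) ≡ r → a < suc m × f a ≡ 3
    later zero    r = contradiction
      (trans (sym eq) (trans (cong (firstRoot-step (f 0)) r) (step-zero f0<3))) (λ ())
    later (suc a′) r =
      let a<m , fa = firstRoot-sound m (f ∘ suc) (f<4 ∘ suc) r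
      in subst (λ a → a < suc m × f a ≡ 3)
           (suc-injective (trans (sym (step-suc a′ f0<3)) (trans (sym (cong (firstRoot-step (f 0)) r)) eq)))
           (s≤s a<m , fa)

-- The program

module Algorithm where

  open Semantics using (for)

  infix 2 _≔_ _≔#_

  val : Bank → NatExp
  val b = load b (lit 0)

  val# : Bank → NumExp
  val# b = load# b (lit 0)

  _≔_ : Bank → NatExp → Program
  b ≔ e = b [ lit 0 ]≔ e

  _≔#_ : Bank → NumExp → Program
  b ≔# e = b [ lit 0 ]≔# e

  fastBank subsetsBank rulesBank : Bank
  fastBank    = 7
  subsetsBank = 8
  rulesBank   = 9

  priceBank ruleBank ruleLeftBank ruleRightBank ruleRootBank : Bank
  priceBank     = 10
  ruleBank      = 11
  ruleLeftBank  = 12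
  ruleRightBank = 13
  ruleRootBank  = 14

  keyBank choiceBank : Bank
  keyBank    = 15
  choiceBank = 16

  bestKey bestRule : Bank
  bestKey  = 17
  bestRule = 18

  jBank jLimit dBank dLimit SBank SLimit kkBank kkLimit tBank tLimit iBank kBank : Bank
  jBank   = 19
  jLimit  = 20
  dBank   = 21
  dLimit  = 22
  SBank   = 23
  SLimit  = 24
  kkBank  = 25
  kkLimit = 26
  tBank   = 27
  tLimit  = 28
  iBank   = 29
  kBank   = 30

  -- Work arrays of the output phase: the address intended for each key, with 0 for a key charged at
  -- the slowest level, and the inverse of the permutation in `φ-bank`.
  ψ-bank inverseBank : Bank
  ψ-bank      = 31
  inverseBank = 32

  xBank xLimit yBank yLimit posBank uBank digitBank cellBank aBank bBank : Bank
  xBank     = 33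
  xLimit    = 34
  yBank     = 35
  yLimit    = 36
  posBank   = 37
  uBank     = 38
  digitBank = 39
  cellBank  = 40
  aBank     = 41
  bBank     = 42

  valueBank weightBank bestValue newValue : Bank
  valueBank  = 2
  weightBank = 3
  bestValue  = 4
  newValue   = 5

  nᵉ : NatExp
  nᵉ = load sizeBank (lit 0)

  lastLevel : NatExp
  lastLevel = load sizeBank (lit 1)

  sizes : Program
  sizes =
    fastBank ≔ nᵉ ⊖ load m-bank lastLevel ︔
    subsetsBank ≔ lit 1 ︔
    for xBank xLimit (val fastBank) (subsetsBank ≔ lit 2 ⊗ val subsetsBank) ︔
    rulesBank ≔ val subsetsBank ⊗ val subsetsBank

  -- Cell 0 holds the cost of the slowest level, cell a that of address a.
  prices : Program
  prices =
    priceBank [ lit 0 ]≔ load c-bank lastLevel ︔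
    posBank ≔ lit 1 ︔
    for xBank xLimit lastLevel
      (for yBank yLimit (load m-bank (lit 1 ⊕ val xBank))
        (priceBank [ val posBank ]≔ load c-bank (lit 1 ⊕ val xBank) ︔
         posBank ≔ lit 1 ⊕ val posBank))

  -- Expressions have no conditional, so case distinctions on a digit use truncated subtraction:
  -- `1 ⊖ x` is 1 if `x` is 0, and 0 otherwise.
  availableᵉ toLeftᵉ toRightᵉ : NatExp → NatExp
  availableᵉ d = lit 1 ⊖ (lit 1 ⊖ d)
  toLeftᵉ    d = (lit 1 ⊖ (d ⊖ lit 1)) ⊖ (lit 1 ⊖ d)
  toRightᵉ   d = (lit 1 ⊖ (lit 2 ⊖ d)) ⊖ (lit 1 ⊖ (lit 3 ⊖ d))

  firstRoot-stepᵉ : NatExp → NatExp → NatExp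
  firstRoot-stepᵉ d r = (d ⊖ lit 2) ⊕ (lit 1 ⊖ (d ⊖ lit 2)) ⊗ (r ⊕ (lit 1 ⊖ (lit 1 ⊖ r)))

  quarter : NatExp
  quarter = val uBank ⊘ lit 4

  -- Rule u adds the digit of weight 1 of u to rule u / 4.
  oneRule : Program
  oneRule =
    uBank ≔ lit 1 ⊕ val xBank ︔
    digitBank ≔ val uBank ⊖ lit 4 ⊗ quarter ︔
    ruleBank [ val uBank ]≔ availableᵉ (val digitBank) ⊕ lit 2 ⊗ load ruleBank quarter ︔
    ruleLeftBank [ val uBank ]≔ toLeftᵉ (val digitBank) ⊕ lit 2 ⊗ load ruleLeftBank quarter ︔
    ruleRightBank [ val uBank ]≔ toRightᵉ (val digitBank) ⊕ lit 2 ⊗ load ruleRightBank quarter ︔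
    ruleRootBank [ val uBank ]≔ firstRoot-stepᵉ (val digitBank) (load ruleRootBank quarter)

  rules : Program
  rules =
    ruleBank [ lit 0 ]≔ lit 0 ︔
    ruleLeftBank [ lit 0 ]≔ lit 0 ︔
    ruleRightBank [ lit 0 ]≔ lit 0 ︔
    ruleRootBank [ lit 0 ]≔ lit 0 ︔
    for xBank xLimit (val rulesBank ⊖ lit 1) oneRule

  -- The table is a linear array. Its index is a mixed radix numeral with the digits `S` (radix
  -- 2^M), `j` (radix n + 1) and `i`.
  cellᵉ : NatExp → NatExp → NatExp → NatExp
  cellᵉ i j S = S ⊕ val subsetsBank ⊗ (j ⊕ (lit 1 ⊕ nᵉ) ⊗ i)

  effectiveWeight : NumExp
  effectiveWeight =
    val# weightBank
    ⊞ cast (lit 1 ⊖ (val kBank ⊖ val iBank)) ⊠ load# q-bank (val iBank)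
    ⊞ cast (lit 1 ⊖ (val jBank ⊖ (lit 1 ⊕ val kBank))) ⊠ load# q-bank (val jBank)

  candidate : NumExp
  candidate =
    effectiveWeight ⊠ cast (load priceBank (load ruleRootBank (val tBank)))
    ⊞ (load# valueBank (cellᵉ (val iBank) (val kBank) (load ruleLeftBank (val tBank)))
       ⊞ load# valueBank (cellᵉ (lit 1 ⊕ val kBank) (val jBank) (load ruleRightBank (val tBank))))

  -- Equality is expressed by two inequalities and disjunction by De Morgan: the rule splits exactly
  -- the set `S`, and either nothing has been stored yet or the new value is no worse. The key 0
  -- takes the place of an infinite value.
  improves : BoolExp
  improves =
    (load ruleBank (val tBank) `≤ val SBank `∧ val SBank `≤ load ruleBank (val tBank))
    `∧ `not (`not (val bestKey `≤ lit 0) `∧ `not (val# newValue `≤# val# bestValue))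

  try : Program
  try =
    newValue ≔# candidate ︔
    `if improves then
      (bestValue ≔# val# newValue ︔
       bestKey ≔ lit 1 ⊕ val kBank ︔
       bestRule ≔ val tBank)
    else skip

  search : Program
  search =
    bestKey ≔ lit 0 ︔
    -- For an empty interval nothing is tried and this 0 is the value of a single external node.
    -- Otherwise the first admissible rule replaces it, whatever its value, because `bestKey` is
    -- still 0.
    bestValue ≔# cast (lit 0) ︔
    for kkBank kkLimit (val dBank)
      (kBank ≔ val iBank ⊕ val kkBank ︔
       for tBank tLimit (val rulesBank) try)

  thisCell : NatExp
  thisCell = cellᵉ (val iBank) (val jBank) (val SBank)

  cell : Program
  cell =
    search ︔
    valueBank [ thisCell ]≔# val# bestValue ︔
    keyBank [ thisCell ]≔ val bestKey ︔
    choiceBank [ thisCell ]≔ val bestRule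

  -- The last assignment prepares the weight for i ∸ 1; for i = 0 its value is
  -- meaningless and not used.
  interval : Program
  interval =
    iBank ≔ val jBank ⊖ val dBank ︔
    for SBank SLimit (val subsetsBank) cell ︔
    weightBank ≔# load# q-bank (val iBank ⊖ lit 1) ⊞ load# p-bank (val iBank) ⊞ val# weightBank

  -- For a fixed right end `j` the left end runs down from `j`. A cell then needs only earlier
  -- columns, for the left subtree, and earlier rows of its own column, for the right one; and the
  -- weight of the interval is updated in constant time.
  table : Program
  table =
    for jBank jLimit (lit 1 ⊕ nᵉ)
      (weightBank ≔# load# q-bank (val jBank) ︔
       for dBank dLimit (lit 1 ⊕ val jBank) interval)

  locate : Program
  locate = cellBank ≔ thisCell

  here : BoolExp
  here = load keyBank (val cellBank) `≤ (lit 1 ⊕ val xBank) `∧ (lit 1 ⊕ val xBank) `≤ load keyBank (val cellBank)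

  descend : Program
  descend =
    tBank ≔ load choiceBank (val cellBank) ︔
    -- Equality has been excluded by the loop test, so this separates the two sides of the root. The
    -- cell stores k + 1: the left interval ends at k, the right one begins at k + 1.
    `if (lit 1 ⊕ val xBank) `≤ load keyBank (val cellBank) then
      (jBank ≔ load keyBank (val cellBank) ⊖ lit 1 ︔
       SBank ≔ load ruleLeftBank (val tBank))
    else
      (iBank ≔ load keyBank (val cellBank) ︔
       SBank ≔ load ruleRightBank (val tBank)) ︔
    locate

  toWholeTree : Program
  toWholeTree =
    iBank ≔ lit 0 ︔
    jBank ≔ nᵉ ︔
    -- The numeral 2^M - 1, all of whose binary digits are 1, is the set of all fast addresses.
    SBank ≔ val subsetsBank ⊖ lit 1

  writeNode : Program
  writeNode =
    tBank ≔ load choiceBank (val cellBank) ︔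
    leftBank [ lit 1 ⊕ val xBank ]≔
      load keyBank (cellᵉ (val iBank) (val xBank) (load ruleLeftBank (val tBank))) ︔
    rightBank [ lit 1 ⊕ val xBank ]≔
      load keyBank (cellᵉ (lit 1 ⊕ val xBank) (val jBank) (load ruleRightBank (val tBank))) ︔
    ψ-bank [ lit 1 ⊕ val xBank ]≔ load ruleRootBank (val tBank)

  -- A traversal would need a stack. Instead each key is searched for from the root, where the
  -- stored choices say which way to go; this takes time O(n) per key, which is negligible beside
  -- the table.
  writeTree : Program
  writeTree =
    toWholeTree ︔
    rootBank [ lit 0 ]≔ load keyBank thisCell ︔
    for xBank xLimit nᵉ
      (toWholeTree ︔
       locate ︔
       `while `not here loop descend ︔
       writeNode)

  identity : Program
  identity =
    for xBank xLimit nᵉ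
      (φ-bank [ lit 1 ⊕ val xBank ]≔ lit 1 ⊕ val xBank ︔
       inverseBank [ lit 1 ⊕ val xBank ]≔ lit 1 ⊕ val xBank)

  -- Key x exchanges addresses with the key that has the address intended for x.
  move : Program
  move =
    aBank ≔ load ψ-bank (lit 1 ⊕ val xBank) ︔
    `if lit 1 `≤ val aBank then
      (kBank ≔ load inverseBank (val aBank) ︔
       bBank ≔ load φ-bank (lit 1 ⊕ val xBank) ︔
       φ-bank [ val kBank ]≔ val bBank ︔
       inverseBank [ val bBank ]≔ val kBank ︔
       φ-bank [ lit 1 ⊕ val xBank ]≔ val aBank ︔
       inverseBank [ val aBank ]≔ lit 1 ⊕ val xBank)
    else skip

  assignAddresses : Program
  assignAddresses = identity ︔ for xBank xLimit nᵉ move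

  algorithm : Program
  algorithm = (sizes ︔ prices ︔ rules) ︔ table ︔ writeTree ︔ assignAddresses

-- Filling the table: the loops establish the Bellman equations

module Search where

  open Semantics
  open Codes
  open Algorithm
  open import Data.Nat.Base as ℕ using (ℕ; zero; suc; _∸_; _<_; z≤n; s≤s; NonZero)
  import Data.Nat.Properties as ℕ
  open import Relation.Binary.PropositionalEquality

  test : ∀ {a b c d} {A : Set a} {B : Set b} {C : Set c} {E : Set d} → Dec A → Dec B → Dec C → Dec E → Bool
  test a? b? c? e? = (does a? ∧ does b?) ∧ not (not (does c?) ∧ not (does e?))

  test-true : ∀ {a b c d} {A : Set a} {B : Set b} {C : Set c} {E : Set d}
    (a? : Dec A) (b? : Dec B) (c? : Dec C) (e? : Dec E) →
    test a? b? c? e? ≡ true → A × B × (C ⊎ E)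
  test-true (yes a) (yes b) (yes c) _       eq = a , b , inj₁ c
  test-true (yes a) (yes b) (no _)  (yes e) eq = a , b , inj₂ e

  test-false : ∀ {a b c d} {A : Set a} {B : Set b} {C : Set c} {E : Set d}
    (a? : Dec A) (b? : Dec B) (c? : Dec C) (e? : Dec E) →
    test a? b? c? e? ≡ false → A → B → (¬ C) × (¬ E)
  test-false (yes _) (yes _) (no ¬c) (no ¬e) eq a b = ¬c , ¬e
  test-false (no ¬a) _       _       _       eq a b = contradiction a ¬a
  test-false (yes _) (no ¬b) _       _       eq a b = contradiction b ¬b

  -- The parameters stand for the contents of the banks rather than for the instance. So the loops
  -- preserve plain equalities between numbers of `K`, although the input is given up to `≈`.
  module Bellman {c ℓ₁ ℓ₂ : Level} (K : OrderedCommutativeRing c ℓ₁ ℓ₂)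
    (n D N : ℕ) (price s sˡ sʳ root : ℕ → ℕ)
    (p q : ℕ → OrderedCommutativeRing.Carrier K) where
    open OrderedCommutativeRing K using (Carrier; _+_; _*_; 0#; _≤_; fromℕ#)

    weight : ℕ → ℕ → Carrier
    weight i zero    = q i
    weight i (suc d) = q i + p (suc i) + weight (suc i) d

    -- The weight of the subtree over zᵢ , … , zⱼ , plus the weights of the
    -- external nodes that are children of its root xₖ₊₁: zᵢ is one if k ≡ i, and
    -- zⱼ is one if j ≡ suc k.
    load-at : ℕ → ℕ → ℕ → Carrier
    load-at i j k = weight i (j ∸ i) + fromℕ# (1 ∸ (k ∸ i)) * q i + fromℕ# (1 ∸ (j ∸ suc k)) * q j

    cand : (ℕ → ℕ → ℕ → Carrier) → ℕ → ℕ → ℕ → ℕ → Carrier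
    cand V i j k t =
      load-at i j k * fromℕ# (price (root t)) + (V i k (sˡ t) + V (suc k) j (sʳ t))

    -- κ is one more than the best root tried so far, θ its rule, and κ ≡ 0 if
    -- nothing has been tried.
    record Best {ℓ} (V : ℕ → ℕ → ℕ → Carrier) (i j S : ℕ) (Tried : ℕ → ℕ → Set ℓ)
                (v : Carrier) (κ θ : ℕ) : Set (c ⊔ˡ ℓ ⊔ˡ ℓ₂) where
      constructor best
      field
        unset : κ ≡ 0 → v ≡ 0#
        set   : ∀ k → κ ≡ suc k →
                (i ℕ.≤ k) × (k < j) × (θ < N) × (s θ ≡ S) × (v ≡ cand V i j k θ)
        least : ∀ k t → Tried k t → t < N → s t ≡ S → (κ ≢ 0) × (v ≤ cand V i j k t)

    Best-mono : ∀ {ℓ ℓ′} {V i j S v κ θ} {Tried : ℕ → ℕ → Set ℓ} {Tried′ : ℕ → ℕ → Set ℓ′} →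
      (∀ k t → t < N → Tried′ k t → Tried k t) →
      Best V i j S Tried v κ θ → Best V i j S Tried′ v κ θ
    Best-mono f (best u w l) = best u w (λ k t tried t<N → l k t (f k t t<N tried) t<N)

    Best-cong : ∀ {ℓ} {V V′ i j S v v′ κ κ′ θ θ′} {Tried : ℕ → ℕ → Set ℓ} →
      (∀ k t → i ℕ.≤ k → k < j → t < N → cand V i j k t ≡ cand V′ i j k t) →
      (∀ k t → Tried k t → (i ℕ.≤ k) × (k < j)) → v ≡ v′ → κ ≡ κ′ → θ ≡ θ′ →
      Best V i j S Tried v κ θ → Best V′ i j S Tried v′ κ′ θ′
    Best-cong same inside refl refl refl (best u w l) = best u
      (λ k eq → let i≤k , k<j , t<N , s≡ , v≡ = w k eq in i≤k , k<j , t<N , s≡ , trans v≡ (same _ _ i≤k k<j t<N))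
      (λ k t tried t<N s≡ →
        let i≤k , k<j = inside k t tried
            κ≢0 , v≤  = l k t tried t<N s≡
        in κ≢0 , subst (_ ≤_) (same k t i≤k k<j t<N) v≤)

    cellIndex : ℕ → ℕ → ℕ → ℕ
    cellIndex i j S = S ℕ.+ D ℕ.* (j ℕ.+ suc n ℕ.* i)

    cellIndex-injective : ∀ {i j S i′ j′ S′} → j ℕ.≤ n → j′ ℕ.≤ n → S < D → S′ < D →
      cellIndex i j S ≡ cellIndex i′ j′ S′ → (i ≡ i′) × (j ≡ j′) × (S ≡ S′)
    cellIndex-injective {i} {j} {S} {i′} {j′} {S′} j≤n j′≤n S<D S′<D eq =
      trans (sym ([d+bx]/b (suc n) i (s≤s j≤n))) (trans (cong (ℕ._/ suc n) rest) ([d+bx]/b (suc n) i′ (s≤s j′≤n))) ,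
      trans (sym ([d+bx]%b (suc n) i (s≤s j≤n))) (trans (cong (ℕ._% suc n) rest) ([d+bx]%b (suc n) i′ (s≤s j′≤n))) ,
      trans (sym ([d+bx]%b D _ S<D)) (trans (cong (ℕ._% D) eq) ([d+bx]%b D _ S′<D))
      where
      instance
        _ : NonZero D
        _ = ℕ.>-nonZero (ℕ.≤-<-trans z≤n S<D)
      rest : j ℕ.+ suc n ℕ.* i ≡ j′ ℕ.+ suc n ℕ.* i′
      rest = trans (sym ([d+bx]/b D _ S<D)) (trans (cong (ℕ._/ D) eq) ([d+bx]/b D _ S′<D))

  module _ {a} {A : Set a} where

    select-≡ : ∀ {x y} {u v : A} → x ≡ y → (if does (x ℕ.≟ y) then u else v) ≡ u
    select-≡ {x} {y} eq rewrite dec-true (x ℕ.≟ y) eq = refl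

    select-≢ : ∀ {x y} {u v : A} → x ≢ y → (if does (x ℕ.≟ y) then u else v) ≡ v
    select-≢ {x} {y} ne rewrite dec-false (x ℕ.≟ y) ne = refl

  module DynamicProgram {c ℓ₁ ℓ₂ : Level} (K : OrderedCommutativeRing c ℓ₁ ℓ₂)
    (n D N : ℕ) (price s sˡ sʳ root : ℕ → ℕ)
    (p q : ℕ → OrderedCommutativeRing.Carrier K)
    (1≤n : 1 ℕ.≤ n) (1≤D : 1 ℕ.≤ D) (1≤N : 1 ℕ.≤ N)
    (sˡ<D : ∀ t → t < N → sˡ t < D) (sʳ<D : ∀ t → t < N → sʳ t < D) where
    open Model K
    open Logic K
    open Bellman K n D N price s sˡ sʳ root p q
    open OrderedCommutativeRing K using (Carrier; _≤_; _≤?_; 0#; total; ≤-refl; ≤-trans; ≤-reflexive)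
    module ≈ = OrderedCommutativeRing K

    -- A product rather than a record, so that it carries over definitionally
    -- along assignments to other banks.
    Env : State → Set c
    Env σ = (nat σ sizeBank 0 ≡ n) × (nat σ subsetsBank 0 ≡ D) × (nat σ rulesBank 0 ≡ N)
          × (∀ x → nat σ priceBank x ≡ price x) × (∀ x → nat σ ruleBank x ≡ s x)
          × (∀ x → nat σ ruleLeftBank x ≡ sˡ x) × (∀ x → nat σ ruleRightBank x ≡ sʳ x)
          × (∀ x → nat σ ruleRootBank x ≡ root x)
          × (∀ x → num σ p-bank x ≡ p x) × (∀ x → num σ q-bank x ≡ q x)

    Disturbs : Program → Bool
    Disturbs P =
      writesNat P sizeBank ∨ writesNat P subsetsBank ∨ writesNat P rulesBank ∨
      writesNat P priceBank ∨ writesNat P ruleBank ∨ writesNat P ruleLeftBank ∨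
      writesNat P ruleRightBank ∨ writesNat P ruleRootBank ∨
      writesNum P p-bank ∨ writesNum P q-bank

    Env-frame : ∀ P {σ τ} → Disturbs P ≡ false → Frame P σ τ → Env σ → Env τ
    Env-frame P w f (e₀ , e₁ , e₂ , e₃ , e₄ , e₅ , e₆ , e₇ , e₈ , e₉) =
      let w₀ , w = ∨-false w
          w₁ , w = ∨-false w
          w₂ , w = ∨-false w
          w₃ , w = ∨-false w
          w₄ , w = ∨-false w
          w₅ , w = ∨-false w
          w₆ , w = ∨-false w
          w₇ , w = ∨-false w
          w₈ , w₉ = ∨-false w
      in
      trans (natF f sizeBank w₀ 0) e₀ , trans (natF f subsetsBank w₁ 0) e₁ , trans (natF f rulesBank w₂ 0) e₂ ,
      (λ x → trans (natF f priceBank w₃ x) (e₃ x)) , (λ x → trans (natF f ruleBank w₄ x) (e₄ x)) ,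
      (λ x → trans (natF f ruleLeftBank w₅ x) (e₅ x)) , (λ x → trans (natF f ruleRightBank w₆ x) (e₆ x)) ,
      (λ x → trans (natF f ruleRootBank w₇ x) (e₇ x)) ,
      (λ x → trans (numF f p-bank w₈ x) (e₈ x)) , (λ x → trans (numF f q-bank w₉ x) (e₉ x))

    module Cell (i j d S : ℕ) (V : ℕ → ℕ → ℕ → Carrier) (i+d≡j : i ℕ.+ d ≡ j) (j≤n : j ℕ.≤ n) where

      Ctx : State → Set c
      Ctx σ = Env σ × (nat σ iBank 0 ≡ i) × (nat σ jBank 0 ≡ j) × (nat σ dBank 0 ≡ d) × (nat σ SBank 0 ≡ S)
            × (num σ weightBank 0 ≡ weight i (j ∸ i))
            × (∀ a b S → num σ valueBank (cellIndex a b S) ≡ V a b S)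

      Ctx-frame : ∀ P {σ τ} →
        Disturbs P ∨ writesNat P iBank ∨ writesNat P jBank ∨ writesNat P dBank ∨ writesNat P SBank
          ∨ writesNum P weightBank ∨ writesNum P valueBank ≡ false →
        Frame P σ τ → Ctx σ → Ctx τ
      Ctx-frame P w f (env , ei , ej , ed , eS , eW , eV) =
        let w₀ , w = ∨-false {Disturbs P} w
            w₁ , w = ∨-false w
            w₂ , w = ∨-false w
            w₃ , w = ∨-false w
            w₄ , w = ∨-false w
            w₅ , w₆ = ∨-false w
        in Env-frame P w₀ f env , trans (natF f iBank w₁ 0) ei , trans (natF f jBank w₂ 0) ej ,
           trans (natF f dBank w₃ 0) ed , trans (natF f SBank w₄ 0) eS , trans (numF f weightBank w₅ 0) eW ,
           (λ a b S → trans (numF f valueBank w₆ (cellIndex a b S)) (eV a b S))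

      candidate-value : ∀ σ → Ctx σ →
        numVal candidate σ ≡ cand V i j (nat σ kBank 0) (nat σ tBank 0)
      candidate-value σ ((e₀ , e₁ , e₂ , e₃ , e₄ , e₅ , e₆ , e₇ , e₈ , e₉) , ei , ej , ed , eS , eW , eV)
        rewrite ei | ej | e₀ | e₁ | e₅ (nat σ tBank 0) | e₆ (nat σ tBank 0) | e₇ (nat σ tBank 0)
              | e₃ (root (nat σ tBank 0)) | eW | e₉ i | e₉ j
              | eV i (nat σ kBank 0) (sˡ (nat σ tBank 0)) | eV (suc (nat σ kBank 0)) j (sʳ (nat σ tBank 0)) = refl

      BestIn : ∀ {ℓ} (Tried : ℕ → ℕ → Set ℓ) → State → Set (c ⊔ˡ ℓ ⊔ˡ ℓ₂)
      BestIn Tried σ = Best V i j S Tried (num σ bestValue 0) (nat σ bestKey 0) (nat σ bestRule 0)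

      -- The order of the two nested loops. Among rules below `N`, at `t` = 0 it amounts to the
      -- bound `k′ < k` alone and at `t` = `N` to `k′ ≤ k`, which joins the invariant of the inner
      -- loop to that of the outer one.
      Before : ℕ → ℕ → ℕ → ℕ → Set
      Before k t k′ t′ = ((i ℕ.≤ k′) × (k′ < k)) ⊎ ((k′ ≡ k) × (t′ < t))

      Improves : ℕ → ℕ → Carrier → Carrier → Set _
      Improves r κ x v = (r ≡ S) × ((κ ≡ 0) ⊎ (x ≤ v))

      improves? : ℕ → ℕ → ℕ → Carrier → Carrier → Bool
      improves? r S κ x v =
        (does (r ℕ.≤? S) ∧ does (S ℕ.≤? r)) ∧ not (not (does (κ ℕ.≤? 0)) ∧ not (does (x ≤? v)))

      improves-true : ∀ {r κ x v} → improves? r S κ x v ≡ true → Improves r κ x v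
      improves-true {r} {κ} {x} {v} eq =
        let r≤S , S≤r , better = test-true (r ℕ.≤? S) (S ℕ.≤? r) (κ ℕ.≤? 0) (x ≤? v) eq
        in ℕ.≤-antisym r≤S S≤r , map₁ ℕ.n≤0⇒n≡0 better

      improves-false : ∀ {r κ x v} → improves? r S κ x v ≡ false → r ≡ S → (κ ≢ 0) × (v ≤ x)
      improves-false {r} {κ} {x} {v} eq r≡S =
        let κ≰0 , x≰v = test-false (r ℕ.≤? S) (S ℕ.≤? r) (κ ℕ.≤? 0) (x ≤? v) eq
                          (ℕ.≤-reflexive r≡S) (ℕ.≤-reflexive (sym r≡S))
        in (λ κ≡0 → κ≰0 (ℕ.≤-reflexive κ≡0)) , [ id , (λ x≤v → contradiction x≤v x≰v) ]′ (total v x)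

      try-run : ∀ σ {k t} → Ctx σ → nat σ kBank 0 ≡ k → nat σ tBank 0 ≡ t → i ℕ.≤ k → k < j → t < N →
        BestIn (Before k t) σ → Run try σ (BestIn (Before k (suc t))) 200
      try-run σ {k} {t} ctx ek et i≤k k<j t<N bst =
        -- Like the other constants, 200 is a generous round number; the exact running time is a
        -- closed term, and the comparison is decided by evaluation.
        weaken (ℕ.≤ᵇ⇒≤ (2 ℕ.+ numTime candidate ℕ.+ (1 ℕ.+ boolTime improves ℕ.+ (20 ℕ.+ 1))) 200 tt) (λ _ x → x)
          (seq (assign# (branch yes′ no′)))
        where
        ρ : State
        ρ = ⟪ nat σ , num σ [ newValue , 0 ↦ numVal candidate σ ] ⟫
        new≡ : numVal candidate σ ≡ cand V i j k t
        new≡ = trans (candidate-value σ ctx) (cong₂ (cand V i j) ek et)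
        rule≡ : nat σ ruleBank (nat σ tBank 0) ≡ s t
        rule≡ = trans (proj₁ (proj₂ (proj₂ (proj₂ (proj₂ (proj₁ ctx))))) (nat σ tBank 0)) (cong s et)
        S≡ : nat σ SBank 0 ≡ S
        S≡ = proj₁ (proj₂ (proj₂ (proj₂ (proj₂ ctx))))
        test≡ : boolVal improves ρ ≡ improves? (s t) S (nat σ bestKey 0) (cand V i j k t) (num σ bestValue 0)
        test≡ = trans
          (cong₂ (λ r S → improves? r S (nat σ bestKey 0) (numVal candidate σ) (num σ bestValue 0)) rule≡ S≡)
          (cong (λ x → improves? (s t) S (nat σ bestKey 0) x (num σ bestValue 0)) new≡)
        cases : ∀ {k′ t′} → Before k (suc t) k′ t′ → Before k t k′ t′ ⊎ ((k′ ≡ k) × (t′ ≡ t))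
        cases (inj₁ x) = inj₁ (inj₁ x)
        cases (inj₂ (eq , s≤s t′≤t)) with ℕ.m≤n⇒m<n∨m≡n t′≤t
        ... | inj₁ lt = inj₁ (inj₂ (eq , lt))
        ... | inj₂ e  = inj₂ (eq , e)
        better : Improves (s t) (nat σ bestKey 0) (cand V i j k t) (num σ bestValue 0) →
                 Best V i j S (Before k (suc t)) (cand V i j k t) (suc k) t
        better (r≡S , imp) = best (λ ()) (λ { _ refl → i≤k , k<j , t<N , r≡S , refl }) least′
          where
          least′ : ∀ k′ t′ → Before k (suc t) k′ t′ → t′ < N → s t′ ≡ S →
                   (suc k ≢ 0) × (cand V i j k t ≤ cand V i j k′ t′)
          least′ k′ t′ tried t′<N s≡ with cases tried
          ... | inj₂ (refl , refl) = (λ ()) , ≤-refl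
          ... | inj₁ old =
            let κ≢0 , v≤ = Best.least bst k′ t′ old t′<N s≡
            in (λ ()) , [ (λ κ≡0 → contradiction κ≡0 κ≢0) , (λ x≤v → ≤-trans x≤v v≤) ]′ imp
        yes′ : boolVal improves ρ ≡ true →
          Run (bestValue ≔# val# newValue ︔ bestKey ≔ lit 1 ⊕ val kBank ︔ bestRule ≔ val tBank) ρ
              (BestIn (Before k (suc t))) 20
        yes′ ok = weaken (ℕ.≤ᵇ⇒≤ _ 20 tt) (λ _ x → x) (seq (assign# (seq (assign (assign
          (subst₂ (λ x κ → Best V i j S (Before k (suc t)) x (suc κ) (nat σ tBank 0)) (sym new≡) (sym ek)
            (subst (Best V i j S (Before k (suc t)) (cand V i j k t) (suc k)) (sym et)
              (better (improves-true (trans (sym test≡) ok))))))))))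
        no′ : boolVal improves ρ ≡ false → Run skip ρ (BestIn (Before k (suc t))) 1
        no′ ko = runSkip (best (Best.unset bst) (Best.set bst) least′)
          where
          least′ : ∀ k′ t′ → Before k (suc t) k′ t′ → t′ < N → s t′ ≡ S →
                   (nat σ bestKey 0 ≢ 0) × (num σ bestValue 0 ≤ cand V i j k′ t′)
          least′ k′ t′ tried t′<N s≡ with cases tried
          ... | inj₁ old = Best.least bst k′ t′ old t′<N s≡
          ... | inj₂ (refl , refl) = improves-false (trans (sym test≡) ko) s≡

      search-run : ∀ σ → Ctx σ →
        Run search σ (BestIn (λ k _ → (i ℕ.≤ k) × (k < j))) (500 ℕ.* (n ℕ.* N))
      search-run σ ctx =
        weaken (bound-sum 7 400 500 (ℕ.*-mono-≤ 1≤n 1≤N) outer-bound)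
          (λ _ → Best-mono (λ { k _ _ (i≤k , k<j) → i≤k , subst (k <_) (sym i+d≡j) k<j }))
          (seq (assign (seq (assign# (forRun {P = inner} {X = kkBank} {L = kkLimit} {e = val dBank}
            Inv d (proj₁ (proj₂ (proj₂ (proj₂ ctx)))) refl refl refl refl id id start step)))))
        where
        inner : Program
        inner = kBank ≔ val iBank ⊕ val kkBank ︔ for tBank tLimit (val rulesBank) try
        Inv : ℕ → State → Set _
        Inv kk = BestIn (λ k _ → (i ℕ.≤ k) × (k < i ℕ.+ kk))
        d≤n : d ℕ.≤ n
        d≤n = ℕ.≤-trans (ℕ.m≤n+m d i) (ℕ.≤-trans (ℕ.≤-reflexive i+d≡j) j≤n)
        outer-bound : d ℕ.* (14 ℕ.+ (7 ℕ.+ (N ℕ.* (14 ℕ.+ 200) ℕ.+ 15))) ℕ.+ 15 ℕ.≤ 400 ℕ.* (n ℕ.* N)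
        outer-bound = loop-bound 2 300 400 d≤n 1≤n 1≤N
          (bound-sum 7 250 300 1≤N (ℕ.≤-trans
            (loop-bound {Y = 1} 2 200 250 ℕ.≤-refl 1≤N ℕ.≤-refl ℕ.≤-refl)
            (ℕ.≤-reflexive (cong (250 ℕ.*_) (ℕ.*-identityʳ N)))))
        start : Best V i j S (λ k _ → (i ℕ.≤ k) × (k < i ℕ.+ 0)) 0# 0 (nat σ bestRule 0)
        start = best (λ _ → refl) (λ _ ())
          (λ { k _ (i≤k , k<i) → contradiction (subst (k <_) (ℕ.+-identityʳ i) k<i) (ℕ.≤⇒≯ i≤k) })
        step : ∀ kk {ρ} → kk < d → nat ρ kkBank 0 ≡ kk →
               Frame (for kkBank kkLimit (val dBank) inner) _ ρ → Inv kk ρ → Run inner ρ (Inv (suc kk)) (7 ℕ.+ (N ℕ.* (14 ℕ.+ 200) ℕ.+ 15))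
        step kk {ρ} kk<d ekk fr inv =
          weaken ℕ.≤-refl (λ _ → Best-mono after)
            (seq (assign (forRun {P = try} {X = tBank} {L = tLimit} {e = val rulesBank}
              (λ t → BestIn (Before k t)) N (proj₁ (proj₂ (proj₂ (proj₁ ctxρ)))) refl refl refl refl id id
              (Best-mono before inv)
              (λ t t<N et fr′ bst →
                try-run _ (Ctx-frame (for tBank tLimit (val rulesBank) try) refl fr′ ctxρ)
                  (trans (natF fr′ kBank refl 0) ek) et (ℕ.m≤m+n i kk) k<j t<N bst))))
          where
          k = i ℕ.+ kk
          ctxρ : Ctx ρ
          ctxρ = Ctx-frame (for kkBank kkLimit (val dBank) inner) refl fr ctx
          ek : nat ρ iBank 0 ℕ.+ nat ρ kkBank 0 ≡ k
          ek = cong₂ ℕ._+_ (proj₁ (proj₂ ctxρ)) ekk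
          k<j : k < j
          k<j = ℕ.<-≤-trans (ℕ.+-monoʳ-< i kk<d) (ℕ.≤-reflexive i+d≡j)
          before : ∀ k′ t → t < N → Before k 0 k′ t → (i ℕ.≤ k′) × (k′ < k)
          before k′ t _ (inj₁ x) = x
          after : ∀ k′ t → t < N → (i ℕ.≤ k′) × (k′ < i ℕ.+ suc kk) → Before k N k′ t
          after k′ t t<N (i≤k′ , k′<) with ℕ.m≤n⇒m<n∨m≡n (ℕ.s≤s⁻¹ (subst (suc k′ ℕ.≤_) (ℕ.+-suc i kk) k′<))
          ... | inj₁ lt = inj₁ (i≤k′ , lt)
          ... | inj₂ e  = inj₂ (e , t<N)

    V-of : State → ℕ → ℕ → ℕ → Carrier
    V-of σ i j S = num σ valueBank (cellIndex i j S)

    K-of T-of : State → ℕ → ℕ → ℕ → ℕ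
    K-of σ i j S = nat σ keyBank (cellIndex i j S)
    T-of σ i j S = nat σ choiceBank (cellIndex i j S)

    Inside : ℕ → ℕ → ℕ → ℕ → Set
    Inside i j k _ = (i ℕ.≤ k) × (k < j)

    -- The Bellman equation of a cell, relative to the very table that contains the cell. Its
    -- preservation requires that later writes avoid the cell and also all cells it refers to.
    Settled : State → ℕ → ℕ → ℕ → Set (c ⊔ˡ ℓ₂)
    Settled σ i j S = Best (V-of σ) i j S (Inside i j) (V-of σ i j S) (K-of σ i j S) (T-of σ i j S)

    SameExcept : ℕ → State → State → Set c
    SameExcept x σ τ = ∀ z → z ≢ x →
      (num τ valueBank z ≡ num σ valueBank z) × (nat τ keyBank z ≡ nat σ keyBank z)
      × (nat τ choiceBank z ≡ nat σ choiceBank z)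

    SameExcept-cand : ∀ {x} σ τ {i j} → SameExcept x σ τ →
      (∀ k S → k < j → S < D → cellIndex i k S ≢ x) → (∀ k S → i ℕ.≤ k → k < j → S < D → cellIndex (suc k) j S ≢ x) →
      ∀ k t → i ℕ.≤ k → k < j → t < N → cand (V-of σ) i j k t ≡ cand (V-of τ) i j k t
    SameExcept-cand σ τ same left right k t i≤k k<j t<N = sym (cong₂ (λ a b → _ ≈.* _ ≈.+ (a ≈.+ b))
      (proj₁ (same _ (left k _ k<j (sˡ<D t t<N)))) (proj₁ (same _ (right k _ i≤k k<j (sʳ<D t t<N)))))

    -- In the order in which the table is filled.
    Earlier : (j i S j′ i′ S′ : ℕ) → Set
    Earlier j i S j′ i′ S′ = (j′ < j) ⊎ ((j′ ≡ j) × ((i < i′) ⊎ ((i′ ≡ i) × (S′ < S))))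

    SettledBefore : (j i S : ℕ) → State → Set (c ⊔ˡ ℓ₂)
    SettledBefore j i S σ = ∀ i′ j′ S′ → i′ ℕ.≤ j′ → j′ ℕ.≤ n → S′ < D → Earlier j i S j′ i′ S′ → Settled σ i′ j′ S′

    module _ (i j d S : ℕ) (i+d≡j : i ℕ.+ d ≡ j) (j≤n : j ℕ.≤ n) (S<D : S < D) where

      private
        x : ℕ
        x = cellIndex i j S

      Written : State → State → Set (c ⊔ˡ ℓ₂)
      Written σ τ = SameExcept x σ τ
        × Best (V-of σ) i j S (Inside i j) (num τ valueBank x) (nat τ keyBank x) (nat τ choiceBank x)

      cell-writes : ∀ σ → Cell.Ctx i j d S (V-of σ) i+d≡j j≤n σ → Run cell σ (Written σ) (600 ℕ.* (n ℕ.* N))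
      cell-writes σ ctx = weaken
        (ℕ.≤-trans (ℕ.≤-reflexive (ℕ.+-comm (500 ℕ.* (n ℕ.* N)) 60))
          (bound-sum 60 500 600 {Y = n ℕ.* N} (ℕ.*-mono-≤ 1≤n 1≤N) ℕ.≤-refl))
        (λ _ y → y)
        (seq (weaken ℕ.≤-refl write (search-run σ ctx)))
        where
        open Cell i j d S (V-of σ) i+d≡j j≤n
        write : ∀ {ρ} → Frame search σ ρ → BestIn (Inside i j) ρ →
          Run (valueBank [ thisCell ]≔# val# bestValue ︔ keyBank [ thisCell ]≔ val bestKey
               ︔ choiceBank [ thisCell ]≔ val bestRule) ρ (Written σ) 60
        write {ρ} fr bst = weaken (ℕ.≤ᵇ⇒≤ _ 60 tt) (λ _ y → y) (seq (assign# (seq (assign (assign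
            ((λ z z≢x → trans (select-≢ (z≢x ∘ at z)) (numF fr valueBank refl z)
                      , trans (select-≢ (z≢x ∘ at z)) (natF fr keyBank refl z)
                      , trans (select-≢ (z≢x ∘ at z)) (natF fr choiceBank refl z))
            , Best-cong (λ _ _ _ _ _ → refl) (λ _ _ y → y)
                (sym (select-≡ here≡)) (sym (select-≡ here≡)) (sym (select-≡ here≡)) bst))))))
          where
          here≡ : natVal thisCell ρ ≡ x
          here≡ with Ctx-frame search refl fr ctx
          ... | (e₀ , e₁ , _) , ei , ej , _ , eS , _
            rewrite ei | ej | eS | e₀ | e₁ = refl
          at : ∀ z → natVal thisCell ρ ≡ z → z ≡ x
          at z eq = trans (sym eq) here≡

      -- A cell refers only to cells with a smaller right end, or with the same right end and a
      -- larger left end. Neither the cell just written nor any cell settled before it can therefore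
      -- refer to the cell just written.
      cell-run : ∀ σ → Cell.Ctx i j d S (V-of σ) i+d≡j j≤n σ → SettledBefore j i S σ →
        Run cell σ (SettledBefore j i (suc S)) (600 ℕ.* (n ℕ.* N))
      cell-run σ ctx settled = weaken ℕ.≤-refl settle (cell-writes σ ctx)
        where
        settle : ∀ {τ} → Frame cell σ τ → Written σ τ → SettledBefore j i (suc S) τ
        settle {τ} _ (same , new) i′ j′ S′ i′≤j′ j′≤n S′<D earlier = cases earlier
          where
          old : Earlier j i S j′ i′ S′ → Settled τ i′ j′ S′
          old e = Best-cong
            (SameExcept-cand {x} σ τ same
              (λ k S″ k<j′ S″<D eq → ℕ.<⇒≢ (ℕ.<-≤-trans k<j′ j′≤j)
                (proj₁ (proj₂ (cellIndex-injective (ℕ.<⇒≤ (ℕ.<-≤-trans k<j′ j′≤n)) j≤n S″<D S<D eq))))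
              (λ k S″ i′≤k k<j′ S″<D eq → right≢ k S″ i′≤k (cellIndex-injective j′≤n j≤n S″<D S<D eq)))
            (λ _ _ y → y)
            (sym (proj₁ here-same)) (sym (proj₁ (proj₂ here-same))) (sym (proj₂ (proj₂ here-same)))
            (settled i′ j′ S′ i′≤j′ j′≤n S′<D e)
            where
            j′≤j : j′ ℕ.≤ j
            j′≤j = [ ℕ.<⇒≤ , (λ y → ℕ.≤-reflexive (proj₁ y)) ]′ e
            i≤i′ : j′ ≡ j → i ℕ.≤ i′
            i≤i′ j′≡j = [ (λ j′<j → contradiction j′≡j (ℕ.<⇒≢ j′<j))
                        , (λ y → [ ℕ.<⇒≤ , (λ z → ℕ.≤-reflexive (sym (proj₁ z))) ]′ (proj₂ y)) ]′ e
            right≢ : ∀ k S″ → i′ ℕ.≤ k → ¬ ((suc k ≡ i) × (j′ ≡ j) × (S″ ≡ S))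
            right≢ k S″ i′≤k (refl , j′≡j , _) = ℕ.<⇒≱ (s≤s i′≤k) (i≤i′ j′≡j)
            here-same = same (cellIndex i′ j′ S′) (λ eq → self (cellIndex-injective j′≤n j≤n S′<D S<D eq) e)
              where
              self : (i′ ≡ i) × (j′ ≡ j) × (S′ ≡ S) → ¬ Earlier j i S j′ i′ S′
              self (refl , refl , refl) (inj₁ lt)                     = ℕ.<-irrefl refl lt
              self (refl , refl , refl) (inj₂ (_ , inj₁ lt))          = ℕ.<-irrefl refl lt
              self (refl , refl , refl) (inj₂ (_ , inj₂ (_ , lt)))    = ℕ.<-irrefl refl lt
          fresh : i′ ≡ i → j′ ≡ j → S′ ≡ S → Settled τ i′ j′ S′
          fresh refl refl refl = Best-cong
            (SameExcept-cand {x} σ τ same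
              (λ k S″ k<j S″<D eq → ℕ.<⇒≢ k<j
                (proj₁ (proj₂ (cellIndex-injective (ℕ.<⇒≤ (ℕ.<-≤-trans k<j j≤n)) j≤n S″<D S<D eq))))
              (λ k S″ i≤k k<j S″<D eq → ℕ.<⇒≢ (s≤s i≤k)
                (sym (proj₁ (cellIndex-injective j≤n j≤n S″<D S<D eq)))))
            (λ _ _ y → y) refl refl refl new
          cases : Earlier j i (suc S) j′ i′ S′ → Settled τ i′ j′ S′
          cases (inj₁ lt) = old (inj₁ lt)
          cases (inj₂ (eq , inj₁ lt)) = old (inj₂ (eq , inj₁ lt))
          cases (inj₂ (eq , inj₂ (eq′ , s≤s le))) with ℕ.m≤n⇒m<n∨m≡n le
          ... | inj₁ lt = old (inj₂ (eq , inj₂ (eq′ , lt)))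
          ... | inj₂ e  = fresh eq′ eq e

    -- In column `j` the rows above j - d are settled. The condition avoids subtraction, which would
    -- be truncated at the end of the column, where `d` is `suc j` and row 0 has to be included.
    Column : ℕ → ℕ → State → Set (c ⊔ˡ ℓ₂)
    Column j d σ = ∀ i′ j′ S′ → i′ ℕ.≤ j′ → j′ ℕ.≤ n → S′ < D →
                   (j′ < j) ⊎ ((j′ ≡ j) × (j < i′ ℕ.+ d)) → Settled σ i′ j′ S′

    ColumnInv : ℕ → ℕ → State → Set (c ⊔ˡ ℓ₂)
    ColumnInv j d σ = Column j d σ × (d ℕ.≤ j → num σ weightBank 0 ≡ weight (j ∸ d) d)

    -- Bounds the `suc n` rounds of the two outer loops by a multiple of `n`, so that the time
    -- bounds remain products.
    2n : ℕ
    2n = 2 ℕ.* n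

    1+n≤2n : suc n ℕ.≤ 2n
    1+n≤2n = ℕ.≤-trans (ℕ.+-monoˡ-≤ n 1≤n) (ℕ.≤-reflexive (cong (n ℕ.+_) (sym (ℕ.+-identityʳ n))))

    1≤2n : 1 ℕ.≤ 2n
    1≤2n = ℕ.≤-trans 1≤n (ℕ.m≤m+n n _)

    cellsTime : ℕ
    cellsTime = D ℕ.* (14 ℕ.+ 600 ℕ.* (n ℕ.* N)) ℕ.+ 15

    1≤nN : 1 ℕ.≤ n ℕ.* N
    1≤nN = ℕ.*-mono-≤ 1≤n 1≤N

    interval-run : ∀ σ j d → Env σ → nat σ jBank 0 ≡ j → nat σ dBank 0 ≡ d → d ℕ.≤ j → j ℕ.≤ n →
      ColumnInv j d σ → Run interval σ (ColumnInv j (suc d)) (7 ℕ.+ (cellsTime ℕ.+ 14))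
    interval-run σ j d env ej ed d≤j j≤n (settled , weighed) =
      seq (assign (seq (weaken ℕ.≤-refl finish
        (forRun {P = cell} {X = SBank} {L = SLimit} {e = val subsetsBank}
          (SettledBefore j i) D (proj₁ (proj₂ env)) refl refl refl refl id id
          start step))))
      where
      i : ℕ
      i = j ∸ d
      i+d≡j : i ℕ.+ d ≡ j
      i+d≡j = ℕ.m∸n+n≡m d≤j
      ei : nat σ jBank 0 ∸ nat σ dBank 0 ≡ i
      ei = cong₂ _∸_ ej ed
      σ₁ : State
      σ₁ = ⟪ nat σ [ iBank , 0 ↦ nat σ jBank 0 ∸ nat σ dBank 0 ] , num σ ⟫
      loop : Program
      loop = for SBank SLimit (val subsetsBank) cell
      weighed′ : num σ weightBank 0 ≡ weight i (j ∸ i)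
      weighed′ = trans (weighed d≤j) (cong (weight i) (sym (ℕ.m∸[m∸n]≡n d≤j)))
      start : SettledBefore j i 0 σ
      start i′ j′ S′ i′≤j′ j′≤n S′<D (inj₁ lt) = settled i′ j′ S′ i′≤j′ j′≤n S′<D (inj₁ lt)
      start i′ j′ S′ i′≤j′ j′≤n S′<D (inj₂ (eq , inj₁ lt)) =
        settled i′ j′ S′ i′≤j′ j′≤n S′<D (inj₂ (eq , subst (_< i′ ℕ.+ d) i+d≡j (ℕ.+-monoˡ-< d lt)))
      step : ∀ S {ρ} → S < D → nat ρ SBank 0 ≡ S → Frame loop σ₁ ρ → SettledBefore j i S ρ →
             Run cell ρ (SettledBefore j i (suc S)) (600 ℕ.* (n ℕ.* N))
      step S {ρ} S<D eS fr before = cell-run i j d S i+d≡j j≤n S<D ρ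
        ( Env-frame loop refl fr env , trans (natF fr iBank refl 0) ei , trans (natF fr jBank refl 0) ej
        , trans (natF fr dBank refl 0) ed , eS , trans (numF fr weightBank refl 0) weighed′ , (λ _ _ _ → refl)) before
      finish : ∀ {ρ} → Frame loop σ₁ ρ → SettledBefore j i D ρ →
        Run (weightBank ≔# load# q-bank (val iBank ⊖ lit 1) ⊞ load# p-bank (val iBank) ⊞ val# weightBank) ρ
            (ColumnInv j (suc d)) 14
      finish {ρ} fr before = weaken (ℕ.≤ᵇ⇒≤ _ 14 tt) (λ _ x → x) (assign# (column , weights))
        where
        envρ : Env ρ
        envρ = Env-frame loop refl fr env
        eiρ : nat ρ iBank 0 ≡ i
        eiρ = trans (natF fr iBank refl 0) ei
        column : Column j (suc d) ρ
        column i′ j′ S′ i′≤j′ j′≤n S′<D (inj₁ lt) = before i′ j′ S′ i′≤j′ j′≤n S′<D (inj₁ lt)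
        column i′ j′ S′ i′≤j′ j′≤n S′<D (inj₂ (eq , j<)) with ℕ.m≤n⇒m<n∨m≡n i≤i′
          where
          i≤i′ : i ℕ.≤ i′
          i≤i′ = ℕ.+-cancelʳ-≤ d i i′
            (ℕ.≤-trans (ℕ.≤-reflexive i+d≡j) (ℕ.s≤s⁻¹ (subst (suc j ℕ.≤_) (ℕ.+-suc i′ d) j<)))
        ... | inj₁ lt = before i′ j′ S′ i′≤j′ j′≤n S′<D (inj₂ (eq , inj₁ lt))
        ... | inj₂ e  = before i′ j′ S′ i′≤j′ j′≤n S′<D (inj₂ (eq , inj₂ (sym e , S′<D)))
        weights : suc d ℕ.≤ j →
          num ρ q-bank (nat ρ iBank 0 ∸ 1) ≈.+ num ρ p-bank (nat ρ iBank 0) ≈.+ num ρ weightBank 0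
            ≡ weight (j ∸ suc d) (suc d)
        weights d<j = begin
          num ρ q-bank (nat ρ iBank 0 ∸ 1) ≈.+ num ρ p-bank (nat ρ iBank 0) ≈.+ num ρ weightBank 0
            ≡⟨ cong (λ x → num ρ q-bank (x ∸ 1) ≈.+ num ρ p-bank x ≈.+ num ρ weightBank 0) (trans eiρ i≡) ⟩
          num ρ q-bank i₀ ≈.+ num ρ p-bank (suc i₀) ≈.+ num ρ weightBank 0
            ≡⟨ cong₂ ≈._+_
                 (cong₂ ≈._+_ (proj₂ (proj₂ (proj₂ (proj₂ (proj₂ (proj₂ (proj₂ (proj₂ (proj₂ envρ)))))))) i₀)
                              (proj₁ (proj₂ (proj₂ (proj₂ (proj₂ (proj₂ (proj₂ (proj₂ (proj₂ envρ)))))))) (suc i₀)))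
                 (trans (numF fr weightBank refl 0) (trans (weighed d≤j) (cong (λ x → weight x d) i≡))) ⟩
          weight i₀ (suc d) ∎
          where
          open ≡-Reasoning
          i₀ : ℕ
          i₀ = j ∸ suc d
          i≡ : i ≡ suc i₀
          i≡ = trans (sym (ℕ.m+n∸n≡m i (suc d)))
                 (trans (cong (_∸ suc d) (trans (ℕ.+-suc i d) (cong suc i+d≡j))) (ℕ.+-∸-assoc 1 d<j))

    tableTime : ℕ
    tableTime = 900 ℕ.* (2n ℕ.* (2n ℕ.* (D ℕ.* (n ℕ.* N))))

    table-run : ∀ σ → Env σ → Run table σ (λ τ → ∀ i j S → i ℕ.≤ j → j ℕ.≤ n → S < D → Settled τ i j S) tableTime
    table-run σ env = weaken fits
      (λ _ settled i j S i≤j j≤n S<D → settled i j S i≤j j≤n S<D (s≤s j≤n))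
      (forRun {P = body} {X = jBank} {L = jLimit} {e = lit 1 ⊕ nᵉ} Inv (suc n) (cong suc (proj₁ env)) refl refl refl refl id id
        (λ _ _ _ _ _ _ ()) step)
      where
      1≤Y : 1 ℕ.≤ D ℕ.* (n ℕ.* N)
      1≤Y = ℕ.*-mono-≤ 1≤D 1≤nN
      columnTime : ℕ → ℕ
      columnTime j = 5 ℕ.+ (suc j ℕ.* (14 ℕ.+ (7 ℕ.+ (cellsTime ℕ.+ 14))) ℕ.+ 17)
      columnBound : ℕ
      columnBound = 800 ℕ.* (2n ℕ.* (D ℕ.* (n ℕ.* N)))
      columnTime≤ : ∀ j → j ℕ.≤ n → columnTime j ℕ.≤ columnBound
      columnTime≤ j j≤n = bound-sum 5 750 800 (ℕ.*-mono-≤ 1≤2n 1≤Y)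
        (loop-bound 4 700 750 (ℕ.≤-trans (s≤s j≤n) 1+n≤2n) 1≤2n 1≤Y
          (ℕ.≤-trans (ℕ.≤-reflexive (cong (7 ℕ.+_) (ℕ.+-comm cellsTime 14)))
            (bound-sum 21 650 700 1≤Y (loop-bound 2 600 650 ℕ.≤-refl 1≤D 1≤nN ℕ.≤-refl))))
      fits : suc n ℕ.* (14 ℕ.+ columnBound) ℕ.+ 17 ℕ.≤ tableTime
      fits = loop-bound 4 800 900 1+n≤2n 1≤2n (ℕ.*-mono-≤ 1≤2n 1≤Y) ℕ.≤-refl
      body : Program
      body = weightBank ≔# load# q-bank (val jBank) ︔ for dBank dLimit (lit 1 ⊕ val jBank) interval
      Inv : ℕ → State → Set (c ⊔ˡ ℓ₂)
      Inv j σ = ∀ i′ j′ S′ → i′ ℕ.≤ j′ → j′ ℕ.≤ n → S′ < D → j′ < j → Settled σ i′ j′ S′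
      step : ∀ j {ρ} → j < suc n → nat ρ jBank 0 ≡ j → Frame (for jBank jLimit (lit 1 ⊕ nᵉ) body) σ ρ →
             Inv j ρ → Run body ρ (Inv (suc j)) columnBound
      step j {ρ} (s≤s j≤n) ej fr inv = weaken (columnTime≤ j j≤n) (λ _ x → x)
        (seq (assign# (weaken ℕ.≤-refl (λ {τ} _ → finish τ)
          (forRun {P = interval} {X = dBank} {L = dLimit} {e = lit 1 ⊕ val jBank} (ColumnInv j) (suc j)
            (cong suc ej) refl refl refl refl id id start
            (λ d d<1+j ed fr′ colinv → interval-run _ j d
              (Env-frame (for dBank dLimit (lit 1 ⊕ val jBank) interval) refl fr′ envρ)
              (trans (natF fr′ jBank refl 0) ej) ed (ℕ.s≤s⁻¹ d<1+j) j≤n colinv)))))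
        where
        envρ : Env ρ
        envρ = Env-frame (for jBank jLimit (lit 1 ⊕ nᵉ) body) refl fr env
        start : ColumnInv j 0 ⟪ nat ρ , num ρ [ weightBank , 0 ↦ num ρ q-bank (nat ρ jBank 0) ] ⟫
        start = (λ { i′ j′ S′ i′≤j′ j′≤n S′<D (inj₁ lt) → inv i′ j′ S′ i′≤j′ j′≤n S′<D lt
                   ; i′ j′ S′ i′≤j′ j′≤n S′<D (inj₂ (refl , lt)) →
                       contradiction (subst (j <_) (ℕ.+-identityʳ i′) lt) (ℕ.≤⇒≯ i′≤j′) })
              , (λ _ → trans (proj₂ (proj₂ (proj₂ (proj₂ (proj₂ (proj₂ (proj₂ (proj₂ (proj₂ envρ)))))))) (nat ρ jBank 0)) (cong q ej))
        finish : ∀ τ → ColumnInv j (suc j) τ → Inv (suc j) τ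
        finish τ (settled , _) i′ j′ S′ i′≤j′ j′≤n S′<D (s≤s j′≤j) with ℕ.m≤n⇒m<n∨m≡n j′≤j
        ... | inj₁ lt = settled i′ j′ S′ i′≤j′ j′≤n S′<D (inj₁ lt)
        ... | inj₂ e  = settled i′ j′ S′ i′≤j′ j′≤n S′<D (inj₂ (e , ℕ.m≤n+m (suc j) i′))

-- Order and arithmetic in the number system

module Ordered where

  open import Algebra.Properties.Ring using (-‿distribˡ-*; -‿involutive)
  open import Data.Nat.Base as ℕ using (ℕ; zero; suc)
  import Relation.Binary.Reasoning.Setoid as ≈-Reasoning

  module OrderedRing {c ℓ₁ ℓ₂ : Level} (K : OrderedCommutativeRing c ℓ₁ ℓ₂) where
    open OrderedCommutativeRing K

    +-monoˡ-≤ : ∀ x {y z} → y ≤ z → y + x ≤ z + x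
    +-monoˡ-≤ x y≤z = ≤-trans (≤-reflexive (+-comm _ x)) (≤-trans (+-monoʳ-≤ x y≤z) (≤-reflexive (+-comm x _)))

    +-mono-≤ : ∀ {x y u v} → x ≤ y → u ≤ v → x + u ≤ y + v
    +-mono-≤ {x} {y} {u} x≤y u≤v = ≤-trans (+-monoˡ-≤ u x≤y) (+-monoʳ-≤ y u≤v)

    +-nonNeg : ∀ {x y} → 0# ≤ x → 0# ≤ y → 0# ≤ x + y
    +-nonNeg 0≤x 0≤y = ≤-trans (≤-reflexive (sym (+-identityˡ 0#))) (+-mono-≤ 0≤x 0≤y)

    *-monoˡ-≤-nonNeg : ∀ {x y z} → 0# ≤ x → y ≤ z → x * y ≤ x * z
    *-monoˡ-≤-nonNeg {x} {y} {z} 0≤x y≤z =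
      ≤-trans (≤-reflexive (sym (+-identityʳ (x * y))))
        (≤-trans (+-monoʳ-≤ (x * y) (*-nonNeg 0≤x 0≤z-y)) (≤-reflexive (begin
          x * y + x * (z - y) ≈⟨ distribˡ x y (z - y) ⟨
          x * (y + (z - y))   ≈⟨ *-congˡ (+-congˡ (+-comm z (- y))) ⟩
          x * (y + (- y + z)) ≈⟨ *-congˡ (+-assoc y (- y) z) ⟨
          x * (y - y + z)     ≈⟨ *-congˡ (+-congʳ (-‿inverseʳ y)) ⟩
          x * (0# + z)        ≈⟨ *-congˡ (+-identityˡ z) ⟩
          x * z               ∎)))
      where
      open ≈-Reasoning setoid
      0≤z-y : 0# ≤ z - y
      0≤z-y = ≤-trans (≤-reflexive (sym (-‿inverseʳ y))) (+-monoˡ-≤ (- y) y≤z)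

    -- By totality 1 or -1 is nonnegative, and in the second case 1 is the square of a nonnegative
    -- element.
    0≤1 : 0# ≤ 1#
    0≤1 with total 0# 1#
    ... | inj₁ 0≤1 = 0≤1
    ... | inj₂ 1≤0 = ≤-trans (*-nonNeg 0≤-1 0≤-1) (≤-reflexive (begin
      - 1# * - 1#   ≈⟨ -‿distribˡ-* ring 1# (- 1#) ⟨
      - (1# * - 1#) ≈⟨ -‿cong (*-identityˡ (- 1#)) ⟩
      - - 1#        ≈⟨ -‿involutive ring 1# ⟩
      1#            ∎))
      where
      open ≈-Reasoning setoid
      0≤-1 : 0# ≤ - 1#
      0≤-1 = ≤-trans (≤-reflexive (sym (-‿inverseʳ 1#)))
               (≤-trans (+-monoˡ-≤ (- 1#) 1≤0) (≤-reflexive (+-identityˡ (- 1#))))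

    fromℕ#-nonNeg : ∀ n → 0# ≤ fromℕ# n
    fromℕ#-nonNeg zero    = ≤-refl
    fromℕ#-nonNeg (suc n) = +-nonNeg 0≤1 (fromℕ#-nonNeg n)

    fromℕ#-mono : ∀ {m n} → m ℕ.≤ n → fromℕ# m ≤ fromℕ# n
    fromℕ#-mono {n = n} ℕ.z≤n = fromℕ#-nonNeg n
    fromℕ#-mono (ℕ.s≤s m≤n)   = +-monoʳ-≤ 1# (fromℕ#-mono m≤n)

-- Level sizes and the level of an address

module Levels where

  open import Data.Nat.Base
  open import Data.Nat.Properties
  open import Relation.Binary.PropositionalEquality

  last≤sum : ∀ h (m : Fin (suc h) → ℕ) → m (fromℕ h) ≤ sumℕ m
  last≤sum zero    m = m≤m+n (m zero) 0
  last≤sum (suc h) m = ≤-trans (last≤sum h (m ∘ suc)) (m≤n+m _ (m zero))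

  levelOf-slow : ∀ h (m : Fin (suc h) → ℕ) (a : Fin (sumℕ m)) →
                 sumℕ m ∸ m (fromℕ h) ≤ toℕ a → levelOf m a ≡ fromℕ h
  levelOf-slow zero m a _ with levelOf m a
  ... | zero = refl
  levelOf-slow (suc h) m a slow with splitAt (m zero) a in eq
  ... | inj₁ x = contradiction
    (≤-trans (m≤m+n (m zero) _) (≤-trans (≤-reflexive (sym (+-∸-assoc (m zero) (last≤sum h (m ∘ suc)))))
      (≤-trans slow (≤-reflexive (trans (sym (cong toℕ (splitAt⁻¹-↑ˡ eq))) (toℕ-↑ˡ x _))))))
    (<⇒≱ (toℕ<n x))
  ... | inj₂ y = cong suc (levelOf-slow h (m ∘ suc) y (+-cancelˡ-≤ (m zero) _ _
    (≤-trans (≤-reflexive (sym (+-∸-assoc (m zero) (last≤sum h (m ∘ suc)))))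
      (≤-trans slow (≤-reflexive (trans (sym (cong toℕ (splitAt⁻¹-↑ʳ eq))) (toℕ-↑ʳ (m zero) y)))))))

  -- The number of addresses in the first `l` levels. With `l` a natural number, `l` = `h` is
  -- allowed, as the invariant of the loop over the levels requires after the last round.
  prefix : ∀ {h} → (Fin h → ℕ) → ℕ → ℕ
  prefix {zero}  m l       = 0
  prefix {suc h} m zero    = 0
  prefix {suc h} m (suc l) = m zero + prefix (m ∘ suc) l

  prefix-suc : ∀ {h} (m : Fin h → ℕ) l → prefix m (suc (toℕ l)) ≡ prefix m (toℕ l) + m l
  prefix-suc {suc h} m zero    = trans (cong (m zero +_) (prefix-zero (m ∘ suc))) (+-identityʳ _)
    where
    prefix-zero : ∀ {h} (m : Fin h → ℕ) → prefix m 0 ≡ 0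
    prefix-zero {zero}  m = refl
    prefix-zero {suc h} m = refl
  prefix-suc {suc h} m (suc l) = trans (cong (m zero +_) (prefix-suc (m ∘ suc) l)) (sym (+-assoc (m zero) _ _))

  prefix-all : ∀ {h} (m : Fin h → ℕ) → prefix m h ≡ sumℕ m
  prefix-all {zero}  m = refl
  prefix-all {suc h} m = cong (m zero +_) (prefix-all (m ∘ suc))

  levelOf-prefix : ∀ {h} (m : Fin h → ℕ) a l {x} → x < m l → toℕ a ≡ prefix m (toℕ l) + x → levelOf m a ≡ l
  levelOf-prefix {suc h} m a l x<m a≡ with splitAt (m zero) a in eq
  levelOf-prefix {suc h} m a zero    x<m a≡ | inj₁ y = refl
  levelOf-prefix {suc h} m a (suc l) x<m a≡ | inj₁ y = contradiction
    (subst (_< m zero) (trans (trans (sym (toℕ-↑ˡ y _)) (cong toℕ (splitAt⁻¹-↑ˡ eq))) a≡) (toℕ<n y))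
    (≤⇒≯ (≤-trans (m≤m+n (m zero) _) (m≤m+n _ _)))
  levelOf-prefix {suc h} m a zero    x<m a≡ | inj₂ y = contradiction
    (subst (_< m zero) (trans (sym a≡) (trans (sym (cong toℕ (splitAt⁻¹-↑ʳ eq))) (toℕ-↑ʳ (m zero) y))) x<m)
    (≤⇒≯ (m≤m+n (m zero) _))
  levelOf-prefix {suc h} m a (suc l) x<m a≡ | inj₂ y = cong suc (levelOf-prefix (m ∘ suc) y l x<m
    (+-cancelˡ-≡ (m zero) _ _
      (trans (trans (sym (toℕ-↑ʳ (m zero) y)) (cong toℕ (splitAt⁻¹-↑ʳ eq))) (trans a≡ (+-assoc (m zero) _ _)))))

  m≤sum : ∀ {h} (m : Fin h → ℕ) l → m l ≤ sumℕ m
  m≤sum m zero    = m≤m+n (m zero) _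
  m≤sum m (suc l) = ≤-trans (m≤sum (m ∘ suc) l) (m≤n+m _ (m zero))

  levels≤sum : ∀ {h} (m : Fin h → ℕ) → (∀ l → 1 ≤ m l) → h ≤ sumℕ m
  levels≤sum {zero}  m m≥1 = z≤n
  levels≤sum {suc h} m m≥1 = +-mono-≤ (m≥1 zero) (levels≤sum (m ∘ suc) (m≥1 ∘ suc))

  levels≤fast : ∀ h (m : Fin (suc h) → ℕ) → (∀ l → 1 ≤ m l) → h ≤ sumℕ m ∸ m (fromℕ h)
  levels≤fast zero    m m≥1 = z≤n
  levels≤fast (suc h) m m≥1 = ≤-trans (+-mono-≤ (m≥1 zero) (levels≤fast h (m ∘ suc) (m≥1 ∘ suc)))
    (≤-reflexive (sym (+-∸-assoc (m zero) (last≤sum h (m ∘ suc)))))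

-- The table value is a lower bound for all costs, and a stored tree attains it

module Optimality where

  open Codes
  open Levels
  open Ordered
  open Search using (module Bellman)
  open import Data.Nat.Base as ℕ using (ℕ; zero; suc; _∸_; _<_; z≤n; s≤s; z<s; _^_)
  import Data.Nat.Properties as ℕ
  open import Relation.Binary.PropositionalEquality as ≡ using (_≡_; _≢_; refl; cong; cong₂; subst)
  import Relation.Binary.Reasoning.Setoid as ≈-Reasoning

  tree-≤ : ∀ {n} {i j : Fin (suc n)} → Tree i j → toℕ i ℕ.≤ toℕ j
  tree-≤ (leaf j)     = ℕ.≤-refl
  tree-≤ (node k L R) = ℕ.≤-trans (≡.subst (_ ℕ.≤_) (toℕ-inject₁ k) (tree-≤ L))
                                  (ℕ.≤-trans (ℕ.n≤1+n (toℕ k)) (tree-≤ R))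

  module Following (n D N : ℕ) (s sˡ sʳ root : ℕ → ℕ) (κ θ : ℕ → ℕ → ℕ → ℕ) where

    -- κ i j S is one more than the key at the root of the tree chosen for the
    -- cell, and 0 for i ≡ j; θ i j S is the rule used there.
    Follows : ∀ {i j} → Tree {n} i j → ℕ → Set
    Follows (leaf j) S = S < D
    Follows (node {i} {j} k L R) S =
      let t = θ (toℕ i) (toℕ j) S in
      (κ (toℕ i) (toℕ j) S ≡ suc (toℕ k)) × (t < N) × (s t ≡ S) × Follows L (sˡ t) × Follows R (sʳ t)

    -- ψ holds the addresses of the keys, 0 standing for a slow one.
    Recorded : (ℕ → ℕ) → ∀ {i j} → Tree {n} i j → ℕ → Set
    Recorded ψ (leaf j) S = ⊤
    Recorded ψ (node {i} {j} k L R) S =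
      let t = θ (toℕ i) (toℕ j) S in
      (ψ (suc (toℕ k)) ≡ root t) × Recorded ψ L (sˡ t) × Recorded ψ R (sʳ t)

    Within : ℕ → ∀ {i j} → Tree {n} i j → Set
    Within k {i} {j} T = (toℕ i ℕ.≤ k) × (k < toℕ j)

    data Position (k : ℕ) {i j} k′ (L : Tree {n} i (inject₁ k′)) (R : Tree (suc k′) j) : Set where
      atRoot  : k ≡ toℕ k′ → Position k k′ L R
      inLeft  : Within k L → Position k k′ L R
      inRight : Within k R → Position k k′ L R

    position : ∀ {k i j} k′ (L : Tree {n} i (inject₁ k′)) (R : Tree (suc k′) j) →
               Within k (node k′ L R) → Position k k′ L R
    position {k} k′ L R (i≤k , k<j) with ℕ.<-cmp k (toℕ k′)
    ... | tri< k<k′ _ _ = inLeft (i≤k , subst (k <_) (≡.sym (toℕ-inject₁ k′)) k<k′)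
    ... | tri≈ _ eq _   = atRoot eq
    ... | tri> _ _ k>k′ = inRight (k>k′ , k<j)

  -- What becomes of an address a with availability g at a node whose own
  -- address is a or not, some key to the left of it having address a or not.
  digit : ∀ {A B : Set} → ℕ → Dec A → Dec B → ℕ
  digit zero    _       _       = 0
  digit (suc _) (yes _) _       = 3
  digit (suc _) (no _)  (yes _) = 1
  digit (suc _) (no _)  (no _)  = 2

  module _ {A B : Set} where

    digit<4 : ∀ g (a? : Dec A) (b? : Dec B) → digit g a? b? < 4
    digit<4 zero    _       _       = z<s
    digit<4 (suc _) (yes _) _       = ℕ.≤-refl
    digit<4 (suc _) (no _)  (yes _) = s≤s (s≤s z≤n)
    digit<4 (suc _) (no _)  (no _)  = s≤s (s≤s (s≤s z≤n))

    available-digit : ∀ {g} (a? : Dec A) (b? : Dec B) → g < 2 → available (digit g a? b?) ≡ g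
    available-digit {0} _       _       _ = refl
    available-digit {1} (yes _) _       _ = refl
    available-digit {1} (no _)  (yes _) _ = refl
    available-digit {1} (no _)  (no _)  _ = refl
    available-digit {suc (suc _)} _ _ (s≤s (s≤s ()))

    digit-root : ∀ {g} (a? : Dec A) (b? : Dec B) → g ≡ 1 → A → digit g a? b? ≡ 3
    digit-root (yes _) _ refl _ = refl
    digit-root (no ¬a) _ refl a = contradiction a ¬a

    digit-nonroot : ∀ g (a? : Dec A) (b? : Dec B) → ¬ A → digit g a? b? < 3
    digit-nonroot zero    _       _       _  = z<s
    digit-nonroot (suc _) (yes a) _       ¬a = contradiction a ¬a
    digit-nonroot (suc _) (no _)  (yes _) _  = s≤s (s≤s z≤n)
    digit-nonroot (suc _) (no _)  (no _)  _  = s≤s (s≤s (s≤s z≤n))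

    digit-left : ∀ {g} (a? : Dec A) (b? : Dec B) → g ≡ 1 → ¬ A → B → digit g a? b? ≡ 1
    digit-left (yes a) _       refl ¬a _ = contradiction a ¬a
    digit-left (no _)  (yes _) refl _  _ = refl
    digit-left (no _)  (no ¬b) refl _  b = contradiction b ¬b

    digit-right : ∀ {g} (a? : Dec A) (b? : Dec B) → g ≡ 1 → ¬ A → ¬ B → digit g a? b? ≡ 2
    digit-right (yes a) _       refl ¬a _  = contradiction a ¬a
    digit-right (no _)  (yes b) refl _  ¬b = contradiction b ¬b
    digit-right (no _)  (no _)  refl _  _  = refl

  module Optimal {c ℓ₁ ℓ₂ : Level} (K : OrderedCommutativeRing c ℓ₁ ℓ₂) (I : Model.Instance K)
    (M : ℕ) (M≡ : M ≡ Model.Instance.n I ∸ Model.Instance.m-last I)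
    (price s sˡ sʳ root : ℕ → ℕ)
    (p′ q′ : ℕ → OrderedCommutativeRing.Carrier K)
    (p≈ : ∀ k → OrderedCommutativeRing._≈_ K (p′ (suc (toℕ k))) (Model.Instance.p I k))
    (q≈ : ∀ j → OrderedCommutativeRing._≈_ K (q′ (toℕ j)) (Model.Instance.q I j))
    (price-slow : price 0 ≡ Model.Instance.cₗ I (fromℕ (suc (Model.Instance.h-2 I))))
    (price-address : ∀ a → price (suc (toℕ a)) ≡ Model.Instance.μ I a)
    (s-enc    : ∀ f → (∀ a → f a < 4) → s (enc 4 M f) ≡ enc 2 M (available ∘ f))
    (sˡ-enc   : ∀ f → (∀ a → f a < 4) → sˡ (enc 4 M f) ≡ enc 2 M (toLeft ∘ f))
    (sʳ-enc   : ∀ f → (∀ a → f a < 4) → sʳ (enc 4 M f) ≡ enc 2 M (toRight ∘ f))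
    (root-enc : ∀ f → (∀ a → f a < 4) → root (enc 4 M f) ≡ firstRoot M f)
    where
    open Model K
    open Instance I
    open OrderedCommutativeRing K renaming (refl to ≈-refl; sym to ≈-sym; trans to ≈-trans)
    open OrderedRing K
    open Bellman K n (2 ^ M) (4 ^ M) price s sˡ sʳ root p′ q′
    open import Algebra.Properties.CommutativeSemigroup +-commutativeSemigroup using (interchange)
    open ≈-Reasoning setoid

    N D : ℕ
    N = 4 ^ M
    D = 2 ^ M

    weight-split : ∀ i a b → weight i (a ℕ.+ suc b) ≈ weight i a + p′ (suc (i ℕ.+ a)) + weight (suc (i ℕ.+ a)) b
    weight-split i zero    b rewrite ℕ.+-identityʳ i = ≈-refl
    weight-split i (suc a) b rewrite ℕ.+-suc i a = begin
      q′ i + p′ (suc i) + weight (suc i) (a ℕ.+ suc b)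
        ≈⟨ +-congˡ (weight-split (suc i) a b) ⟩
      q′ i + p′ (suc i) + (weight (suc i) a + p′ (suc (suc (i ℕ.+ a))) + weight (suc (suc (i ℕ.+ a))) b)
        ≈⟨ +-assoc _ _ _ ⟨
      q′ i + p′ (suc i) + (weight (suc i) a + p′ (suc (suc (i ℕ.+ a)))) + weight (suc (suc (i ℕ.+ a))) b
        ≈⟨ +-congʳ (+-assoc _ _ _) ⟨
      q′ i + p′ (suc i) + weight (suc i) a + p′ (suc (suc (i ℕ.+ a))) + weight (suc (suc (i ℕ.+ a))) b ∎

    w≈weight : ∀ {i j} (T : Tree i j) → w T ≈ weight (toℕ i) (toℕ j ∸ toℕ i)
    w≈weight (leaf j) rewrite ℕ.n∸n≡0 (toℕ j) = ≈-sym (q≈ j)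
    w≈weight (node {i} {j} k L R) = begin
      w L + p k + w R
        ≈⟨ +-cong (+-cong (w≈weight L) (≈-sym (p≈ k))) (w≈weight R) ⟩
      weight (toℕ i) (toℕ (inject₁ k) ∸ toℕ i) + p′ (suc (toℕ k)) + weight (suc (toℕ k)) (toℕ j ∸ suc (toℕ k))
        ≡⟨ cong₂ (λ x y → weight (toℕ i) (x ∸ toℕ i) + p′ (suc y) + weight (suc y) (toℕ j ∸ suc (toℕ k)))
             (toℕ-inject₁ k) (≡.sym (ℕ.m+[n∸m]≡n i≤k)) ⟩
      weight (toℕ i) a + p′ (suc (toℕ i ℕ.+ a)) + weight (suc (toℕ i ℕ.+ a)) b
        ≈⟨ weight-split (toℕ i) a b ⟨
      weight (toℕ i) (a ℕ.+ suc b)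
        ≡⟨ cong (weight (toℕ i)) a+1+b ⟩
      weight (toℕ i) (toℕ j ∸ toℕ i) ∎
      where
      i≤k : toℕ i ℕ.≤ toℕ k
      i≤k = subst (toℕ i ℕ.≤_) (toℕ-inject₁ k) (tree-≤ L)
      a b : ℕ
      a = toℕ k ∸ toℕ i
      b = toℕ j ∸ suc (toℕ k)
      a+1+b : a ℕ.+ suc b ≡ toℕ j ∸ toℕ i
      a+1+b = ≡.trans (ℕ.+-comm a (suc b)) (≡.trans (≡.sym (ℕ.+-∸-assoc (suc b) i≤k))
        (cong (_∸ toℕ i) (≡.trans (≡.sym (ℕ.+-suc b (toℕ k))) (ℕ.m∸n+n≡m (tree-≤ R)))))

    0≤p′ : ∀ k → k < n → 0# ≤ p′ (suc k)
    0≤p′ k k<n = ≤-trans (p-nonNeg (fromℕ< k<n))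
      (≤-reflexive (≈-trans (≈-sym (p≈ (fromℕ< k<n))) (reflexive (cong (p′ ∘ suc) (toℕ-fromℕ< k<n)))))

    0≤q′ : ∀ j → j ℕ.≤ n → 0# ≤ q′ j
    0≤q′ j j≤n = ≤-trans (q-nonNeg (fromℕ< (s≤s j≤n)))
      (≤-reflexive (≈-trans (≈-sym (q≈ (fromℕ< (s≤s j≤n)))) (reflexive (cong q′ (toℕ-fromℕ< (s≤s j≤n))))))

    0≤weight : ∀ i d → i ℕ.+ d ℕ.≤ n → 0# ≤ weight i d
    0≤weight i zero    i≤n = 0≤q′ i (subst (ℕ._≤ n) (ℕ.+-identityʳ i) i≤n)
    0≤weight i (suc d) le  = +-nonNeg
      (+-nonNeg (0≤q′ i (ℕ.≤-trans (ℕ.m≤m+n i (suc d)) le))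
                (0≤p′ i (ℕ.≤-trans (s≤s (ℕ.m≤m+n i d)) le′)))
      (0≤weight (suc i) d le′)
      where
      le′ : suc (i ℕ.+ d) ℕ.≤ n
      le′ = subst (ℕ._≤ n) (ℕ.+-suc i d) le

    0≤load-at : ∀ i j k → i ℕ.≤ j → j ℕ.≤ n → 0# ≤ load-at i j k
    0≤load-at i j k i≤j j≤n = +-nonNeg (+-nonNeg
      (0≤weight i (j ∸ i) (subst (ℕ._≤ n) (≡.sym (ℕ.m+[n∸m]≡n i≤j)) j≤n))
      (*-nonNeg (fromℕ#-nonNeg (1 ∸ (k ∸ i))) (0≤q′ i (ℕ.≤-trans i≤j j≤n))))
      (*-nonNeg (fromℕ#-nonNeg (1 ∸ (j ∸ suc k))) (0≤q′ j j≤n))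

    module _ (φ : Fin n → Fin n) where

      charge : Fin n → Carrier
      charge k = fromℕ# (μ (φ k))

      totalCost : ∀ {i j} → Tree i j → Carrier
      totalCost T = internalCost I φ T + externalCost I φ T

      -- Replaces the case distinction on the child by an indicator factor, 1 for an external and 0
      -- for an internal node. At an external node both ends of the interval coincide, so `x` may be
      -- read at the left end for a left child and at the right end for a right child.
      childCost≈ : ∀ {i j} (T : Tree i j) k x → (toℕ i ≡ toℕ j → x ≈ q′ (toℕ i)) →
        childCost I φ k T ≈ fromℕ# (1 ∸ (toℕ j ∸ toℕ i)) * x * charge k + externalCost I φ T
      childCost≈ (leaf j) k x x≈ rewrite ℕ.n∸n≡0 (toℕ j) = begin
        q j * charge k                        ≈⟨ *-congʳ (≈-trans (x≈ refl) (q≈ j)) ⟨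
        x * charge k                          ≈⟨ *-congʳ (*-identityˡ x) ⟨
        1# * x * charge k                     ≈⟨ *-congʳ (*-congʳ (+-identityʳ 1#)) ⟨
        (1# + 0#) * x * charge k              ≈⟨ +-identityʳ _ ⟨
        (1# + 0#) * x * charge k + 0#         ∎
      childCost≈ T@(node {i} {j} k′ L R) k x x≈ = begin
        externalCost I φ T                    ≈⟨ +-identityˡ _ ⟨
        0# + externalCost I φ T               ≈⟨ +-congʳ (zeroˡ (charge k)) ⟨
        0# * charge k + externalCost I φ T    ≈⟨ +-congʳ (*-congʳ (zeroˡ x)) ⟨
        0# * x * charge k + externalCost I φ T
          ≡⟨ cong (λ y → fromℕ# y * x * charge k + externalCost I φ T) (≡.sym (ℕ.m≤n⇒m∸n≡0 1≤j∸i)) ⟩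
        fromℕ# (1 ∸ (toℕ j ∸ toℕ i)) * x * charge k + externalCost I φ T ∎
        where
        1≤j∸i : 1 ℕ.≤ toℕ j ∸ toℕ i
        1≤j∸i = ℕ.m<n⇒0<n∸m (ℕ.≤-trans (s≤s (subst (toℕ i ℕ.≤_) (toℕ-inject₁ k′) (tree-≤ L))) (tree-≤ R))

      -- External children are charged at the address of the root, so their terms join its weight in
      -- `load-at`. What remains is the cost of two independent trees, and this independence is what
      -- makes dynamic programming possible.
      totalCost-node : ∀ {i j} k (L : Tree i (inject₁ k)) (R : Tree (suc k) j) →
        totalCost (node k L R) ≈
        load-at (toℕ i) (toℕ j) (toℕ k) * charge k + (totalCost L + totalCost R)
      totalCost-node {i} {j} k L R = begin
        w (node k L R) * γ + (iL + iR) + (childCost I φ k L + childCost I φ k R)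
          ≈⟨ +-cong (+-congʳ (*-congʳ (w≈weight (node k L R))))
               (+-cong (childCost≈ L k (q′ (toℕ i)) (λ _ → ≈-refl))
                       (childCost≈ R k (q′ (toℕ j)) (λ e → reflexive (cong q′ (≡.sym e))))) ⟩
        W * γ + (iL + iR) + (fromℕ# (1 ∸ (toℕ (inject₁ k) ∸ toℕ i)) * q′ (toℕ i) * γ + eL + (β * γ + eR))
          ≡⟨ cong (λ x → W * γ + (iL + iR) + (fromℕ# (1 ∸ (x ∸ toℕ i)) * q′ (toℕ i) * γ + eL + (β * γ + eR))) (toℕ-inject₁ k) ⟩
        W * γ + (iL + iR) + (α * γ + eL + (β * γ + eR))
          ≈⟨ +-congˡ (interchange _ _ _ _) ⟩
        W * γ + (iL + iR) + (α * γ + β * γ + (eL + eR))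
          ≈⟨ interchange _ _ _ _ ⟩
        W * γ + (α * γ + β * γ) + (iL + iR + (eL + eR))
          ≈⟨ +-cong factor (interchange _ _ _ _) ⟩
        load-at (toℕ i) (toℕ j) (toℕ k) * γ + (totalCost L + totalCost R) ∎
        where
        γ W α β iL iR eL eR : Carrier
        γ  = charge k
        W  = weight (toℕ i) (toℕ j ∸ toℕ i)
        α  = fromℕ# (1 ∸ (toℕ k ∸ toℕ i)) * q′ (toℕ i)
        β  = fromℕ# (1 ∸ (toℕ j ∸ suc (toℕ k))) * q′ (toℕ j)
        iL = internalCost I φ L
        iR = internalCost I φ R
        eL = externalCost I φ L
        eR = externalCost I φ R
        factor : W * γ + (α * γ + β * γ) ≈ (W + α + β) * γ
        factor = begin
          W * γ + (α * γ + β * γ)   ≈⟨ +-assoc _ _ _ ⟨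
          W * γ + α * γ + β * γ     ≈⟨ +-congʳ (distribʳ γ W α) ⟨
          (W + α) * γ + β * γ       ≈⟨ distribʳ γ (W + α) β ⟨
          (W + α + β) * γ           ∎

    split-of : ∀ t → t < N → Σ[ f ∈ (ℕ → ℕ) ] (∀ a → f a < 4) × (enc 4 M f ≡ t)
    split-of = decode 4 M

    s<D : ∀ t → t < N → s t < D
    s<D t t<N with split-of t t<N
    ... | f , f<4 , refl = subst (_< D) (≡.sym (s-enc f f<4)) (enc< 2 M (λ a _ → available<2 (f a)))

    sˡ<D : ∀ t → t < N → sˡ t < D
    sˡ<D t t<N with split-of t t<N
    ... | f , f<4 , refl = subst (_< D) (≡.sym (sˡ-enc f f<4)) (enc< 2 M (λ a _ → toLeft<2 (f a)))

    sʳ<D : ∀ t → t < N → sʳ t < D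
    sʳ<D t t<N with split-of t t<N
    ... | f , f<4 , refl = subst (_< D) (≡.sym (sʳ-enc f f<4)) (enc< 2 M (λ a _ → toRight<2 (f a)))

    -- The binary digits of `S`, read in base 4, send every address of `S` to the left. Hence each
    -- set has a rule, and no cell of a nonempty interval stays unset.
    rule-for : ∀ S → S < D → ∃[ t ] (t < N) × (s t ≡ S)
    rule-for S S<D with decode 2 M S S<D
    ... | g , g<2 , refl = enc 4 M g , enc< 4 M (λ a _ → g<4 a) ,
          ≡.trans (s-enc g g<4) (enc-cong 2 M (λ a _ → available-bit (g<2 a)))
      where
      g<4 : ∀ a → g a < 4
      g<4 a = ℕ.≤-trans (g<2 a) (s≤s (s≤s z≤n))
      available-bit : ∀ {d} → d < 2 → available d ≡ d
      available-bit {0} _ = refl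
      available-bit {1} _ = refl
      available-bit {suc (suc _)} (s≤s (s≤s ()))

    module _ (V : ℕ → ℕ → ℕ → Carrier) (κ θ : ℕ → ℕ → ℕ → ℕ)
             (settled : ∀ i j S → i ℕ.≤ j → j ℕ.≤ n → S < D →
                Best V i j S (λ k _ → (i ℕ.≤ k) × (k < j)) (V i j S) (κ i j S) (θ i j S)) where

      κ-empty : ∀ j S → j ℕ.≤ n → S < D → κ j j S ≡ 0
      κ-empty j S j≤n S<D with κ j j S in eq
      ... | zero  = refl
      ... | suc k =
        let j≤k , k<j , _ = Best.set (settled j j S ℕ.≤-refl j≤n S<D) k eq
        in contradiction k<j (ℕ.≤⇒≯ j≤k)

      V-empty : ∀ j S → j ℕ.≤ n → S < D → V j j S ≡ 0#
      V-empty j S j≤n S<D = Best.unset (settled j j S ℕ.≤-refl j≤n S<D) (κ-empty j S j≤n S<D)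

      module _ (φ : Fin n → Fin n) (φ-injective : Injective _≡_ _≡_ φ) where

        Covers : (ℕ → ℕ) → ℕ → ℕ → Set
        Covers g i j = ∀ k → i ℕ.≤ toℕ k → toℕ k < j → toℕ (φ k) < M → g (toℕ (φ k)) ≡ 1

        module _ (k : Fin n) (g : ℕ → ℕ) (g<2 : ∀ a → g a < 2) where

          above? : ∀ a → Dec (∃[ k′ ] (toℕ k′ < toℕ k) × (toℕ (φ k′) ≡ a))
          above? a = any? (λ k′ → (toℕ k′ ℕ.<? toℕ k) ×-dec (toℕ (φ k′) ℕ.≟ a))

          -- The rule that an arbitrary `φ` induces at the root `k`. Available addresses claimed
          -- neither by the root nor by a key before it go right, used there or not, and keys before
          -- `k` count even outside the interval: only the inclusion `Covers` has to be passed on.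
          splitting : ℕ → ℕ
          splitting a = digit (g a) (a ℕ.≟ toℕ (φ k)) (above? a)

          splitting<4 : ∀ a → splitting a < 4
          splitting<4 a = digit<4 (g a) (a ℕ.≟ toℕ (φ k)) (above? a)

          other : ∀ {k′} → k′ ≢ k → toℕ (φ k′) ≢ toℕ (φ k)
          other k′≢k eq = k′≢k (φ-injective (toℕ-injective eq))

          covers-left : ∀ {i j} → toℕ k < j → Covers g i j → Covers (toLeft ∘ splitting) i (toℕ k)
          covers-left k<j cov k′ i≤k′ k′<k fast = cong toLeft
            (digit-left (toℕ (φ k′) ℕ.≟ toℕ (φ k)) (above? (toℕ (φ k′))) (cov k′ i≤k′ (ℕ.<-trans k′<k k<j) fast)
              (other (λ e → ℕ.<⇒≢ k′<k (cong toℕ e))) (k′ , k′<k , refl))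

          covers-right : ∀ {i j} → i ℕ.≤ toℕ k → Covers g i j → Covers (toRight ∘ splitting) (suc (toℕ k)) j
          covers-right i≤k cov k′ k<k′ k′<j fast = cong toRight
            (digit-right (toℕ (φ k′) ℕ.≟ toℕ (φ k)) (above? (toℕ (φ k′))) (cov k′ (ℕ.≤-trans i≤k (ℕ.<⇒≤ k<k′)) k′<j fast)
              (other (λ e → ℕ.<⇒≢ k<k′ (≡.sym (cong toℕ e))))
              (λ { (k″ , k″<k , eq) → ℕ.<⇒≢ (ℕ.<-trans k″<k k<k′) (cong toℕ (φ-injective (toℕ-injective eq))) }))

          root-price : (toℕ (φ k) < M → g (toℕ (φ k)) ≡ 1) → price (firstRoot M splitting) ≡ μ (φ k)
          root-price cov with toℕ (φ k) ℕ.<? M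
          ... | yes fast = ≡.trans
            (cong price (firstRoot-unique M splitting (toℕ (φ k)) fast
              (digit-root (toℕ (φ k) ℕ.≟ toℕ (φ k)) (above? (toℕ (φ k))) (cov fast) refl)
              (λ a′ a′≢ → digit-nonroot (g a′) (a′ ℕ.≟ toℕ (φ k)) (above? a′) a′≢)))
            (price-address (φ k))
          ... | no slow = ≡.trans
            (cong price (firstRoot-none M splitting (λ a a<M →
              digit-nonroot (g a) (a ℕ.≟ toℕ (φ k)) (above? a) (λ { refl → slow a<M }))))
            (≡.trans price-slow (cong cₗ (≡.sym (levelOf-slow (suc h-2) m (φ k)
              (ℕ.≤-trans (ℕ.≤-reflexive (≡.sym M≡)) (ℕ.≮⇒≥ slow))))))

        -- At each node the rule induced by `φ` is among those tried and charges the root exactly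
        -- its price, so the cell is at most the corresponding candidate. The indices `i′` and `j′`
        -- are separate because `toℕ (inject₁ k)` is `toℕ k` only propositionally.
        V≤totalCost : ∀ {i j} (T : Tree i j) {i′ j′} → i′ ≡ toℕ i → j′ ≡ toℕ j →
          ∀ g → (∀ a → g a < 2) → Covers g i′ j′ → V i′ j′ (enc 2 M g) ≤ totalCost φ T
        V≤totalCost (leaf j) refl refl g g<2 cov = ≤-reflexive (≈-trans
          (reflexive (V-empty (toℕ j) (enc 2 M g) (ℕ.s≤s⁻¹ (toℕ<n j)) (enc< 2 M (λ a _ → g<2 a))))
          (≈-sym (+-identityˡ 0#)))
        V≤totalCost (node {i} {j} k L R) refl refl g g<2 cov = ≤-trans
          (proj₂ (Best.least (settled _ _ _ (ℕ.<⇒≤ (ℕ.≤-<-trans i≤k k<j)) (ℕ.s≤s⁻¹ (toℕ<n j)) (enc< 2 M (λ a _ → g<2 a)))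
            (toℕ k) t (i≤k , k<j) (enc< 4 M (λ a _ → f<4 a))
            (≡.trans (s-enc f f<4) (enc-cong 2 M (λ a _ → available-digit (a ℕ.≟ toℕ (φ k)) (above? k g g<2 a) (g<2 a))))))
          (≤-trans (+-mono-≤ (≤-reflexive (*-congˡ (reflexive (cong fromℕ# price≡))))
            (+-mono-≤
              (subst (λ x → V (toℕ i) (toℕ k) x ≤ totalCost φ L) (≡.sym (sˡ-enc f f<4))
                (V≤totalCost L refl (≡.sym (toℕ-inject₁ k)) (toLeft ∘ f) (λ a → toLeft<2 (f a)) (covers-left k g g<2 {toℕ i} k<j cov)))
              (subst (λ x → V (suc (toℕ k)) (toℕ j) x ≤ totalCost φ R) (≡.sym (sʳ-enc f f<4))
                (V≤totalCost R refl refl (toRight ∘ f) (λ a → toRight<2 (f a)) (covers-right k g g<2 {toℕ i} {toℕ j} i≤k cov)))))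
            (≤-reflexive (≈-sym (totalCost-node φ k L R))))
          where
          i≤k : toℕ i ℕ.≤ toℕ k
          i≤k = subst (toℕ i ℕ.≤_) (toℕ-inject₁ k) (tree-≤ L)
          k<j : toℕ k < toℕ j
          k<j = tree-≤ R
          f : ℕ → ℕ
          f = splitting k g g<2
          f<4 : ∀ a → f a < 4
          f<4 = splitting<4 k g g<2
          t : ℕ
          t = enc 4 M f
          price≡ : price (root t) ≡ μ (φ k)
          price≡ = ≡.trans (cong price (root-enc f f<4)) (root-price k g g<2 (cov k i≤k k<j))

      open Following n D N s sˡ sʳ root κ θ public

      Follows-< : ∀ {i j} (T : Tree i j) {S} → Follows T S → S < D
      Follows-< (leaf j)     S<D                 = S<D
      Follows-< (node k L R) (_ , t<N , s≡ , _) = subst (_< D) s≡ (s<D _ t<N)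

      -- The roots come from the table, so the recursion is not structural; `fuel` bounds the number
      -- of keys in the interval.
      extract : ∀ fuel (i j : Fin (suc n)) S → toℕ i ℕ.≤ toℕ j → toℕ j ∸ toℕ i ℕ.≤ fuel → S < D →
                Σ[ T ∈ Tree i j ] Follows T S
      extract fuel i j S i≤j fits S<D with ℕ.m≤n⇒m<n∨m≡n i≤j
      ... | inj₂ i≡j with toℕ-injective i≡j
      ...   | refl = leaf i , S<D
      extract zero       i j S i≤j fits S<D | inj₁ i<j = contradiction (ℕ.m<n⇒0<n∸m i<j) (ℕ.≤⇒≯ fits)
      extract (suc fuel) i j S i≤j fits S<D | inj₁ i<j with κ (toℕ i) (toℕ j) S in eq
      ... | zero =
        let t , t<N , s≡ = rule-for S S<D
            κ≢0 , _ = Best.least (settled _ _ S i≤j (ℕ.s≤s⁻¹ (toℕ<n j)) S<D) (toℕ i) t (ℕ.≤-refl , i<j) t<N s≡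
        in contradiction eq κ≢0
      ... | suc k′ =
        let i≤k , k<j , t<N , s≡ , _ = Best.set (settled _ _ S i≤j (ℕ.s≤s⁻¹ (toℕ<n j)) S<D) k′ eq
            k<n = ℕ.<-≤-trans k<j (ℕ.s≤s⁻¹ (toℕ<n j))
            k   = fromℕ< k<n
            k≡  = toℕ-fromℕ< k<n
            k₁≡ = ≡.trans (toℕ-inject₁ k) k≡
            L , followsL = extract fuel i (inject₁ k) _ (subst (toℕ i ℕ.≤_) (≡.sym k₁≡) i≤k)
              (subst (λ x → x ∸ toℕ i ℕ.≤ fuel) (≡.sym k₁≡)
                (ℕ.s≤s⁻¹ (ℕ.≤-trans (ℕ.∸-monoˡ-< k<j i≤k) fits)))
              (sˡ<D _ t<N)
            R , followsR = extract fuel (suc k) j _ (subst (λ x → suc x ℕ.≤ toℕ j) (≡.sym k≡) k<j)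
              (subst (λ x → toℕ j ∸ suc x ℕ.≤ fuel) (≡.sym k≡)
                (ℕ.s≤s⁻¹ (ℕ.≤-trans (ℕ.∸-monoʳ-< (s≤s i≤k) k<j) fits)))
              (sʳ<D _ t<N)
        in node k L R , ≡.trans eq (cong suc (≡.sym k≡)) , t<N , s≡ , followsL , followsR

      Priced : (Fin n → Fin n) → ∀ {i j} → Tree i j → ℕ → Set
      Priced φ (leaf j) S = ⊤
      Priced φ (node {i} {j} k L R) S =
        let t = θ (toℕ i) (toℕ j) S in
        (μ (φ k) ℕ.≤ price (root t)) × Priced φ L (sˡ t) × Priced φ R (sʳ t)

      -- In contrast to the lower bound, prices are here compared by an inequality. Multiplying it
      -- by the load of a node requires the load, and so the `p` and `q`, to be nonnegative.
      totalCost≤V : ∀ φ {i j} (T : Tree i j) {S i′ j′} → i′ ≡ toℕ i → j′ ≡ toℕ j →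
                    Follows T S → Priced φ T S → totalCost φ T ≤ V i′ j′ S
      totalCost≤V φ (leaf j) {S} refl refl S<D _ = ≤-reflexive (≈-trans (+-identityˡ 0#)
        (reflexive (≡.sym (V-empty (toℕ j) S (ℕ.s≤s⁻¹ (toℕ<n j)) S<D))))
      totalCost≤V φ T@(node {i} {j} k L R) {S} refl refl follows@(κ≡ , t<N , s≡ , fL , fR) (cheap , pL , pR) =
        ≤-trans (≤-reflexive (totalCost-node φ k L R))
          (≤-trans (+-mono-≤ (*-monoˡ-≤-nonNeg (0≤load-at (toℕ i) (toℕ j) (toℕ k) i≤j j≤n) (fromℕ#-mono cheap))
            (+-mono-≤ (totalCost≤V φ L refl (≡.sym (toℕ-inject₁ k)) fL pL) (totalCost≤V φ R refl refl fR pR)))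
          (≤-reflexive (reflexive (≡.sym v≡))))
        where
        i≤j : toℕ i ℕ.≤ toℕ j
        i≤j = tree-≤ T
        j≤n : toℕ j ℕ.≤ n
        j≤n = ℕ.s≤s⁻¹ (toℕ<n j)
        v≡ : V (toℕ i) (toℕ j) S ≡ cand V (toℕ i) (toℕ j) (toℕ k) (θ (toℕ i) (toℕ j) S)
        v≡ = proj₂ (proj₂ (proj₂ (proj₂ (Best.set (settled _ _ S i≤j j≤n (Follows-< T follows)) (toℕ k) κ≡))))

      module _ (ψ : ℕ → ℕ) where

        private
          clash : ∀ {x y z : ℕ} → x ≡ y → x ≡ z → y ≢ z → ∀ {ℓ} {A : Set ℓ} → A
          clash refl refl y≢z = contradiction refl y≢z

        -- What a subtree receives was available at the node above it, so the sets shrink downwards.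
        -- The address recorded for a key lies in every set on the path to that key.
        available-to : ∀ {i j} (T : Tree i j) {S} → Follows T S → Recorded ψ T S →
          ∀ {k a} → Within k T → ψ (suc k) ≡ suc a →
          ∀ g → (∀ b → g b < 2) → enc 2 M g ≡ S → (a < M) × (g a ≡ 1)
        available-to (leaf j) _ _ (i≤k , k<j) = contradiction k<j (ℕ.≤⇒≯ i≤k)
        available-to (node {i} {j} k′ L R) {S} (_ , t<N , s≡ , fL , fR) (r , rL , rR) {k} {a} within ψ≡ g g<2 g≡
          with split-of (θ (toℕ i) (toℕ j) S) t<N
        ... | f , f<4 , enc≡ rewrite ≡.sym enc≡ = go (position k′ L R within)
          where
          digits : ∀ {b} → b < M → available (f b) ≡ g b
          digits = enc-injective 2 M (λ b → available<2 (f b)) g<2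
            (≡.trans (≡.sym (s-enc f f<4)) (≡.trans s≡ (≡.sym g≡))) _
          go : Position k k′ L R → (a < M) × (g a ≡ 1)
          go (atRoot refl) =
            let a<M , fa = firstRoot-sound M f f<4 (≡.trans (≡.sym (root-enc f f<4)) (≡.trans (≡.sym r) ψ≡))
            in a<M , ≡.trans (≡.sym (digits a<M)) (cong available fa)
          go (inLeft inside) =
            let a<M , fa = available-to L fL rL inside ψ≡ (toLeft ∘ f) (λ b → toLeft<2 (f b)) (≡.sym (sˡ-enc f f<4))
            in a<M , ≡.trans (≡.sym (digits a<M)) (cong available (toLeft-1 {f a} fa))
          go (inRight inside) =
            let a<M , fa = available-to R fR rR inside ψ≡ (toRight ∘ f) (λ b → toRight<2 (f b)) (≡.sym (sʳ-enc f f<4))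
            in a<M , ≡.trans (≡.sym (digits a<M)) (cong available (toRight-1 (f<4 a) fa))

        -- At a node the digit of `a` is 3, 1 or 2 according to whether the root, the left or the
        -- right subtree may use `a`. Two keys with address `a` in different parts would give this
        -- digit two values.
        ψ-unique : ∀ {i j} (T : Tree i j) {S} → Follows T S → Recorded ψ T S →
          ∀ {k k′ a} → Within k T → Within k′ T → ψ (suc k) ≡ suc a → ψ (suc k′) ≡ suc a → k ≡ k′
        ψ-unique (leaf j) _ _ (i≤k , k<j) = contradiction k<j (ℕ.≤⇒≯ i≤k)
        ψ-unique (node {i} {j} k₀ L R) {S} (_ , t<N , s≡ , fL , fR) (r , rL , rR) {k} {k′} {a} within within′ ψ≡ ψ′≡
          with split-of (θ (toℕ i) (toℕ j) S) t<N
        ... | f , f<4 , enc≡ rewrite ≡.sym enc≡ = go (position k₀ L R within) (position k₀ L R within′)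
          where
          rootDigit : ∀ {k} → k ≡ toℕ k₀ → ψ (suc k) ≡ suc a → f a ≡ 3
          rootDigit refl e = proj₂ (firstRoot-sound M f f<4 (≡.trans (≡.sym (root-enc f f<4)) (≡.trans (≡.sym r) e)))
          leftDigit : ∀ {k} → Within k L → ψ (suc k) ≡ suc a → f a ≡ 1
          leftDigit inside e = toLeft-1
            (proj₂ (available-to L fL rL inside e (toLeft ∘ f) (λ b → toLeft<2 (f b)) (≡.sym (sˡ-enc f f<4))))
          rightDigit : ∀ {k} → Within k R → ψ (suc k) ≡ suc a → f a ≡ 2
          rightDigit inside e = toRight-1 (f<4 a)
            (proj₂ (available-to R fR rR inside e (toRight ∘ f) (λ b → toRight<2 (f b)) (≡.sym (sʳ-enc f f<4))))
          go : Position k k₀ L R → Position k′ k₀ L R → k ≡ k′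
          go (atRoot e)  (atRoot e′)  = ≡.trans e (≡.sym e′)
          go (inLeft x)  (inLeft y)   = ψ-unique L fL rL x y ψ≡ ψ′≡
          go (inRight x) (inRight y)  = ψ-unique R fR rR x y ψ≡ ψ′≡
          go (atRoot e)  (inLeft y)   = clash (rootDigit e ψ≡) (leftDigit y ψ′≡) (λ ())
          go (atRoot e)  (inRight y)  = clash (rootDigit e ψ≡) (rightDigit y ψ′≡) (λ ())
          go (inLeft x)  (atRoot e)   = clash (leftDigit x ψ≡) (rootDigit e ψ′≡) (λ ())
          go (inLeft x)  (inRight y)  = clash (leftDigit x ψ≡) (rightDigit y ψ′≡) (λ ())
          go (inRight x) (atRoot e)   = clash (rightDigit x ψ≡) (rootDigit e ψ′≡) (λ ())
          go (inRight x) (inLeft y)   = clash (rightDigit x ψ≡) (leftDigit y ψ′≡) (λ ())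

-- Correctness of the precomputed sizes, prices and rules

module Setup where

  open Semantics
  open Codes
  open Levels
  open Algorithm
  open Search using (select-≡; select-≢)
  open import Data.Nat.Base
  open import Data.Nat.Properties
  open import Relation.Binary.PropositionalEquality

  Recurrence : (ℕ → ℕ → ℕ) → (ℕ → ℕ) → ℕ → Set
  Recurrence step A x = (A 0 ≡ 0) × (∀ u → 1 ≤ u → u ≤ x → A u ≡ step (digit4 u) (A (u / 4)))

  -- The extended table has the form to which an assignment to its bank reduces. The new entry reads
  -- only `u / 4`, and no old entry reads the new one, since `u / 4` is below `u`.
  Recurrence-extend : ∀ {step A x u} → u ≡ suc x → Recurrence step A x →
    Recurrence step (λ z → if does (u ≟ z) then step (digit4 u) (A (u / 4)) else A z) (suc x)
  Recurrence-extend {step} {A} {x} refl (A0 , rec) = A0 , rec′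
    where
    A′ : ℕ → ℕ
    A′ z = if does (suc x ≟ z) then step (digit4 (suc x)) (A (suc x / 4)) else A z
    below : ∀ {u} → 1 ≤ u → u ≤ suc x → A′ (u / 4) ≡ A (u / 4)
    below 1≤u u≤ = select-≢ (λ eq → <⇒≢ (<-≤-trans (u/4<u 1≤u) u≤) (sym eq))
    rec′ : ∀ u → 1 ≤ u → u ≤ suc x → A′ u ≡ step (digit4 u) (A′ (u / 4))
    rec′ u 1≤u u≤ with m≤n⇒m<n∨m≡n u≤
    ... | inj₂ refl = trans (select-≡ {x = suc x} refl) (cong (step (digit4 u)) (sym (below 1≤u u≤)))
    ... | inj₁ (s≤s u≤x) = trans (select-≢ {x = suc x} (λ eq → <⇒≢ (s≤s u≤x) (sym eq)))
      (trans (rec u 1≤u u≤x) (cong (step (digit4 u)) (sym (below 1≤u u≤))))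

  module Initialisation {c ℓ₁ ℓ₂ : Level} (K : OrderedCommutativeRing c ℓ₁ ℓ₂) (I : Model.Instance K) where
    open Model K
    open Logic K
    open Instance I

    M D N : ℕ
    M = n ∸ m-last
    D = 2 ^ M
    N = 4 ^ M

    h≤n : h ≤ n
    h≤n = levels≤sum m m-pos

    1≤n : 1 ≤ n
    1≤n = ≤-trans (s≤s z≤n) h≤n

    1≤D : 1 ≤ D
    1≤D = m^n>0 2 M

    1≤N : 1 ≤ N
    1≤N = m^n>0 4 M

    D*D≡N : D * D ≡ N
    D*D≡N = sym (^-distribʳ-* M 2 2)

    sizes-run : ∀ σ → Holds I σ → Run sizes σ (λ τ → (nat τ subsetsBank 0 ≡ D) × (nat τ rulesBank 0 ≡ N)) (150 * n)
    sizes-run σ holds = weaken fits (λ _ x → x)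
      (seq (assign (seq (assign (seq (weaken ≤-refl multiply
        (forRun {P = double} {X = xBank} {L = xLimit} {e = val fastBank}
          (λ x τ → nat τ subsetsBank 0 ≡ 2 ^ x) M fast≡ refl refl refl refl id id
          refl
          (λ x _ _ _ eq → assign (cong (2 *_) eq)))))))))
      where
      open Holds holds
      double : Program
      double = subsetsBank ≔ lit 2 ⊗ val subsetsBank
      fast≡ : nat σ sizeBank 0 ∸ nat σ m-bank (nat σ sizeBank 1) ≡ M
      fast≡ = cong₂ _∸_ n-cell (trans (cong (nat σ m-bank)
        (trans h-cell (cong suc (sym (toℕ-fromℕ (suc h-2)))))) (m-cell (fromℕ (suc h-2))))
      multiply : ∀ {ρ τ} → Frame (for xBank xLimit (val fastBank) double) ρ τ → nat τ subsetsBank 0 ≡ D →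
        Run (rulesBank ≔ val subsetsBank ⊗ val subsetsBank) τ
            (λ τ → (nat τ subsetsBank 0 ≡ D) × (nat τ rulesBank 0 ≡ N)) 7
      multiply _ eq = assign (eq , trans (cong₂ _*_ eq eq) D*D≡N)
      fits : 8 + (3 + ((M * (14 + 6) + 15) + 7)) ≤ 150 * n
      fits = ≤-trans (≤-reflexive (cong (11 +_) (+-comm (M * 20 + 15) 7)))
        (bound-sum 18 40 150 1≤n (≤-trans (loop-bound {Y = 1} 2 6 40 (m∸n≤m n m-last) 1≤n ≤-refl ≤-refl)
          (≤-reflexive (cong (40 *_) (*-identityʳ n)))))

    Priced : ℕ → State → Set
    Priced z τ = (nat τ priceBank 0 ≡ cₗ (fromℕ (suc h-2))) × (nat τ posBank 0 ≡ suc z)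
               × (∀ a → toℕ a < z → nat τ priceBank (suc (toℕ a)) ≡ μ a)

    prices-run : ∀ σ → Holds I σ →
      Run prices σ (λ τ → (nat τ priceBank 0 ≡ cₗ (fromℕ (suc h-2))) × (∀ a → nat τ priceBank (suc (toℕ a)) ≡ μ a))
          (200 * (n * n))
    prices-run σ holds = weaken fits
      (λ { _ (slow , _ , all) → slow , λ a → all a (subst (toℕ a <_) (sym (prefix-all m)) (toℕ<n a)) })
      (seq (assign (seq (assign
        (forRun {P = level} {X = xBank} {L = xLimit} {e = lastLevel}
          (λ l → Priced (prefix m l)) h h-cell refl refl refl refl id id
          (slow , refl , λ _ ())
          step)))))
      where
      open Holds holds
      slow : nat σ c-bank (nat σ sizeBank 1) ≡ cₗ (fromℕ (suc h-2))
      slow = trans (cong (nat σ c-bank) (trans h-cell (cong suc (sym (toℕ-fromℕ (suc h-2)))))) (c-cell (fromℕ (suc h-2)))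
      inner level : Program
      inner = priceBank [ val posBank ]≔ load c-bank (lit 1 ⊕ val xBank) ︔ posBank ≔ lit 1 ⊕ val posBank
      level = for yBank yLimit (load m-bank (lit 1 ⊕ val xBank)) inner
      fits : 5 + (3 + (h * (14 + 70 * (n * 1)) + 15)) ≤ 200 * (n * n)
      fits = bound-sum 8 170 200 {Y = n * n} (*-mono-≤ 1≤n 1≤n)
        (loop-bound 2 70 170 h≤n 1≤n 1≤n (≤-reflexive (cong (70 *_) (*-identityʳ n))))
      step : ∀ l {ρ} → l < h → nat ρ xBank 0 ≡ l → Frame (for xBank xLimit lastLevel level) _ ρ →
             Priced (prefix m l) ρ → Run level ρ (Priced (prefix m (suc l))) (70 * (n * 1))
      step l {ρ} l<h el fr priced =
        weaken (loop-bound 5 14 70 (m≤sum m l′) 1≤n ≤-refl ≤-refl)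
          (λ {τ} _ → subst (λ z → Priced z τ) end)
          (forRun {P = inner} {X = yBank} {L = yLimit} {e = load m-bank (lit 1 ⊕ val xBank)}
            (λ y → Priced (prefix m l + y)) (m l′) size refl refl refl refl id id
            (subst (λ z → Priced z ρ) (sym (+-identityʳ _)) priced)
            fill)
        where
        l′ : Fin h
        l′ = fromℕ< l<h
        l≡ : toℕ l′ ≡ l
        l≡ = toℕ-fromℕ< l<h
        end : prefix m l + m l′ ≡ prefix m (suc l)
        end = trans (cong (λ x → prefix m x + m l′) (sym l≡)) (trans (sym (prefix-suc m l′)) (cong (prefix m ∘ suc) l≡))
        size : nat ρ m-bank (suc (nat ρ xBank 0)) ≡ m l′
        size = trans (natF fr m-bank refl _) (trans (cong (nat σ m-bank ∘ suc) (trans el (sym l≡))) (m-cell l′))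
        fill : ∀ y {τ} → y < m l′ → nat τ yBank 0 ≡ y → Frame level ρ τ →
               Priced (prefix m l + y) τ → Run inner τ (Priced (prefix m l + suc y)) 14
        fill y {τ} y<m ey fr′ (s , pos , all) = weaken (≤ᵇ⇒≤ _ 14 tt) (λ _ x → x) (seq (assign (assign
          ( trans (select-≢ (λ eq → 1+n≢0 (trans (sym pos) eq))) s
          , cong suc (trans pos (sym (+-suc _ y)))
          , all′))))
          where
          price : nat τ c-bank (suc (nat τ xBank 0)) ≡ cₗ l′
          price = trans (natF fr′ c-bank refl _) (trans (natF fr c-bank refl _)
            (trans (cong (nat σ c-bank ∘ suc) (trans (natF fr′ xBank refl 0) (trans el (sym l≡)))) (c-cell l′)))
          all′ : ∀ a → toℕ a < prefix m l + suc y →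
            (if does (nat τ posBank 0 ≟ suc (toℕ a)) then nat τ c-bank (suc (nat τ xBank 0))
             else nat τ priceBank (suc (toℕ a))) ≡ μ a
          all′ a a< with m≤n⇒m<n∨m≡n (s≤s⁻¹ (subst (suc (toℕ a) ≤_) (+-suc _ y) a<))
          ... | inj₁ lt = trans (select-≢ (λ eq → <⇒≢ lt (suc-injective (trans (sym eq) pos)))) (all a lt)
          ... | inj₂ e  = trans (select-≡ (trans pos (cong suc (sym e))))
            (trans price (cong cₗ (sym (levelOf-prefix m a l′ y<m
              (trans e (cong (λ x → prefix m x + y) (sym l≡)))))))

    bits : (ℕ → ℕ) → ℕ → ℕ → ℕ
    bits γ d r = γ d + 2 * r

    Tabulated : ℕ → State → Set
    Tabulated x τ = Recurrence (bits available) (nat τ ruleBank) x × Recurrence (bits toLeft) (nat τ ruleLeftBank) x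
                  × Recurrence (bits toRight) (nat τ ruleRightBank) x × Recurrence firstRoot-step (nat τ ruleRootBank) x

    rules-run : ∀ σ → nat σ rulesBank 0 ≡ N → Run rules σ (Tabulated (N ∸ 1)) (300 * N)
    rules-run σ eN = weaken fits (λ _ x → x)
      (seq (assign (seq (assign (seq (assign (seq (assign
        (forRun {P = oneRule} {X = xBank} {L = xLimit} {e = val rulesBank ⊖ lit 1}
          Tabulated (N ∸ 1) (cong (_∸ 1) eN) refl refl refl refl id id
          (start (bits available) , start (bits toLeft) , start (bits toRight) , start firstRoot-step)
          step)))))))))
      where
      start : ∀ step {A : ℕ → ℕ} → Recurrence step (λ z → if does (0 ≟ z) then 0 else A z) 0
      start step = refl , λ { u 1≤u z≤n → contradiction 1≤u λ () }
      fits : 3 + (3 + (3 + (3 + ((N ∸ 1) * (14 + 200) + 17)))) ≤ 300 * N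
      fits = bound-sum 12 250 300 1≤N (≤-trans (loop-bound {Y = 1} 4 200 250 (m∸n≤m N 1) 1≤N ≤-refl ≤-refl)
        (≤-reflexive (cong (250 *_) (*-identityʳ N))))
      step : ∀ x {ρ} → x < N ∸ 1 → nat ρ xBank 0 ≡ x → Frame (for xBank xLimit (val rulesBank ⊖ lit 1) oneRule) _ ρ →
             Tabulated x ρ → Run oneRule ρ (Tabulated (suc x)) 200
      step x _ ex _ (r₁ , r₂ , r₃ , r₄) = weaken (≤ᵇ⇒≤ _ 200 tt) (λ _ y → y)
        (seq (assign (seq (assign (seq (assign (seq (assign (seq (assign (assign
          ( Recurrence-extend {bits available} (cong suc ex) r₁
          , Recurrence-extend {bits toLeft} (cong suc ex) r₂
          , Recurrence-extend {bits toRight} (cong suc ex) r₃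
          , Recurrence-extend {firstRoot-step} (cong suc ex) r₄))))))))))))

    record Ready (τ : State) : Set where
      field
        subsets≡      : nat τ subsetsBank 0 ≡ D
        rules≡        : nat τ rulesBank 0 ≡ N
        price-slow    : nat τ priceBank 0 ≡ cₗ (fromℕ (suc h-2))
        price-address : ∀ a → nat τ priceBank (suc (toℕ a)) ≡ μ a
        s-enc    : ∀ f → (∀ a → f a < 4) → nat τ ruleBank (enc 4 M f) ≡ enc 2 M (available ∘ f)
        sˡ-enc   : ∀ f → (∀ a → f a < 4) → nat τ ruleLeftBank (enc 4 M f) ≡ enc 2 M (toLeft ∘ f)
        sʳ-enc   : ∀ f → (∀ a → f a < 4) → nat τ ruleRightBank (enc 4 M f) ≡ enc 2 M (toRight ∘ f)
        root-enc : ∀ f → (∀ a → f a < 4) → nat τ ruleRootBank (enc 4 M f) ≡ firstRoot M f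

    table-fold : ∀ {step A} → step 0 0 ≡ 0 → Recurrence step A (N ∸ 1) →
                 ∀ f → (∀ a → f a < 4) → A (enc 4 M f) ≡ foldDigits step M f
    table-fold {A = A} s0 (A0 , rec) f f<4 =
      foldDigits-table A s0 A0 (λ u 1≤u u<N → rec u 1≤u (∸-monoˡ-≤ 1 u<N)) M f f<4 (enc< 4 M (λ a _ → f<4 a))

    setup : Program
    setup = sizes ︔ prices ︔ rules

    setup-run : ∀ σ → Holds I σ → Run setup σ Ready (700 * (n * (n * N)))
    setup-run σ holds = weaken fits (λ _ x → x) (seq (weaken ≤-refl (λ {ρ} → afterSizes ρ) (sizes-run σ holds)))
      where
      open Holds holds
      fits : 150 * n + (200 * (n * n) + 300 * N) ≤ 700 * (n * (n * N))
      fits = begin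
        150 * n + (200 * (n * n) + 300 * N)
          ≤⟨ +-mono-≤ (*-monoʳ-≤ 150 (m≤m*n′ n (*-mono-≤ 1≤n 1≤N)))
               (+-mono-≤ (*-monoʳ-≤ 200 (*-monoʳ-≤ n (m≤m*n′ n 1≤N)))
                         (*-monoʳ-≤ 300 (≤-trans (m≤n*m′ N 1≤n) (m≤n*m′ (n * N) 1≤n)))) ⟩
        150 * Y + (200 * Y + 300 * Y) ≡⟨ cong (150 * Y +_) (*-distribʳ-+ Y 200 300) ⟨
        150 * Y + 500 * Y             ≡⟨ *-distribʳ-+ Y 150 500 ⟨
        650 * Y                       ≤⟨ *-monoˡ-≤ Y (≤ᵇ⇒≤ 650 700 tt) ⟩
        700 * Y ∎
        where
        open ≤-Reasoning
        Y : ℕ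
        Y = n * (n * N)
        m≤m*n′ : ∀ x {y} → 1 ≤ y → x ≤ x * y
        m≤m*n′ x 1≤y = ≤-trans (≤-reflexive (sym (*-identityʳ x))) (*-monoʳ-≤ x 1≤y)
        m≤n*m′ : ∀ x {y} → 1 ≤ y → x ≤ y * x
        m≤n*m′ x {y} 1≤y = ≤-trans (m≤m*n′ x 1≤y) (≤-reflexive (*-comm x y))
      afterSizes : ∀ ρ → Frame sizes σ ρ → (nat ρ subsetsBank 0 ≡ D) × (nat ρ rulesBank 0 ≡ N) →
                   Run (prices ︔ rules) ρ Ready (200 * (n * n) + 300 * N)
      afterSizes ρ fr (eD , eN) = seq (weaken ≤-refl (λ {τ} → afterPrices τ) (prices-run ρ record
        { n-cell = trans (natF fr sizeBank refl 0) n-cell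
        ; h-cell = trans (natF fr sizeBank refl 1) h-cell
        ; m-cell = λ l → trans (natF fr m-bank refl _) (m-cell l)
        ; c-cell = λ l → trans (natF fr c-bank refl _) (c-cell l)
        ; p-cell = λ k → K-trans (K-reflexive (numF fr p-bank refl _)) (p-cell k)
        ; q-cell = λ j → K-trans (K-reflexive (numF fr q-bank refl _)) (q-cell j)
        }))
        where
        open OrderedCommutativeRing K using () renaming (trans to K-trans; reflexive to K-reflexive)
        afterPrices : ∀ τ → Frame prices ρ τ → _ → Run rules τ Ready (300 * N)
        afterPrices τ fr′ (slow , addresses) = weaken ≤-refl ready (rules-run τ (trans (natF fr′ rulesBank refl 0) eN))
          where
          ready : ∀ {τ′} → Frame rules τ τ′ → Tabulated (N ∸ 1) τ′ → Ready τ′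
          ready fr″ (r₁ , r₂ , r₃ , r₄) = record
            { subsets≡ = trans (natF fr″ subsetsBank refl 0) (trans (natF fr′ subsetsBank refl 0) eD)
            ; rules≡ = trans (natF fr″ rulesBank refl 0) (trans (natF fr′ rulesBank refl 0) eN)
            ; price-slow = trans (natF fr″ priceBank refl 0) slow
            ; price-address = λ a → trans (natF fr″ priceBank refl _) (addresses a)
            ; s-enc = λ f f<4 → trans (table-fold {bits available} refl r₁ f f<4) (foldDigits-enc 2 available M f)
            ; sˡ-enc = λ f f<4 → trans (table-fold {bits toLeft} refl r₂ f f<4) (foldDigits-enc 2 toLeft M f)
            ; sʳ-enc = λ f f<4 → trans (table-fold {bits toRight} refl r₃ f f<4) (foldDigits-enc 2 toRight M f)
            ; root-enc = λ f f<4 → table-fold {firstRoot-step} refl r₄ f f<4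
            }

-- Completing the chosen fast addresses to a bijection

module Addresses where

  open Semantics
  open Algorithm
  open Search using (select-≡; select-≢)
  open import Data.Nat.Base
  open import Data.Nat.Properties
  open import Relation.Binary.PropositionalEquality

  _[_≔_]′ : (ℕ → ℕ) → ℕ → ℕ → ℕ → ℕ
  (f [ x ≔ y ]′) z = if does (x ≟ z) then y else f z

  InRange : ℕ → ℕ → Set
  InRange n k = (1 ≤ k) × (k ≤ n)

  LeftInverse : ℕ → (ℕ → ℕ) → (ℕ → ℕ) → Set
  LeftInverse n f g = ∀ k → InRange n k → InRange n (f k) × (g (f k) ≡ k)

  -- Exchanging `f` with `g` and `k` with `a` exchanges the two updated functions, so this one
  -- statement serves both directions of the bijection. If `g a` is already `k`, the outer updates
  -- override the inner ones and nothing changes.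
  transpose-inverse : ∀ {n f g k a} → LeftInverse n f g → InRange n k → InRange n a →
    LeftInverse n ((f [ g a ≔ f k ]′) [ k ≔ a ]′) ((g [ f k ≔ g a ]′) [ a ≔ k ]′)
  transpose-inverse {n} {f} {g} {k} {a} fg k∈ a∈ z z∈ with k ≟ z | g a ≟ z
  ... | yes refl | _ =
    subst (λ x → InRange n x × ((g [ f k ≔ g a ]′) [ a ≔ k ]′) x ≡ k) (sym (select-≡ {x = k} refl))
        (a∈ , select-≡ {x = a} refl)
  ... | no k≢z | yes refl =
    subst (λ x → InRange n x × ((g [ f k ≔ g a ]′) [ a ≔ k ]′) x ≡ g a)
      (sym (trans (select-≢ k≢z) (select-≡ {x = g a} refl)))
      (proj₁ (fg k k∈) , trans (select-≢ a≢fk) (select-≡ {x = f k} refl))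
    where
    a≢fk : a ≢ f k
    a≢fk eq = k≢z (trans (sym (proj₂ (fg k k∈))) (cong g (sym eq)))
  ... | no k≢z | no ga≢z =
    subst (λ x → InRange n x × ((g [ f k ≔ g a ]′) [ a ≔ k ]′) x ≡ z)
      (sym (trans (select-≢ k≢z) (select-≢ ga≢z)))
      (proj₁ (fg z z∈) , trans (select-≢ (λ eq → ga≢z (trans (cong g eq) (proj₂ (fg z z∈)))))
        (trans (select-≢ (λ eq → k≢z (trans (sym (proj₂ (fg k k∈))) (trans (cong g eq) (proj₂ (fg z z∈))))))
          (proj₂ (fg z z∈))))

  module Assignment {c ℓ₁ ℓ₂ : Level} (K : OrderedCommutativeRing c ℓ₁ ℓ₂)
    (n : ℕ) (1≤n : 1 ≤ n) (ψ : ℕ → ℕ)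
    (ψ≤n : ∀ k → InRange n k → ψ k ≤ n)
    (ψ-unique : ∀ k k′ → InRange n k → InRange n k′ → 1 ≤ ψ k → ψ k ≡ ψ k′ → k ≡ k′) where
    open Model K
    open Logic K

    Bijective : State → Set
    Bijective σ = LeftInverse n (nat σ φ-bank) (nat σ inverseBank) × LeftInverse n (nat σ inverseBank) (nat σ φ-bank)

    Placed : ℕ → State → Set
    Placed x σ = ∀ k → 1 ≤ k → k ≤ x → 1 ≤ ψ k → nat σ φ-bank k ≡ ψ k

    identity-run : ∀ σ → nat σ sizeBank 0 ≡ n → Run identity σ Bijective (100 * n)
    identity-run σ en = weaken fits
      (λ {τ} _ → bijective τ)
      (forRun {P = write} {X = xBank} {L = xLimit} {e = nᵉ} Inv n en refl refl refl refl id id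
        (λ { k 1≤k z≤n → contradiction 1≤k λ () }) step)
      where
      write : Program
      write = φ-bank [ lit 1 ⊕ val xBank ]≔ lit 1 ⊕ val xBank ︔ inverseBank [ lit 1 ⊕ val xBank ]≔ lit 1 ⊕ val xBank
      fits : n * (14 + 20) + 15 ≤ 100 * n
      fits = ≤-trans (loop-bound {Y = 1} 2 20 100 ≤-refl 1≤n ≤-refl ≤-refl) (≤-reflexive (cong (100 *_) (*-identityʳ n)))
      Inv : ℕ → State → Set
      Inv x τ = ∀ k → 1 ≤ k → k ≤ x → (nat τ φ-bank k ≡ k) × (nat τ inverseBank k ≡ k)
      bijective : ∀ τ → Inv n τ → Bijective τ
      bijective τ all =
        (λ k k∈ → let a , b = all k (proj₁ k∈) (proj₂ k∈) in
          subst (InRange n) (sym a) k∈ , trans (cong (nat τ inverseBank) a) b) ,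
        (λ k k∈ → let a , b = all k (proj₁ k∈) (proj₂ k∈) in
          subst (InRange n) (sym b) k∈ , trans (cong (nat τ φ-bank) b) a)
      step : ∀ x {ρ} → x < n → nat ρ xBank 0 ≡ x → Frame (for xBank xLimit nᵉ write) σ ρ → Inv x ρ → Run write ρ (Inv (suc x)) 20
      step x {ρ} _ ex _ inv = weaken (≤ᵇ⇒≤ _ 20 tt) (λ _ y → y) (seq (assign (assign inv′)))
        where
        inv′ : ∀ k → 1 ≤ k → k ≤ suc x →
          ((nat ρ φ-bank [ suc (nat ρ xBank 0) ≔ suc (nat ρ xBank 0) ]′) k ≡ k)
          × ((nat ρ inverseBank [ suc (nat ρ xBank 0) ≔ suc (nat ρ xBank 0) ]′) k ≡ k)
        inv′ k 1≤k k≤ with m≤n⇒m<n∨m≡n k≤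
        ... | inj₁ (s≤s k≤x) =
          let old = inv k 1≤k k≤x
              ne : suc (nat ρ xBank 0) ≢ k
              ne = λ eq → <⇒≢ (s≤s k≤x) (trans (sym eq) (cong suc ex))
          in trans (select-≢ ne) (proj₁ old) , trans (select-≢ ne) (proj₂ old)
        ... | inj₂ k≡ =
          let eq : suc (nat ρ xBank 0) ≡ k
              eq = trans (cong suc ex) (sym k≡)
          in trans (select-≡ eq) eq , trans (select-≡ eq) eq

    Inv : ℕ → State → Set
    Inv x σ = Bijective σ × Placed x σ

    -- The exchange displaces only the key that holds the wanted address `a`. If that were an
    -- earlier key with an intended address, its intended address would be `a` as well, against
    -- `ψ-unique`.
    move-run : ∀ x σ → x < n → nat σ xBank 0 ≡ x → (∀ k → nat σ ψ-bank k ≡ ψ k) → Inv x σ → Run move σ (Inv (suc x)) 100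
    move-run x σ x<n ex eψ ((fg , gf) , placed) = weaken (≤ᵇ⇒≤ (7 + (5 + (60 + 1))) 100 tt) (λ _ y → y)
      (seq (assign (branch yes′ no′)))
      where
      a : ℕ
      a = nat σ ψ-bank (suc (nat σ xBank 0))
      a≡ : a ≡ ψ (suc x)
      a≡ = trans (eψ _) (cong (ψ ∘ suc) ex)
      ρ : State
      ρ = ⟪ nat σ [ aBank , 0 ↦ a ] , num σ ⟫
      k∈ : InRange n (suc (nat σ xBank 0))
      k∈ = s≤s z≤n , subst (λ x → suc x ≤ n) (sym ex) x<n
      yes′ : does (1 ≤? a) ≡ true →
        Run (kBank ≔ load inverseBank (val aBank) ︔
             bBank ≔ load φ-bank (lit 1 ⊕ val xBank) ︔
             φ-bank [ val kBank ]≔ val bBank ︔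
             inverseBank [ val bBank ]≔ val kBank ︔
             φ-bank [ lit 1 ⊕ val xBank ]≔ val aBank ︔
             inverseBank [ val aBank ]≔ lit 1 ⊕ val xBank) ρ (Inv (suc x)) 60
      yes′ ok = weaken (≤ᵇ⇒≤ _ 60 tt) (λ _ y → y)
        (seq (assign (seq (assign (seq (assign (seq (assign (seq (assign (assign
          ((transpose-inverse {f = φ} {g = g} fg k∈ a∈ , transpose-inverse {f = g} {g = φ} gf a∈ k∈) , placed′))))))))))))
        where
        1≤a : 1 ≤ a
        1≤a = ≤ᵇ⇒≤ 1 a (subst T′ (sym ok) tt)
          where
          open import Data.Bool.Base using () renaming (T to T′)
        a∈ : InRange n a
        a∈ = 1≤a , subst (_≤ n) (sym a≡) (ψ≤n (suc x) (s≤s z≤n , x<n))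
        φ g : ℕ → ℕ
        φ = nat σ φ-bank
        g = nat σ inverseBank
        k₁ : ℕ
        k₁ = suc (nat σ xBank 0)
        placed′ : ∀ k → 1 ≤ k → k ≤ suc x → 1 ≤ ψ k → ((φ [ g a ≔ φ k₁ ]′) [ k₁ ≔ a ]′) k ≡ ψ k
        placed′ k 1≤k k≤ 1≤ψk with m≤n⇒m<n∨m≡n k≤
        ... | inj₂ refl = trans (select-≡ (cong suc ex)) a≡
        ... | inj₁ (s≤s k≤x) = trans (select-≢ (λ eq → <⇒≢ (s≤s k≤x) (trans (sym eq) (cong suc ex))))
          (trans (select-≢ (λ eq → <⇒≢ (s≤s k≤x) (ψ-unique k (suc x) (1≤k , ≤-trans k≤x (<⇒≤ x<n)) (s≤s z≤n , x<n) 1≤ψk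
                    (trans (sym (placed k 1≤k k≤x 1≤ψk)) (trans (cong φ (sym eq)) (trans (proj₂ (gf a a∈)) a≡))))))
                 (placed k 1≤k k≤x 1≤ψk))
      no′ : does (1 ≤? a) ≡ false → Run skip ρ (Inv (suc x)) 1
      no′ ko = runSkip ((fg , gf) , placed′)
        where
        placed′ : ∀ k → 1 ≤ k → k ≤ suc x → 1 ≤ ψ k → nat σ φ-bank k ≡ ψ k
        placed′ k 1≤k k≤ 1≤ψk with m≤n⇒m<n∨m≡n k≤
        ... | inj₁ (s≤s k≤x) = placed k 1≤k k≤x 1≤ψk
        ... | inj₂ refl = contradiction (trans (sym ko) (dec-true (1 ≤? a) (subst (1 ≤_) (sym a≡) 1≤ψk))) (λ ())

    assignAddresses-run : ∀ σ → nat σ sizeBank 0 ≡ n → (∀ k → nat σ ψ-bank k ≡ ψ k) →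
      Run assignAddresses σ (Inv n) (400 * n)
    assignAddresses-run σ en eψ = weaken fits (λ _ y → y)
      (seq (weaken ≤-refl (λ {ρ} fr bij →
        forRun {P = move} {X = xBank} {L = xLimit} {e = nᵉ} Inv n (trans (natF fr sizeBank refl 0) en) refl refl refl refl id id
          (bij , λ { k 1≤k z≤n → contradiction 1≤k λ () })
          (λ x x<n ex fr′ inv → move-run x _ x<n ex
            (λ k → trans (natF fr′ ψ-bank refl k) (trans (natF fr ψ-bank refl k) (eψ k))) inv))
        (identity-run σ en)))
      where
      fits : 100 * n + (n * (14 + 100) + 15) ≤ 400 * n
      fits = ≤-trans (+-monoʳ-≤ (100 * n) (≤-trans (loop-bound {Y = 1} 2 100 200 ≤-refl 1≤n ≤-refl ≤-refl)
          (≤-reflexive (cong (200 *_) (*-identityʳ n)))))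
        (≤-trans (≤-reflexive (sym (*-distribʳ-+ n 100 200))) (*-monoˡ-≤ n (≤ᵇ⇒≤ 300 400 tt)))

-- Reading the tree off the table

module Output where

  open Semantics
  open Algorithm
  open Search
  open Optimality using (module Following; tree-≤)
  open import Data.Nat.Base
  open import Data.Nat.Properties
  open import Relation.Binary.PropositionalEquality

  differs : ∀ {a b} (a≤b? : Dec (a ≤ b)) (b≤a? : Dec (b ≤ a)) → a ≢ b → not (does a≤b? ∧ does b≤a?) ≡ true
  differs (no _)    _         _   = refl
  differs (yes _)   (no _)    _   = refl
  differs (yes a≤b) (yes b≤a) a≢b = contradiction (≤-antisym a≤b b≤a) a≢b

  module Writing {c ℓ₁ ℓ₂ : Level} (K : OrderedCommutativeRing c ℓ₁ ℓ₂)
    (n D N : ℕ) (price s sˡ sʳ root : ℕ → ℕ)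
    (p q : ℕ → OrderedCommutativeRing.Carrier K)
    (1≤n : 1 ≤ n) (1≤D : 1 ≤ D) (1≤N : 1 ≤ N)
    (sˡ<D : ∀ t → t < N → sˡ t < D) (sʳ<D : ∀ t → t < N → sʳ t < D)
    (κ θ : ℕ → ℕ → ℕ → ℕ) where
    open Model K
    open Logic K
    open Bellman K n D N price s sˡ sʳ root p q
    open DynamicProgram K n D N price s sˡ sʳ root p q 1≤n 1≤D 1≤N sˡ<D sʳ<D using (Env; Env-frame; Disturbs; K-of; T-of)
    open Following n D N s sˡ sʳ root κ θ

    Table : State → Set c
    Table σ = Env σ × (∀ i j S → K-of σ i j S ≡ κ i j S) × (∀ i j S → T-of σ i j S ≡ θ i j S)

    Table-frame : ∀ P {σ τ} → Disturbs P ∨ writesNat P keyBank ∨ writesNat P choiceBank ≡ false →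
                  Frame P σ τ → Table σ → Table τ
    Table-frame P w f (env , eκ , eθ) =
      let w₀ , w = ∨-false {Disturbs P} w
          w₁ , w₂ = ∨-false w
      in Env-frame P w₀ f env , (λ i j S → trans (natF f keyBank w₁ _) (eκ i j S))
                              , (λ i j S → trans (natF f choiceBank w₂ _) (eθ i j S))

    Place : Set
    Place = ℕ × ℕ × ℕ

    -- The cell at which the descent for key `x` has to stop. The clause for a leaf is a default, as
    -- a key within the tree is met at a node.
    find : ∀ {i j} → Tree {n} i j → ℕ → ℕ → Place
    find (leaf j) S x = toℕ j , toℕ j , S
    find (node {i} {j} k L R) S x with <-cmp x (toℕ k)
    ... | tri< _ _ _ = find L (sˡ (θ (toℕ i) (toℕ j) S)) x
    ... | tri≈ _ _ _ = toℕ i , toℕ j , S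
    ... | tri> _ _ _ = find R (sʳ (θ (toℕ i) (toℕ j) S)) x

    At : Place → State → Set
    At (i , j , S) σ = (nat σ iBank 0 ≡ i) × (nat σ jBank 0 ≡ j) × (nat σ SBank 0 ≡ S)
                     × (nat σ cellBank 0 ≡ cellIndex i j S)

    ruleLeft≡ : ∀ σ → Env σ → ∀ t → nat σ ruleLeftBank t ≡ sˡ t
    ruleLeft≡ σ (_ , _ , _ , _ , _ , e , _) = e

    ruleRight≡ : ∀ σ → Env σ → ∀ t → nat σ ruleRightBank t ≡ sʳ t
    ruleRight≡ σ (_ , _ , _ , _ , _ , _ , e , _) = e

    ruleRoot≡ : ∀ σ → Env σ → ∀ t → nat σ ruleRootBank t ≡ root t
    ruleRoot≡ σ (_ , _ , _ , _ , _ , _ , _ , e , _) = e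

    thisCell≡ : ∀ σ {i j S} → Env σ → nat σ iBank 0 ≡ i → nat σ jBank 0 ≡ j → nat σ SBank 0 ≡ S →
                natVal thisCell σ ≡ cellIndex i j S
    thisCell≡ σ (e₀ , e₁ , _) ei ej eS rewrite e₀ | e₁ | ei | ej | eS = refl

    whileDone : ∀ {ℓ b P σ} {Post : State → Set ℓ} → boolVal b σ ≡ false → Post σ →
                Run (`while b loop P) σ Post (1 + boolTime b)
    whileDone eq post = run (⇓-done eq) post ≤-refl

    -- The number of rounds of a descent depends on the tree, so that loop is unrolled by induction
    -- on the tree rather than counted as in `whileRun`.
    whileStep : ∀ {ℓ b P σ B B′} {Post : State → Set ℓ} → boolVal b σ ≡ true →
                Run P σ (λ ρ → Run (`while b loop P) ρ Post B′) B →
                Run (`while b loop P) σ Post (1 + boolTime b + (B + B′))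
    whileStep {b = b} {B = B} {B′ = B′} eq (run d (run e post l′) l) = run (⇓-loop eq d e) post
      (≤-trans (≤-reflexive (+-assoc (1 + boolTime b) _ _)) (+-monoʳ-≤ (1 + boolTime b) (+-mono-≤ l l′)))

    step-fits : ∀ {a b} → a < b → 1 + boolTime (`not here) + (90 + 120 * a) ≤ 120 * b
    step-fits {a} {b} a<b = ≤-trans (+-monoˡ-≤ (120 * a) (≤ᵇ⇒≤ (1 + boolTime (`not here) + 90) 120 tt))
      (≤-trans (≤-reflexive (sym (*-suc 120 a))) (*-monoʳ-≤ 120 a<b))

    descent : Program
    descent = `while `not here loop descend

    locate-run : ∀ σ {i j S} → Env σ → nat σ iBank 0 ≡ i → nat σ jBank 0 ≡ j → nat σ SBank 0 ≡ S →
                 Run locate σ (At (i , j , S)) 30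
    locate-run σ env ei ej eS = weaken (≤ᵇ⇒≤ _ 30 tt) (λ _ y → y) (assign (ei , ej , eS , thisCell≡ σ env ei ej eS))

    module _ (σ : State) {i j S k t x : ℕ} (env : Env σ) (ex : nat σ xBank 0 ≡ x) (at : At (i , j , S) σ)
             (key≡ : nat σ keyBank (nat σ cellBank 0) ≡ suc k) (rule≡ : nat σ choiceBank (nat σ cellBank 0) ≡ t) where

      descend-left : x < k → Run descend σ (At (i , k , sˡ t)) 90
      descend-left x<k = weaken (≤ᵇ⇒≤ (5 + ((9 + (20 + 20)) + 30)) 90 tt) (λ _ y → y) (seq (assign (seq (branch left wrong))))
        where
        ρ : State
        ρ = ⟪ nat σ [ tBank , 0 ↦ nat σ choiceBank (nat σ cellBank 0) ] , num σ ⟫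
        left : does (suc (nat σ xBank 0) ≤? nat σ keyBank (nat σ cellBank 0)) ≡ true →
          Run (jBank ≔ load keyBank (val cellBank) ⊖ lit 1 ︔ SBank ≔ load ruleLeftBank (val tBank)) ρ
              (λ τ → Run locate τ (At (i , k , sˡ t)) 30) 20
        left _ = weaken (≤ᵇ⇒≤ _ 20 tt) (λ _ y → y) (seq (assign (assign
          (locate-run _ env (proj₁ at) (cong (_∸ 1) key≡) (trans (ruleLeft≡ σ env _) (cong sˡ rule≡))))))
        wrong : does (suc (nat σ xBank 0) ≤? nat σ keyBank (nat σ cellBank 0)) ≡ false →
          Run (iBank ≔ load keyBank (val cellBank) ︔ SBank ≔ load ruleRightBank (val tBank)) ρ
              (λ τ → Run locate τ (At (i , k , sˡ t)) 30) 20
        wrong ko = contradiction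
          (trans (sym ko) (dec-true (_ ≤? _) (subst₂ (λ u v → suc u ≤ v) (sym ex) (sym key≡) (s≤s (<⇒≤ x<k))))) (λ ())

      descend-right : k < x → Run descend σ (At (suc k , j , sʳ t)) 90
      descend-right k<x = weaken (≤ᵇ⇒≤ (5 + ((9 + (20 + 20)) + 30)) 90 tt) (λ _ y → y) (seq (assign (seq (branch wrong right))))
        where
        ρ : State
        ρ = ⟪ nat σ [ tBank , 0 ↦ nat σ choiceBank (nat σ cellBank 0) ] , num σ ⟫
        wrong : does (suc (nat σ xBank 0) ≤? nat σ keyBank (nat σ cellBank 0)) ≡ true →
          Run (jBank ≔ load keyBank (val cellBank) ⊖ lit 1 ︔ SBank ≔ load ruleLeftBank (val tBank)) ρ
              (λ τ → Run locate τ (At (suc k , j , sʳ t)) 30) 20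
        wrong ok = contradiction
          (trans (sym ok) (dec-false (_ ≤? _) (λ le → <⇒≱ k<x (s≤s⁻¹ (subst₂ (λ u v → suc u ≤ v) ex key≡ le))))) (λ ())
        right : does (suc (nat σ xBank 0) ≤? nat σ keyBank (nat σ cellBank 0)) ≡ false →
          Run (iBank ≔ load keyBank (val cellBank) ︔ SBank ≔ load ruleRightBank (val tBank)) ρ
              (λ τ → Run locate τ (At (suc k , j , sʳ t)) 30) 20
        right _ = weaken (≤ᵇ⇒≤ _ 20 tt) (λ _ y → y) (seq (assign (assign
          (locate-run _ env key≡ (proj₁ (proj₂ at)) (trans (ruleRight≡ σ env _) (cong sʳ rule≡))))))

      not-here : x ≢ k → boolVal (`not here) σ ≡ true
      not-here x≢k = differs (_ ≤? _) (_ ≤? _) (λ eq → x≢k (trans (sym ex) (suc-injective (trans (sym eq) key≡))))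

      found : x ≡ k → boolVal (`not here) σ ≡ false
      found x≡k = cong not (cong₂ _∧_ (dec-true (_ ≤? _) (≤-reflexive same)) (dec-true (_ ≤? _) (≤-reflexive (sym same))))
        where
        same : nat σ keyBank (nat σ cellBank 0) ≡ suc (nat σ xBank 0)
        same = trans key≡ (cong suc (sym (trans ex x≡k)))

    -- Every round moves to a strictly shorter interval, so the length of the interval pays for it:
    -- 120 units cover one `descend` together with its test.
    descent-run : ∀ {i j} (T : Tree {n} i j) S x σ → Follows T S → Within x T →
      Table σ → nat σ xBank 0 ≡ x → At (toℕ i , toℕ j , S) σ →
      Run descent σ (At (find T S x)) (120 * (toℕ j ∸ toℕ i))
    descent-run (leaf j) S x σ _ (i≤x , x<j) = contradiction x<j (≤⇒≯ i≤x)
    descent-run T@(node {i} {j} k L R) S x σ (κ≡ , t<N , s≡ , fL , fR) (i≤x , x<j) table@(env , eκ , eθ) ex at@(ei , ej , eS , ec)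
      with <-cmp x (toℕ k)
    ... | tri≈ _ x≡k _ = weaken (≤-trans (≤ᵇ⇒≤ _ 120 tt) (*-monoʳ-≤ 120 (m<n⇒0<n∸m (≤-<-trans i≤x x<j))))
        (λ _ y → y) (whileDone (found σ env ex at key≡ rule≡ x≡k) at)
      where
      key≡ : nat σ keyBank (nat σ cellBank 0) ≡ suc (toℕ k)
      key≡ = trans (cong (nat σ keyBank) ec) (trans (eκ _ _ _) κ≡)
      rule≡ : nat σ choiceBank (nat σ cellBank 0) ≡ θ (toℕ i) (toℕ j) S
      rule≡ = trans (cong (nat σ choiceBank) ec) (eθ _ _ _)
    ... | tri< x<k x≢k _ = weaken fits (λ _ y → y)
        (whileStep (not-here σ env ex at key≡ rule≡ x≢k)
          (weaken ≤-refl (λ {ρ} fr → next ρ fr) (descend-left σ env ex at key≡ rule≡ x<k)))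
      where
      t : ℕ
      t = θ (toℕ i) (toℕ j) S
      key≡ : nat σ keyBank (nat σ cellBank 0) ≡ suc (toℕ k)
      key≡ = trans (cong (nat σ keyBank) ec) (trans (eκ _ _ _) κ≡)
      rule≡ : nat σ choiceBank (nat σ cellBank 0) ≡ t
      rule≡ = trans (cong (nat σ choiceBank) ec) (eθ _ _ _)
      next : ∀ ρ → Frame descend σ ρ → At (toℕ i , toℕ k , sˡ t) ρ →
        Run descent ρ (At (find L (sˡ t) x)) (120 * (toℕ (inject₁ k) ∸ toℕ i))
      next ρ fr at′ = descent-run L (sˡ t) x ρ fL (i≤x , subst (x <_) (sym (toℕ-inject₁ k)) x<k)
        (Table-frame descend refl fr table) (trans (natF fr xBank refl 0) ex)
        (subst (λ k → At (toℕ i , k , sˡ t) ρ) (sym (toℕ-inject₁ k)) at′)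
      fits : 1 + boolTime (`not here) + (90 + 120 * (toℕ (inject₁ k) ∸ toℕ i)) ≤ 120 * (toℕ j ∸ toℕ i)
      fits = step-fits (subst (λ k → k ∸ toℕ i < toℕ j ∸ toℕ i) (sym (toℕ-inject₁ k))
        (∸-monoˡ-< (tree-≤ R) (≤-trans i≤x (<⇒≤ x<k))))
    ... | tri> _ x≢k k<x = weaken fits (λ _ y → y)
        (whileStep (not-here σ env ex at key≡ rule≡ x≢k)
          (weaken ≤-refl (λ {ρ} fr → next ρ fr) (descend-right σ env ex at key≡ rule≡ k<x)))
      where
      t : ℕ
      t = θ (toℕ i) (toℕ j) S
      key≡ : nat σ keyBank (nat σ cellBank 0) ≡ suc (toℕ k)
      key≡ = trans (cong (nat σ keyBank) ec) (trans (eκ _ _ _) κ≡)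
      rule≡ : nat σ choiceBank (nat σ cellBank 0) ≡ t
      rule≡ = trans (cong (nat σ choiceBank) ec) (eθ _ _ _)
      next : ∀ ρ → Frame descend σ ρ → At (suc (toℕ k) , toℕ j , sʳ t) ρ →
        Run descent ρ (At (find R (sʳ t) x)) (120 * (toℕ j ∸ suc (toℕ k)))
      next ρ fr at′ = descent-run R (sʳ t) x ρ fR (k<x , x<j)
        (Table-frame descend refl fr table) (trans (natF fr xBank refl 0) ex) at′
      fits : 1 + boolTime (`not here) + (90 + 120 * (toℕ j ∸ suc (toℕ k))) ≤ 120 * (toℕ j ∸ toℕ i)
      fits = step-fits (∸-monoʳ-< (s≤s (subst (toℕ i ≤_) (toℕ-inject₁ k) (tree-≤ L))) (tree-≤ R))

    cell≡ : ∀ σ → Env σ → ∀ e f g {i j S} → natVal e σ ≡ i → natVal f σ ≡ j → natVal g σ ≡ S →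
            natVal (cellᵉ e f g) σ ≡ cellIndex i j S
    cell≡ σ (e₀ , e₁ , _) e f g ei ej eS rewrite e₀ | e₁ | ei | ej | eS = refl

    LinkedBy : (ℕ → ℕ) → (ℕ → ℕ) → (ℕ → ℕ) → ℕ → Place → Set
    LinkedBy left right ψ x (i , j , S) = let t = θ i j S in
      (left (suc x) ≡ κ i x (sˡ t)) × (right (suc x) ≡ κ (suc x) j (sʳ t)) × (ψ (suc x) ≡ root t)

    Link : State → ℕ → Place → Set
    Link τ = LinkedBy (nat τ leftBank) (nat τ rightBank) (nat τ ψ-bank)

    Linked : State → ∀ {i j} → Tree {n} i j → ℕ → Set
    Linked τ (leaf j) S = ⊤
    Linked τ (node {i} {j} k L R) S = let t = θ (toℕ i) (toℕ j) S in
      Link τ (toℕ k) (toℕ i , toℕ j , S) × Linked τ L (sˡ t) × Linked τ R (sʳ t)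

    module _ {i j} (k : Fin n) (L : Tree i (inject₁ k)) (R : Tree (suc k) j) (S : ℕ) where

      find-root : find (node k L R) S (toℕ k) ≡ (toℕ i , toℕ j , S)
      find-root with <-cmp (toℕ k) (toℕ k)
      ... | tri< _ k≢k _ = contradiction refl k≢k
      ... | tri≈ _ _ _   = refl
      ... | tri> _ k≢k _ = contradiction refl k≢k

      find-left : ∀ {x} → x < toℕ k → find (node k L R) S x ≡ find L (sˡ (θ (toℕ i) (toℕ j) S)) x
      find-left {x} x<k with <-cmp x (toℕ k)
      ... | tri< _ _ _   = refl
      ... | tri≈ x≮k _ _ = contradiction x<k x≮k
      ... | tri> x≮k _ _ = contradiction x<k x≮k

      find-right : ∀ {x} → toℕ k < x → find (node k L R) S x ≡ find R (sʳ (θ (toℕ i) (toℕ j) S)) x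
      find-right {x} k<x with <-cmp x (toℕ k)
      ... | tri< _ _ k≮x = contradiction k<x k≮x
      ... | tri≈ _ _ k≮x = contradiction k<x k≮x
      ... | tri> _ _ _   = refl

    module _ (T₀ : BST n) (follows₀ : Follows T₀ (D ∸ 1)) where

      Links : ℕ → State → Set
      Links x τ = ∀ y → y < x → Link τ y (find T₀ (D ∸ 1) y)

      -- Passes from the order of the keys, in which the loop writes, to the recursion of the tree.
      -- The hypothesis says that the search from the root for a key within `T` goes through `T`.
      linked : ∀ τ → Links n τ → ∀ {i j} (T : Tree {n} i j) S →
               (∀ y → Within y T → find T₀ (D ∸ 1) y ≡ find T S y) → Linked τ T S
      linked τ links (leaf j) S same = tt
      linked τ links T@(node {i} {j} k L R) S same =
        subst (Link τ (toℕ k)) (trans (same (toℕ k) (i≤k , tree-≤ R)) (find-root k L R S)) (links (toℕ k) (toℕ<n k)) ,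
        linked τ links L _ (λ { y (i≤y , y<k) →
          let y<k = subst (y <_) (toℕ-inject₁ k) y<k
          in trans (same y (i≤y , <-trans y<k (tree-≤ R))) (find-left k L R S y<k) }) ,
        linked τ links R _ (λ { y (k<y , y<j) →
          trans (same y (≤-trans i≤k (<⇒≤ k<y) , y<j)) (find-right k L R S k<y) })
        where
        i≤k : toℕ i ≤ toℕ k
        i≤k = subst (toℕ i ≤_) (toℕ-inject₁ k) (tree-≤ L)

      toWholeTree-run : ∀ σ → Env σ →
        Run toWholeTree σ (λ τ → (nat τ iBank 0 ≡ 0) × (nat τ jBank 0 ≡ n) × (nat τ SBank 0 ≡ D ∸ 1)) 20
      toWholeTree-run σ (en , eD , _) = weaken (≤ᵇ⇒≤ _ 20 tt) (λ _ y → y)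
        (seq (assign (seq (assign (assign (refl , en , cong (_∸ 1) eD))))))

      writeNode-run : ∀ x σ → Table σ → nat σ xBank 0 ≡ x → At (find T₀ (D ∸ 1) x) σ → Links x σ →
        Run writeNode σ (Links (suc x)) 90
      writeNode-run x σ (env , eκ , eθ) ex (ei , ej , eS , ec) links = weaken (≤ᵇ⇒≤ _ 90 tt) (λ _ y → y)
        (seq (assign (seq (assign (seq (assign (assign links′)))))))
        where
        i j S t : ℕ
        i = proj₁ (find T₀ (D ∸ 1) x)
        j = proj₁ (proj₂ (find T₀ (D ∸ 1) x))
        S = proj₂ (proj₂ (find T₀ (D ∸ 1) x))
        t = θ i j S
        ρ : State
        ρ = ⟪ nat σ [ tBank , 0 ↦ nat σ choiceBank (nat σ cellBank 0) ] , num σ ⟫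
        et : nat σ choiceBank (nat σ cellBank 0) ≡ t
        et = trans (cong (nat σ choiceBank) ec) (eθ i j S)
        k : ℕ
        k = suc (nat σ xBank 0)
        left≡ : nat σ keyBank (natVal (cellᵉ (val iBank) (val xBank) (load ruleLeftBank (val tBank))) ρ) ≡ κ i x (sˡ t)
        left≡ = trans (cong (nat σ keyBank) (cell≡ ρ env (val iBank) (val xBank) (load ruleLeftBank (val tBank)) ei ex
          (trans (ruleLeft≡ σ env _) (cong sˡ et)))) (eκ i x (sˡ t))
        right≡ : nat σ keyBank (natVal (cellᵉ (lit 1 ⊕ val xBank) (val jBank) (load ruleRightBank (val tBank))) ρ) ≡ κ (suc x) j (sʳ t)
        right≡ = trans (cong (nat σ keyBank) (cell≡ ρ env (lit 1 ⊕ val xBank) (val jBank) (load ruleRightBank (val tBank))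
          (cong suc ex) ej (trans (ruleRight≡ σ env _) (cong sʳ et)))) (eκ (suc x) j (sʳ t))
        root≡ : nat σ ruleRootBank (nat σ choiceBank (nat σ cellBank 0)) ≡ root t
        root≡ = trans (ruleRoot≡ σ env _) (cong root et)
        _[k≔_] : (ℕ → ℕ) → ℕ → ℕ → ℕ
        (f [k≔ v ]) z = if does (k ≟ z) then v else f z
        links′ : ∀ y → y < suc x → LinkedBy
          (nat σ leftBank [k≔ nat σ keyBank (natVal (cellᵉ (val iBank) (val xBank) (load ruleLeftBank (val tBank))) ρ) ])
          (nat σ rightBank [k≔ nat σ keyBank (natVal (cellᵉ (lit 1 ⊕ val xBank) (val jBank) (load ruleRightBank (val tBank))) ρ) ])
          (nat σ ψ-bank [k≔ nat σ ruleRootBank (nat σ choiceBank (nat σ cellBank 0)) ])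
          y (find T₀ (D ∸ 1) y)
        links′ y (s≤s y≤x) with m≤n⇒m<n∨m≡n y≤x
        ... | inj₂ refl = trans (select-≡ (cong suc ex)) left≡ , trans (select-≡ (cong suc ex)) right≡
                        , trans (select-≡ (cong suc ex)) root≡
        ... | inj₁ y<x = trans (select-≢ ne) (proj₁ old) , trans (select-≢ ne) (proj₁ (proj₂ old))
                       , trans (select-≢ ne) (proj₂ (proj₂ old))
          where
          old = links y y<x
          ne : k ≢ suc y
          ne eq = <⇒≢ y<x (sym (trans (sym ex) (suc-injective eq)))

      writeTree-run : ∀ σ → Table σ →
        Run writeTree σ (λ τ → (nat τ rootBank 0 ≡ κ 0 n (D ∸ 1)) × Linked τ T₀ (D ∸ 1)) (500 * (n * n))
      writeTree-run σ table@(env , _) = weaken fits (λ {τ} _ (r , links) → r , linked τ links T₀ (D ∸ 1) (λ _ _ → refl))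
        (seq (weaken ≤-refl (λ {ρ} → afterStart ρ) (toWholeTree-run σ env)))
        where
        body : Program
        body = toWholeTree ︔ locate ︔ descent ︔ writeNode
        Inv : ℕ → State → Set
        Inv x τ = (nat τ rootBank 0 ≡ κ 0 n (D ∸ 1)) × Links x τ
        bodyTime : ℕ
        bodyTime = 20 + (30 + (120 * n + 90))
        fits : 20 + (25 + (n * (14 + bodyTime) + 15)) ≤ 500 * (n * n)
        fits = bound-sum 45 400 500 (*-mono-≤ 1≤n 1≤n) (loop-bound 2 300 400 ≤-refl 1≤n 1≤n
          (≤-trans (≤-reflexive (cong (50 +_) (+-comm (120 * n) 90))) (bound-sum 140 120 300 1≤n ≤-refl)))
        step : ∀ ρ x → x < n → nat ρ xBank 0 ≡ x → Table ρ → Inv x ρ → Run body ρ (Inv (suc x)) bodyTime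
        step ρ x x<n ex tableρ@(envρ , _) (r , links) =
          weaken ≤-refl (λ fr links′ → trans (natF fr rootBank refl 0) r , links′)
            (seq (weaken ≤-refl (λ {ρ₁} fr₁ (ei , ej , eS) →
              let table₁ = Table-frame toWholeTree refl fr₁ tableρ in
              seq (weaken ≤-refl (λ {ρ₂} fr₂ at₂ →
                let table₂ = Table-frame locate refl fr₂ table₁
                    ex₂    = trans (natF fr₂ xBank refl 0) (trans (natF fr₁ xBank refl 0) ex) in
                seq (weaken (*-monoʳ-≤ 120 (≤-reflexive (toℕ-fromℕ n))) (λ {ρ₃} fr₃ at₃ →
                  writeNode-run x ρ₃ (Table-frame descent refl fr₃ table₂) (trans (natF fr₃ xBank refl 0) ex₂) at₃
                    (λ y y<x →
                      let a , b , d = links y y<x in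
                      back leftBank refl refl refl fr₁ fr₂ fr₃ a , back rightBank refl refl refl fr₁ fr₂ fr₃ b
                      , back ψ-bank refl refl refl fr₁ fr₂ fr₃ d))
                  (descent-run T₀ (D ∸ 1) x ρ₂ follows₀ (z≤n , subst (x <_) (sym (toℕ-fromℕ n)) x<n) table₂ ex₂
                    (subst (λ m → At (0 , m , D ∸ 1) ρ₂) (sym (toℕ-fromℕ n)) at₂))))
                (locate-run ρ₁ (proj₁ table₁) ei ej eS)))
              (toWholeTree-run ρ envρ)))
          where
          back : ∀ b → writesNat toWholeTree b ≡ false → writesNat locate b ≡ false → writesNat descent b ≡ false →
                 ∀ {ρ₁ ρ₂ ρ₃ z v} → Frame toWholeTree ρ ρ₁ → Frame locate ρ₁ ρ₂ → Frame descent ρ₂ ρ₃ →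
                 nat ρ b z ≡ v → nat ρ₃ b z ≡ v
          back b w₁ w₂ w₃ fr₁ fr₂ fr₃ eq =
            trans (natF fr₃ b w₃ _) (trans (natF fr₂ b w₂ _) (trans (natF fr₁ b w₁ _) eq))
        afterStart : ∀ ρ → Frame toWholeTree σ ρ →
          (nat ρ iBank 0 ≡ 0) × (nat ρ jBank 0 ≡ n) × (nat ρ SBank 0 ≡ D ∸ 1) →
          Run (rootBank [ lit 0 ]≔ load keyBank thisCell ︔ for xBank xLimit nᵉ body) ρ (Inv n)
              (25 + (n * (14 + bodyTime) + 15))
        afterStart ρ fr (ei , ej , eS) = weaken (+-monoˡ-≤ _ (≤ᵇ⇒≤ (2 + natTime (load keyBank thisCell)) 25 tt)) (λ _ y → y)
          (seq (assign (forRun {P = body} {X = xBank} {L = xLimit} {e = nᵉ} Inv n (proj₁ (proj₁ tableρ)) refl refl refl refl id id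
            (trans (cong (nat ρ keyBank) (thisCell≡ ρ (proj₁ tableρ) ei ej eS)) (proj₁ (proj₂ tableρ) 0 n (D ∸ 1)) , λ _ ())
            (λ x x<n ex fr′ inv → step _ x x<n ex (Table-frame (for xBank xLimit nᵉ body) refl fr′ tableρ) inv))))
          where
          tableρ : Table ρ
          tableρ = Table-frame toWholeTree refl fr table

-- The arithmetic of the time bound

module TimeBound where

  open Codes using (^-distribʳ-*)
  open import Data.Nat.Base
  open import Data.Nat.Properties
  open import Relation.Binary.PropositionalEquality
  open import Data.Nat.Tactic.RingSolver using (solve-∀)

  -- The left side consists of the first two terms of the binomial expansion of the right side.
  bernoulli : ∀ a m → a ^ suc m + suc m * a ^ m ≤ suc a ^ suc m
  bernoulli a zero    = ≤-reflexive (lemma a)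
    where
    lemma : ∀ a → a * 1 + 1 ≡ suc a * 1
    lemma = solve-∀
  bernoulli a (suc m) = begin
    a * (a * x) + suc (suc m) * (a * x)            ≤⟨ m≤m+n _ (suc m * x) ⟩
    a * (a * x) + suc (suc m) * (a * x) + suc m * x ≡⟨ lemma a m x ⟩
    suc a * (a * x + suc m * x)                    ≤⟨ *-monoʳ-≤ (suc a) (bernoulli a m) ⟩
    suc a * suc a ^ suc m ∎
    where
    open ≤-Reasoning
    x : ℕ
    x = a ^ m
    lemma : ∀ a m x → a * (a * x) + suc (suc m) * (a * x) + suc m * x ≡ suc a * (a * x + suc m * x)
    lemma = solve-∀

  -- The inductive step comes down to 2 (g + 1)^(g + 1) ≤ (g + 2)^(g + 1), which is `bernoulli` with
  -- base g + 1, where both terms on the left are equal.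
  2^g*g!≤ : ∀ g → 2 ^ g * g ! ≤ suc g ^ g
  2^g*g!≤ zero    = ≤-refl
  2^g*g!≤ (suc g) = begin
    2 * 2 ^ g * (suc g * g !)       ≡⟨ lemma (2 ^ g) (suc g) (g !) ⟩
    2 * (suc g * (2 ^ g * g !))     ≤⟨ *-monoʳ-≤ 2 (*-monoʳ-≤ (suc g) (2^g*g!≤ g)) ⟩
    2 * (suc g * suc g ^ g)         ≡⟨ cong (suc g ^ suc g +_) (+-identityʳ _) ⟩
    suc g ^ suc g + suc g * suc g ^ g ≤⟨ bernoulli (suc g) g ⟩
    suc (suc g) ^ suc g ∎
    where
    open ≤-Reasoning
    lemma : ∀ x y z → 2 * x * (y * z) ≡ 2 * (y * (x * z))
    lemma = solve-∀

  4^g*g!≤ : ∀ g B → 2 * suc g ≤ B → 4 ^ g * g ! ≤ B ^ g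
  4^g*g!≤ g B le = begin
    4 ^ g * g !            ≡⟨ cong (_* g !) (^-distribʳ-* g 2 2) ⟩
    2 ^ g * 2 ^ g * g !    ≡⟨ *-assoc (2 ^ g) (2 ^ g) (g !) ⟩
    2 ^ g * (2 ^ g * g !)  ≤⟨ *-monoʳ-≤ (2 ^ g) (2^g*g!≤ g) ⟩
    2 ^ g * suc g ^ g      ≡⟨ ^-distribʳ-* g 2 (suc g) ⟨
    (2 * suc g) ^ g        ≤⟨ ^-monoˡ-≤ g le ⟩
    B ^ g ∎
    where open ≤-Reasoning

  -- Let B = M + g + 2 and r = M - g - 1. Of the M factors 4, g are combined with g! and bounded by
  -- B^g; r are bounded by B each, since B ≥ 4 as soon as r ≥ 1; the last one becomes the constant,
  -- since B may be as small as 3.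
  4^M*g!≤ : ∀ M g → suc g ≤ M → 4 ^ M * g ! ≤ 4 * (M + suc (suc g)) ^ M
  4^M*g!≤ M g g<M = subst (λ M → 4 ^ M * g ! ≤ 4 * (M + suc (suc g)) ^ M) (m+[n∸m]≡n g<M) (go (M ∸ suc g))
    where
    go : ∀ r → 4 ^ (suc g + r) * g ! ≤ 4 * (suc g + r + suc (suc g)) ^ (suc g + r)
    go r = begin
      4 * 4 ^ (g + r) * g !          ≡⟨ cong (λ x → 4 * x * g !) (^-distribˡ-+-* 4 g r) ⟩
      4 * (4 ^ g * 4 ^ r) * g !      ≡⟨ lemma (4 ^ g) (4 ^ r) (g !) ⟩
      4 * (4 ^ g * g ! * 4 ^ r)      ≤⟨ *-monoʳ-≤ 4 (*-mono-≤ (4^g*g!≤ g B 2+2g≤B) (powers r refl)) ⟩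
      4 * (B ^ g * B ^ r)            ≡⟨ cong (4 *_) (^-distribˡ-+-* B g r) ⟨
      4 * B ^ (g + r)                ≤⟨ *-monoʳ-≤ 4 (m≤n*m (B ^ (g + r)) B) ⟩
      4 * B ^ (suc g + r) ∎
      where
      open ≤-Reasoning
      B : ℕ
      B = suc g + r + suc (suc g)
      lemma : ∀ x y z → 4 * (x * y) * z ≡ 4 * (x * z * y)
      lemma = solve-∀
      size : ∀ g r → suc g + r + suc (suc g) ≡ 2 * suc g + (1 + r)
      size = solve-∀
      2+2g≤B : 2 * suc g ≤ B
      2+2g≤B = ≤-trans (m≤m+n (2 * suc g) (1 + r)) (≤-reflexive (sym (size g r)))
      powers : ∀ r′ → r ≡ r′ → 4 ^ r′ ≤ B ^ r′
      powers zero     _ = ≤-refl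
      powers (suc r′) e = ^-monoˡ-≤ (suc r′) (≤-trans
        (+-mono-≤ (*-monoʳ-≤ 2 (s≤s (z≤n {g}))) (s≤s (subst (1 ≤_) (sym e) (s≤s z≤n))))
        (≤-reflexive (sym (size g r))))

  -- Abstract, so that the literal factors are never unfolded.
  abstract

    runningTime constant : ℕ
    runningTime = 5200
    constant    = 20800

    -- The sum 700 + 4 · 900 + 500 + 400 is 5200, where 4 comes from the two loops bounded by 2n.
    total-time : ∀ {n D N : ℕ} → 1 ≤ n → 1 ≤ D → 1 ≤ N →
      700 * (n * (n * N)) + (900 * (2 * n * (2 * n * (D * (n * N)))) + (500 * (n * n) + 400 * n))
      ≤ runningTime * (n ^ 3 * (D * N))
    total-time {n} {D} {N} 1≤n 1≤D 1≤N = begin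
      700 * (n * (n * N)) + (900 * (2 * n * (2 * n * (D * (n * N)))) + (500 * (n * n) + 400 * n))
        ≤⟨ +-mono-≤ (*-monoʳ-≤ 700 nnN≤) (+-mono-≤ (≤-reflexive (trans (cong (900 *_) (main n D N)) (sym (*-assoc 900 4 Y)))) (+-mono-≤ (*-monoʳ-≤ 500 nn≤) (*-monoʳ-≤ 400 n≤))) ⟩
      700 * Y + (3600 * Y + (500 * Y + 400 * Y))
        ≡⟨ collect ⟩
      5200 * Y ∎
      where
      open ≤-Reasoning
      Y : ℕ
      Y = n ^ 3 * (D * N)
      main : ∀ n D N → 2 * n * (2 * n * (D * (n * N))) ≡ 4 * (n * (n * (n * 1)) * (D * N))
      main = solve-∀
      collect : 700 * Y + (3600 * Y + (500 * Y + 400 * Y)) ≡ 5200 * Y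
      collect = begin-equality
        700 * Y + (3600 * Y + (500 * Y + 400 * Y))  ≡⟨ cong (λ x → 700 * Y + (3600 * Y + x)) (*-distribʳ-+ Y 500 400) ⟨
        700 * Y + (3600 * Y + 900 * Y)              ≡⟨ cong (700 * Y +_) (*-distribʳ-+ Y 3600 900) ⟨
        700 * Y + 4500 * Y                          ≡⟨ *-distribʳ-+ Y 700 4500 ⟨
        5200 * Y                                    ∎
      grow : ∀ x {y} → 1 ≤ y → x ≤ x * y
      grow x 1≤y = ≤-trans (≤-reflexive (sym (*-identityʳ x))) (*-monoʳ-≤ x 1≤y)
      rearrange : ∀ n D N → n * (n * N) * (n * D) ≡ n * (n * (n * 1)) * (D * N)
      rearrange = solve-∀
      nnN≤ : n * (n * N) ≤ Y
      nnN≤ = ≤-trans (grow (n * (n * N)) (*-mono-≤ 1≤n 1≤D)) (≤-reflexive (rearrange n D N))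
      nn≤ : n * n ≤ Y
      nn≤ = ≤-trans (*-monoʳ-≤ n (grow n 1≤N)) nnN≤
      n≤ : n ≤ Y
      n≤ = ≤-trans (grow n 1≤n) nn≤

    -- The constant 20800 is 4 · 5200, with the factor 4 of `4^M*g!≤`.
    time-bound : ∀ t n M h {g} → h ≡ suc (suc g) → suc g ≤ M → t ≤ runningTime * (n ^ 3 * (2 ^ M * 4 ^ M)) →
      t * g ! ≤ constant * (2 ^ M * (M + h) ^ M * n ^ 3)
    time-bound t n M h {g} refl g<M t≤ = begin
      t * g !                                        ≤⟨ *-monoˡ-≤ (g !) t≤ ⟩
      5200 * (n ^ 3 * (2 ^ M * 4 ^ M)) * g !         ≡⟨ trans (*-assoc 5200 (n ^ 3 * (2 ^ M * 4 ^ M)) (g !)) (cong (5200 *_) (before (n ^ 3) (2 ^ M) (4 ^ M) (g !))) ⟩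
      5200 * (n ^ 3 * (2 ^ M * (4 ^ M * g !)))       ≤⟨ *-monoʳ-≤ 5200 (*-monoʳ-≤ (n ^ 3) (*-monoʳ-≤ (2 ^ M) (4^M*g!≤ M g g<M))) ⟩
      5200 * (n ^ 3 * (2 ^ M * (4 * B ^ M)))         ≡⟨ trans (cong (5200 *_) (after (n ^ 3) (2 ^ M) (B ^ M))) (sym (*-assoc 5200 4 (2 ^ M * B ^ M * n ^ 3))) ⟩
      20800 * (2 ^ M * B ^ M * n ^ 3) ∎
      where
      open ≤-Reasoning
      B : ℕ
      B = M + suc (suc g)
      before : ∀ x y z w → x * (y * z) * w ≡ x * (y * (z * w))
      before = solve-∀
      after : ∀ x y z → x * (y * (4 * z)) ≡ 4 * (y * z * x)
      after = solve-∀

-- Assembling the phases of a run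

module Proof where

  open Semantics
  open Codes
  open Levels
  open Algorithm
  open Search
  open Optimality
  open Setup
  open Addresses
  open Output
  open TimeBound
  open import Data.Nat.Base
  open import Data.Nat.Properties
  open import Relation.Binary.PropositionalEquality

  module Correctness {c ℓ₁ ℓ₂ : Level} (K : OrderedCommutativeRing c ℓ₁ ℓ₂) (I : Model.Instance K) where
    open Model K
    open Logic K
    open Initialisation K I
    open Instance I hiding (p; q)
    private
      module ≈ = OrderedCommutativeRing K

    Solved : State → Set ℓ₂
    Solved τ = Σ[ S ∈ Solution I ] (Stores I τ S × Optimum I S)

    -- Each nested module fixes the state reached by one more phase, so that the tables found in
    -- that state can be the parameters of the results about the next.
    module AfterSetup (σ τ₁ : State) (holds : Holds I σ) (fr₁ : Frame setup σ τ₁) (ready : Ready τ₁) where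
      open Ready ready

      price s sˡ sʳ root : ℕ → ℕ
      price = nat τ₁ priceBank
      s     = nat τ₁ ruleBank
      sˡ    = nat τ₁ ruleLeftBank
      sʳ    = nat τ₁ ruleRightBank
      root  = nat τ₁ ruleRootBank

      p q : ℕ → ≈.Carrier
      p = num τ₁ p-bank
      q = num τ₁ q-bank

      module O = Optimal K I M refl price s sˡ sʳ root p q
        (λ k → ≈.trans (≈.reflexive (numF fr₁ p-bank refl _)) (Holds.p-cell holds k))
        (λ j → ≈.trans (≈.reflexive (numF fr₁ q-bank refl _)) (Holds.q-cell holds j))
        price-slow price-address s-enc sˡ-enc sʳ-enc root-enc

      module DP = DynamicProgram K n D N price s sˡ sʳ root p q 1≤n 1≤D 1≤N O.sˡ<D O.sʳ<D

      env : DP.Env τ₁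
      env = trans (natF fr₁ sizeBank refl 0) (Holds.n-cell holds) , subsets≡ , rules≡
          , (λ _ → refl) , (λ _ → refl) , (λ _ → refl) , (λ _ → refl) , (λ _ → refl) , (λ _ → refl) , (λ _ → refl)

      module AfterTable (τ₂ : State) (fr₂ : Frame table τ₁ τ₂)
        (settled : ∀ i j S → i ≤ j → j ≤ n → S < D → DP.Settled τ₂ i j S) where

        V : ℕ → ℕ → ℕ → ≈.Carrier
        V = DP.V-of τ₂

        κ θ : ℕ → ℕ → ℕ → ℕ
        κ = DP.K-of τ₂
        θ = DP.T-of τ₂

        all : ℕ
        all = D ∸ 1

        all<D : all < D
        all<D = ≤-reflexive (m+[n∸m]≡n 1≤D)

        open Following n D N s sˡ sʳ root κ θ
        module W = Writing K n D N price s sˡ sʳ root p q 1≤n 1≤D 1≤N O.sˡ<D O.sʳ<D κ θ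

        best-tree : Σ[ T ∈ BST n ] Follows T all
        best-tree = O.extract V κ θ settled n zero (fromℕ n) all z≤n (≤-reflexive (toℕ-fromℕ n)) all<D

        T₀ : BST n
        T₀ = proj₁ best-tree

        follows₀ : Follows T₀ all
        follows₀ = proj₂ best-tree

        tableOf : W.Table τ₂
        tableOf = DP.Env-frame table refl fr₂ env , (λ _ _ _ → refl) , (λ _ _ _ → refl)

        module AfterTree (τ₃ : State) (fr₃ : Frame writeTree τ₂ τ₃)
          (root≡ : nat τ₃ rootBank 0 ≡ κ 0 n all) (linked : W.Linked τ₃ T₀ all) where

          ψ : ℕ → ℕ
          ψ = nat τ₃ ψ-bank

          recorded : ∀ {i j} (T : Tree {n} i j) S → W.Linked τ₃ T S → Recorded ψ T S
          recorded (leaf j)     S _                        = tt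
          recorded (node k L R) S ((_ , _ , ψ≡) , lL , lR) = ψ≡ , recorded L _ lL , recorded R _ lR

          recorded₀ : Recorded ψ T₀ all
          recorded₀ = recorded T₀ all linked

          within₀ : ∀ {k} → k < n → Within k T₀
          within₀ k<n = z≤n , subst (_ <_) (sym (toℕ-fromℕ n)) k<n

          all≡ : enc 2 M (λ _ → 1) ≡ all
          all≡ = cong (_∸ 1) (suc-enc-ones M)

          ψ≤n : ∀ k → InRange n k → ψ k ≤ n
          ψ≤n (suc k) (_ , k<n) with ψ (suc k) in eq
          ... | zero  = z≤n
          ... | suc a = ≤-trans
            (proj₁ (O.available-to V κ θ settled ψ T₀ follows₀ recorded₀ (within₀ k<n) eq (λ _ → 1) (λ _ → ≤-refl) all≡))
            (m∸n≤m n m-last)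

          ψ-unique : ∀ k k′ → InRange n k → InRange n k′ → 1 ≤ ψ k → ψ k ≡ ψ k′ → k ≡ k′
          ψ-unique (suc k) (suc k′) (_ , k<n) (_ , k′<n) 1≤ψ eq with ψ (suc k) in eqk
          ... | suc a = cong suc (O.ψ-unique V κ θ settled ψ T₀ follows₀ recorded₀ (within₀ k<n) (within₀ k′<n) eqk (sym eq))

          module A = Assignment K n 1≤n ψ ψ≤n ψ-unique

          module AfterAddresses (τ₄ : State) (fr₄ : Frame assignAddresses τ₃ τ₄) (done : A.Inv n τ₄) where

            address : Fin n → ℕ
            address k = nat τ₄ φ-bank (suc (toℕ k))

            inverse : ∀ k → InRange n (address k) × (nat τ₄ inverseBank (address k) ≡ suc (toℕ k))
            inverse k = proj₁ (proj₁ done) (suc (toℕ k)) (s≤s z≤n , toℕ<n k)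

            suc-pred-address : ∀ k → suc (address k ∸ 1) ≡ address k
            suc-pred-address k = m+[n∸m]≡n (proj₁ (proj₁ (inverse k)))

            φ : Fin n → Fin n
            φ k = fromℕ< (subst (_≤ n) (sym (suc-pred-address k)) (proj₂ (proj₁ (inverse k))))

            address≡ : ∀ k → address k ≡ suc (toℕ (φ k))
            address≡ k = trans (sym (suc-pred-address k)) (cong suc (sym (toℕ-fromℕ< _)))

            φ-injective : Injective _≡_ _≡_ φ
            φ-injective {k} {k′} eq = toℕ-injective (suc-injective
              (trans (sym (proj₂ (inverse k))) (trans (cong (nat τ₄ inverseBank)
                (trans (address≡ k) (trans (cong (suc ∘ toℕ) eq) (sym (address≡ k′))))) (proj₂ (inverse k′)))))

            solution : Solution I
            solution = record { T = T₀ ; φ = φ ; φ-injective = φ-injective }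

            slowest : ∀ a → μ a ≤ price 0
            slowest a with m≤n⇒m<n∨m≡n (s≤s⁻¹ (toℕ<n (levelOf m a)))
            ... | inj₁ lt = ≤-trans (<⇒≤ (cₗ-< (subst (toℕ (levelOf m a) <_) (sym (toℕ-fromℕ (suc h-2))) lt)))
                              (≤-reflexive (sym price-slow))
            ... | inj₂ e  = ≤-reflexive (trans
              (cong cₗ (toℕ-injective (trans e (sym (toℕ-fromℕ (suc h-2)))))) (sym price-slow))

            cheap : ∀ k {t} → ψ (suc (toℕ k)) ≡ root t → μ (φ k) ≤ price (root t)
            cheap k {t} eq with root t
            ... | zero  = slowest (φ k)
            ... | suc a = ≤-reflexive (trans (sym (price-address (φ k))) (cong price (trans (sym (address≡ k))
              (trans (proj₂ done (suc (toℕ k)) (s≤s z≤n) (toℕ<n k) (subst (1 ≤_) (sym eq) (s≤s z≤n))) eq))))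

            priced : ∀ {i j} (T : Tree i j) S → Recorded ψ T S → O.Priced V κ θ settled φ T S
            priced (leaf j)     S _               = tt
            priced (node k L R) S (eq , rL , rR) = cheap k eq , priced L _ rL , priced R _ rR

            points : ∀ {i j} (T : Tree i j) {S i′ j′} → i′ ≡ toℕ i → j′ ≡ toℕ j → Follows T S → W.Linked τ₃ T S →
                     PointsTo I τ₄ (κ i′ j′ S) T
            points (leaf j) {S} refl refl S<D _ =
              subst (λ x → PointsTo I τ₄ x (leaf j))
                (sym (O.κ-empty V κ θ settled (toℕ j) S (s≤s⁻¹ (toℕ<n j)) S<D)) external
            points (node k L R) {S} refl refl (κ≡ , _ , _ , fL , fR) ((left≡ , right≡ , _) , lL , lR) =
              subst (λ x → PointsTo I τ₄ x (node k L R)) (sym κ≡) (internal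
                (subst (λ x → PointsTo I τ₄ x L) (sym (trans (natF fr₄ leftBank refl _) left≡))
                  (points L refl (sym (toℕ-inject₁ k)) fL lL))
                (subst (λ x → PointsTo I τ₄ x R) (sym (trans (natF fr₄ rightBank refl _) right≡))
                  (points R refl refl fR lR)))

            stores : Stores I τ₄ solution
            stores = record
              { T-cells = subst (λ x → PointsTo I τ₄ x T₀) (sym (trans (natF fr₄ rootBank refl 0) root≡))
                            (points T₀ refl (sym (toℕ-fromℕ n)) follows₀ linked)
              ; φ-cells = address≡
              }

            optimum : Optimum I solution
            optimum S′ = ≈.≤-trans
              (O.totalCost≤V V κ θ settled φ T₀ refl (sym (toℕ-fromℕ n)) follows₀ (priced T₀ all recorded₀))
              -- The full set covers every assignment, so the lower bound at the cell of the whole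
              -- tree applies to every competitor.
              (subst (λ x → V 0 n x ≈.≤ cost I S′) all≡
                (O.V≤totalCost V κ θ settled (Solution.φ S′) (Solution.φ-injective S′) (Solution.T S′)
                  refl (sym (toℕ-fromℕ n)) (λ _ → 1) (λ _ → ≤-refl) (λ _ _ _ _ → refl)))

            solved : Solved τ₄
            solved = solution , stores , optimum

          assign-run : Run assignAddresses τ₃ Solved (400 * n)
          assign-run = weaken ≤-refl (λ {τ₄} fr₄ done → AfterAddresses.solved τ₄ fr₄ done)
            (A.assignAddresses-run τ₃ (trans (natF fr₃ sizeBank refl 0) (proj₁ (proj₁ tableOf))) (λ _ → refl))

        write-run : Run (writeTree ︔ assignAddresses) τ₂ Solved (500 * (n * n) + 400 * n)
        write-run = seq (weaken ≤-refl (λ {τ₃} fr₃ (r , linked) → AfterTree.assign-run τ₃ fr₃ r linked)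
          (W.writeTree-run T₀ follows₀ τ₂ tableOf))

      fill-run : Run (table ︔ writeTree ︔ assignAddresses) τ₁ Solved (DP.tableTime + (500 * (n * n) + 400 * n))
      fill-run = seq (weaken ≤-refl (λ {τ₂} fr₂ settled → AfterTable.write-run τ₂ fr₂ settled) (DP.table-run τ₁ env))

    algorithm-run : ∀ σ → Holds I σ → Run algorithm σ Solved (runningTime * (n ^ 3 * (D * N)))
    algorithm-run σ holds = weaken (total-time {n} {D} {N} 1≤n 1≤D 1≤N) (λ _ x → x)
      (seq (weaken ≤-refl (λ {τ₁} fr₁ ready → AfterSetup.fill-run σ τ₁ holds fr₁ ready) (setup-run σ holds)))

    solves : ∀ σ → Holds I σ → Σ[ τ ∈ State ] Σ[ t ∈ ℕ ]
      (⟨ algorithm , σ ⟩⇓⟨ τ , t ⟩ × Solved τ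
      × t * (h-2 !) ≤ constant * (2 ^ (n ∸ m-last) * (n ∸ m-last + h) ^ (n ∸ m-last) * n ^ 3))
    solves σ holds = conclude (algorithm-run σ holds)
      where
      conclude : Run algorithm σ Solved (runningTime * (n ^ 3 * (D * N))) → _
      conclude (run {τ} {t} steps solved bound) =
        τ , t , steps , solved , time-bound t n (n ∸ m-last) h refl (levels≤fast (suc h-2) m m-pos) bound

open Algorithm using (algorithm)
open TimeBound using (constant)
open Proof using (module Correctness)
open import Data.Nat.Base using (ℕ; _+_; _*_; _∸_; _^_; _!; _≤_)

mainTheorem2 : ∀ {c ℓ₁ ℓ₂} (K : OrderedCommutativeRing c ℓ₁ ℓ₂) →
    let open Model K in
    Σ[ P ∈ Program ] Σ[ C ∈ ℕ ]
    ((I : Instance) → let open Instance I in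
    (σ : State) → Holds I σ →
    Σ[ τ ∈ State ] Σ[ t ∈ ℕ ]
    (⟨ P , σ ⟩⇓⟨ τ , t ⟩
    × (Σ[ S ∈ Solution I ] (Stores I τ S × Optimum I S))
    × t * (h-2 !) ≤ C * (2 ^ (n ∸ m-last) * (n ∸ m-last + h) ^ (n ∸ m-last) * n ^ 3)))
mainTheorem2 K = algorithm , constant , Correctness.solves K
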